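{- Let $s, t \in \mathbb{N}^+$ and $s' \in \mathbb{N}$, and assume that $t \ge s^3 - 1$ whenever $s - s' \ge 2$. If the rooted tree $F := T_{s,t,s'}$ is balanced, then for every $p \in \mathbb{N}^+$ we have $\operatorname{ex}(n, F^p) = O(n^{2-1/\rho_F})$ as $n \to \infty$ (the implied constant depending on $s,t,s',p$), where $\rho_F = (st + t + s')/(t + 1)$.
   Context: A rooted graph is a graph $F$ together with a subset $R(F)$ of its vertices, called roots. For integers $s \ge 1$, $t \ge 0$, $s' \ge 0$, the rooted tree $T_{s,t,s'}$ consists of a vertex $v_0$; $t$ vertices $q_1,\dots,q_t$ each adjacent to $v_0$; for each $j$, $s$ further vertices adjacent only to $q_j$; and $s'$ further vertices adjacent only to $v_0$. Its root set consists of these $ts + s'$ leaves (so $v_0, q_1, \dots, q_t$ are the non-roots; for $t=0$ it is the star $K_{1,s'}$ with its leaves as roots). For a rooted graph $F$, its $p$th power $F^p$ is obtained by taking $p$ disjoint copies of $F$ and identifying the copies of each root (reducing multiple edges between roots). The density of a rooted graph $F$ is $\rho_F = e(F)/(v(F) - |R(F)|)$. $F$ is balanced if $\rho_F > 1$ and for every subset $S \subseteq V(F)\setminus R(F)$ the number of edges of $F$ with at least one endpoint in $S$ is at least $\rho_F |S|$. For a graph $H$, $\operatorname{ex}(n,H)$ is the maximum number of edges in an $n$-vertex graph containing no subgraph isomorphic to $H$. -}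

module Defs where

open import Data.Nat using (ℕ; zero; suc; _+_; _*_; _≤_; _<_; _<ᵇ_)
open import Data.Bool using (Bool; true; false; _∧_; _∨_; if_then_else_)
open import Data.Fin using (Fin; zero; suc; toℕ; splitAt; remQuot; _≟_)
open import Data.Sum using (_⊎_; inj₁; inj₂)
open import Data.Product using (Σ; _×_; _,_; proj₁; ∃)
open import Relation.Nullary using (¬_)
open import Relation.Nullary.Decidable using (⌊_⌋)
open import Relation.Binary.PropositionalEquality using (_≡_; refl)
open import Function.Definitions using (Injective)

sumF : ∀ n → (Fin n → ℕ) → ℕ
sumF zero    f = 0
sumF (suc n) f = f zero + sumF n (λ i → f (suc i))

ind : Bool → ℕ
ind true  = 1
ind false = 0

_<F_ : ∀ {n} → Fin n → Fin n → Bool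
i <F j = toℕ i <ᵇ toℕ j

record SimpleGraph (n : ℕ) : Set where
  field
    adj    : Fin n → Fin n → Bool
    sym    : ∀ u v → adj u v ≡ adj v u
    irrefl : ∀ u → adj u u ≡ false

edges : ∀ {n} → SimpleGraph n → ℕ
edges {n} G = sumF n λ i → sumF n λ j → ind ((i <F j) ∧ SimpleGraph.adj G i j)

Contains : ∀ {n} → SimpleGraph n → (V : Set) → (V → V → Bool) → Set
Contains {n} G V adjH =
  Σ (V → Fin n) λ f → Injective _≡_ _≡_ f ×
    (∀ u v → adjH u v ≡ true → SimpleGraph.adj G (f u) (f v) ≡ true)

-- Rooted graphs: r roots (Fin r) and m non-roots (Fin m)

record RootedGraph : Set where
  field
    r m    : ℕ
    adj    : Fin r ⊎ Fin m → Fin r ⊎ Fin m → Bool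
    sym    : ∀ u v → adj u v ≡ adj v u
    irrefl : ∀ u → adj u u ≡ false

module _ (F : RootedGraph) where
  open RootedGraph F

  eR : ℕ
  eR = (sumF r λ i → sumF r λ j → ind ((i <F j) ∧ adj (inj₁ i) (inj₁ j)))
     + (sumF r λ i → sumF m λ x → ind (adj (inj₁ i) (inj₂ x)))
     + (sumF m λ x → sumF m λ y → ind ((x <F y) ∧ adj (inj₂ x) (inj₂ y)))

  card : (Fin m → Bool) → ℕ
  card S = sumF m λ x → ind (S x)

  eAt : (Fin m → Bool) → ℕ
  eAt S = (sumF r λ i → sumF m λ x → ind (S x ∧ adj (inj₁ i) (inj₂ x)))
        + (sumF m λ x → sumF m λ y → ind ((x <F y) ∧ (S x ∨ S y) ∧ adj (inj₂ x) (inj₂ y)))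

  -- balanced: ρ_F = e(F)/m > 1 and e_S ≥ ρ_F |S| for every S (cleared of denominators)
  Balanced : Set
  Balanced = m < eR × (∀ (S : Fin m → Bool) → eR * card S ≤ eAt S * m)

  PowV : ℕ → Set
  PowV p = Fin r ⊎ (Fin p × Fin m)

  powAdj : ∀ p → PowV p → PowV p → Bool
  powAdj p (inj₁ i)       (inj₁ j)       = adj (inj₁ i) (inj₁ j)
  powAdj p (inj₁ i)       (inj₂ (c , x)) = adj (inj₁ i) (inj₂ x)
  powAdj p (inj₂ (c , x)) (inj₁ j)       = adj (inj₂ x) (inj₁ j)
  powAdj p (inj₂ (c , x)) (inj₂ (d , y)) = ⌊ c ≟ d ⌋ ∧ adj (inj₂ x) (inj₂ y)

-- The rooted tree T_{s,t,s'}
-- non-roots Fin (suc t): zero = v₀, suc j = q_j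
-- roots Fin (t * s + s'): the first t*s are the leaves below the q_j
-- (leaf i lies below q_(i / s)), the last s' are the leaves below v₀.

module _ (s t s' : ℕ) where

  parentT : Fin (t * s + s') → Fin (suc t)
  parentT a with splitAt (t * s) a
  ... | inj₁ b = suc (proj₁ (remQuot {t} s b))
  ... | inj₂ _ = zero

  innerT : Fin (suc t) → Fin (suc t) → Bool
  innerT zero    (suc _) = true
  innerT (suc _) zero    = true
  innerT _       _       = false

  adjT : Fin (t * s + s') ⊎ Fin (suc t) → Fin (t * s + s') ⊎ Fin (suc t) → Bool
  adjT (inj₁ a) (inj₁ b) = false
  adjT (inj₁ a) (inj₂ x) = ⌊ parentT a ≟ x ⌋
  adjT (inj₂ x) (inj₁ a) = ⌊ parentT a ≟ x ⌋
  adjT (inj₂ x) (inj₂ y) = innerT x y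

  innerT-sym : ∀ x y → innerT x y ≡ innerT y x
  innerT-sym zero    zero    = refl
  innerT-sym zero    (suc _) = refl
  innerT-sym (suc _) zero    = refl
  innerT-sym (suc _) (suc _) = refl

  adjT-sym : ∀ u v → adjT u v ≡ adjT v u
  adjT-sym (inj₁ a) (inj₁ b) = refl
  adjT-sym (inj₁ a) (inj₂ x) = refl
  adjT-sym (inj₂ x) (inj₁ a) = refl
  adjT-sym (inj₂ x) (inj₂ y) = innerT-sym x y

  adjT-irrefl : ∀ u → adjT u u ≡ false
  adjT-irrefl (inj₁ a)       = refl
  adjT-irrefl (inj₂ zero)    = refl
  adjT-irrefl (inj₂ (suc _)) = refl

  T : RootedGraph
  T = record { r = t * s + s' ; m = suc t ; adj = adjT
             ; sym = adjT-sym ; irrefl = adjT-irrefl }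

{-# OPTIONS --safe #-}
-- Write a = s + 1, N = s' + t, e = e(F) = s t + N and m = t + 1.  The proof rests
-- on two counting facts about a graph (V, E) with no copy of Fᵖ.
--
-- (1) Star bound: the number of homomorphic K_{a,a} is at most a constant times
--     the number of homomorphic stars K_{1,a}.  Otherwise some a vertices w have
--     a common neighbourhood X in which a positive proportion of the a-tuples
--     have many common neighbours; a Kővári–Sós–Turán count inside X gives the
--     v's and u's of Fᵖ, the q's are found greedily, and the w's serve as roots.
--     So most stars have leaves with few common neighbours, and the common
--     neighbourhoods satisfy Σ |N(v) ∩ N(v')|^N ≤ const · |V| D^N as N ≥ a.
-- (2) Second moment: for a choice W of roots count the centres v that extend to
--     a copy of F through such light stars.  If W has no p centres with disjoint
--     extensions, then by Turán a positive proportion of the pairs of its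
--     centres conflict, i.e. share some q.  Conflicting pairs are controlled
--     through (1), so the second moment is O(first moment), whereas
--     Cauchy–Schwarz makes it larger when D^e ≥ C |V|^(e-m).
--
-- The maximum degree D is obtained by induction on the number of vertices:
-- either the few vertices of large degree, together with a small chunk of the
-- rest, span a denser graph, or deleting them keeps half of the edges.
-- The only balanced case with N < a that the hypotheses allow is t = 1, where
-- exchanging v₀ and q₁ turns T_{s,1,s'} into T_{s',1,s}.

module Submission where

open import Defs
open import Data.Nat
open import Data.Nat.Properties hiding (_≟_)
open import Data.Nat.DivMod using (m/n*n≤m; m≡m%n+[m/n]*n; m%n<n)
open import Data.Nat.Tactic.RingSolver using (solve-∀)
open import Data.Bool using (Bool; true; false; _∧_; _∨_; not)
open import Data.Bool.Properties using (T-≡; ∧-comm; ∧-idem; ∧-zeroʳ; ∧-identityʳ)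
open import Data.List using (List; []; _∷_; _++_; length; map; concatMap; filterᵇ; take; drop; tabulate; allFin)
open import Data.List.Properties using (length-++; length-take; length-drop; take++drop≡id; length-tabulate)
open import Data.List.Membership.Propositional using (_∈_; _∉_; find)
open import Data.List.Membership.Propositional.Properties using (∈-map⁻; ∈-concatMap⁻; ∈-++⁺ˡ; ∈-++⁺ʳ)
open import Data.List.Relation.Unary.Any using (here; there)
open import Data.List.Relation.Unary.All using (All; []; _∷_)
open import Data.List.Relation.Unary.AllPairs using ([]; _∷_)
open import Data.List.Relation.Unary.Unique.Propositional using (Unique)
import Data.List.Relation.Unary.Unique.Propositional.Properties as Unique
open import Data.Vec using (Vec; []; _∷_; lookup; toList)
open import Data.Vec.Properties using (length-toList)
open import Data.Product using (Σ; ∃; _×_; _,_; proj₁; proj₂)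
open import Data.Sum using (_⊎_; inj₁; inj₂)
open import Data.Empty using (⊥; ⊥-elim)
open import Data.Fin using (Fin; zero; suc; inject≤; combine; remQuot; splitAt)
import Data.Fin as Fin
open import Data.Fin.Properties using (inject≤-injective; combine-injective; remQuot-combine; combine-remQuot; join-splitAt; splitAt-↑ˡ; splitAt-↑ʳ)
open import Function using (Equivalence)
open import Function.Definitions using (Injective)
open import Relation.Nullary using (¬_; yes; no)
open import Relation.Nullary.Decidable using (⌊_⌋)
open import Relation.Binary.Definitions using (DecidableEquality)
open import Relation.Binary.PropositionalEquality using (module ≡-Reasoning; _≡_; _≢_; refl; sym; trans; cong; cong₂; subst)

-- Finite sums

-- Three estimates close by absorption: a constant is chosen so that the unwanted term is at most
-- half of the quantity to be bounded and cancels. In the star bound the K_{a,a} are counted from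
-- both sides, so the dense part returns as exactly one copy of a doubled quantity; for light stars
-- L₀ is taken large against the star constant; in the second moment `lam` is at least 2·μ.
--
-- The cap L₀ on the common neighbours of a light star lets whole common neighbourhoods be kept away
-- from all other tuples at cost O(D^s). Hence the q's need not be counted or coordinated: any
-- common neighbour will do.
--
-- The obstacle is a pair v, v′ with so many common neighbours that most W may conflict. Its
-- contribution is of order D^(s·t)·|N(v) ∩ N(v′)|^N, and the star bound is available for powers at
-- least a. Balancedness yields s ≤ s' + t, one short of a ≤ N; the condition on s - s' addresses
-- this gap.
--
-- Rational exponents are cleared throughout: with g = e - m, the bound reads E^e ≤ C·k^(e+g).

infixr 7 _·_
_·_ : Bool → ℕ → ℕ
b · n = ind b * n

ind≤1 : ∀ b → ind b ≤ 1
ind≤1 true  = ≤-refl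
ind≤1 false = z≤n

ind-∧ : ∀ a b → ind (a ∧ b) ≡ ind a * ind b
ind-∧ true  b = sym (+-identityʳ (ind b))
ind-∧ false b = refl

ind-∨ : ∀ a b → ind (a ∨ b) ≤ ind a + ind b
ind-∨ true  b = s≤s z≤n
ind-∨ false b = ≤-refl

ind-mono : ∀ {a b} → (a ≡ true → b ≡ true) → ind a ≤ ind b
ind-mono {false} f = z≤n
ind-mono {true}  f rewrite f refl = ≤-refl

∧-elim : ∀ {a b} → a ∧ b ≡ true → a ≡ true × b ≡ true
∧-elim {true} {true} _ = refl , refl

∧-intro : ∀ {a b} → a ≡ true → b ≡ true → a ∧ b ≡ true
∧-intro refl refl = refl

not-true : ∀ {a} → not a ≡ true → a ≡ false
not-true {false} _ = refl

module _ {X : Set} where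

  ∑ : List X → (X → ℕ) → ℕ
  ∑ []       f = 0
  ∑ (x ∷ xs) f = f x + ∑ xs f

  count : List X → (X → Bool) → ℕ
  count xs P = ∑ xs λ x → ind (P x)

  ∑-cong : ∀ xs {f g : X → ℕ} → (∀ x → f x ≡ g x) → ∑ xs f ≡ ∑ xs g
  ∑-cong []       e = refl
  ∑-cong (x ∷ xs) e = cong₂ _+_ (e x) (∑-cong xs e)

  ∑-mono-∈ : ∀ xs {f g : X → ℕ} → (∀ {x} → x ∈ xs → f x ≤ g x) → ∑ xs f ≤ ∑ xs g
  ∑-mono-∈ []       e = z≤n
  ∑-mono-∈ (x ∷ xs) e = +-mono-≤ (e (here refl)) (∑-mono-∈ xs (λ i → e (there i)))

  ∑-mono : ∀ xs {f g : X → ℕ} → (∀ x → f x ≤ g x) → ∑ xs f ≤ ∑ xs g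
  ∑-mono xs e = ∑-mono-∈ xs (λ {x} _ → e x)

  ∑-zero : ∀ xs → ∑ xs (λ _ → 0) ≡ 0
  ∑-zero []       = refl
  ∑-zero (x ∷ xs) = ∑-zero xs

  ∑-const : ∀ xs c → ∑ xs (λ _ → c) ≡ length xs * c
  ∑-const []       c = refl
  ∑-const (x ∷ xs) c = cong (c +_) (∑-const xs c)

  ∑-+ : ∀ xs (f g : X → ℕ) → ∑ xs (λ x → f x + g x) ≡ ∑ xs f + ∑ xs g
  ∑-+ []       f g = refl
  ∑-+ (x ∷ xs) f g rewrite ∑-+ xs f g = interchange (f x) (g x) (∑ xs f) (∑ xs g)
    where interchange : ∀ a b c d → a + b + (c + d) ≡ a + c + (b + d)
          interchange = solve-∀

  ∑-*ˡ : ∀ xs c (f : X → ℕ) → ∑ xs (λ x → c * f x) ≡ c * ∑ xs f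
  ∑-*ˡ []       c f = sym (*-zeroʳ c)
  ∑-*ˡ (x ∷ xs) c f rewrite ∑-*ˡ xs c f = sym (*-distribˡ-+ c (f x) (∑ xs f))

  ∑-*ʳ : ∀ xs c (f : X → ℕ) → ∑ xs (λ x → f x * c) ≡ ∑ xs f * c
  ∑-*ʳ xs c f = trans (∑-cong xs (λ x → *-comm (f x) c)) (trans (∑-*ˡ xs c f) (*-comm c (∑ xs f)))

  ∑-++ : ∀ xs ys (f : X → ℕ) → ∑ (xs ++ ys) f ≡ ∑ xs f + ∑ ys f
  ∑-++ []       ys f = refl
  ∑-++ (x ∷ xs) ys f rewrite ∑-++ xs ys f = sym (+-assoc (f x) _ _)

  ∑-∃< : ∀ xs {f g : X → ℕ} → ∑ xs f < ∑ xs g → ∃ λ x → x ∈ xs × f x < g x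
  ∑-∃< (x ∷ xs) {f} {g} lt with f x <? g x
  ... | yes p = x , here refl , p
  ... | no ¬p with ∑-∃< xs {f} {g} (+-cancelˡ-< (f x) _ _ (<-≤-trans lt (+-monoˡ-≤ _ (≮⇒≥ ¬p))))
  ...   | y , i , q = y , there i , q

  ∑-∃≤ : ∀ xs {f g : X → ℕ} → 0 < length xs → ∑ xs f ≤ ∑ xs g → ∃ λ x → x ∈ xs × f x ≤ g x
  ∑-∃≤ (x ∷ xs) {f} {g} _ le with f x ≤? g x
  ... | yes p = x , here refl , p
  ... | no ¬p with ∑-∃< xs {f} {g} (+-cancelˡ-< (g x) _ _ (<-≤-trans (+-monoˡ-< _ (≰⇒> ¬p)) le))
  ...   | y , i , q = y , there i , <⇒≤ q

  count-mono : ∀ xs {P Q : X → Bool} → (∀ x → P x ≡ true → Q x ≡ true) → count xs P ≤ count xs Q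
  count-mono xs e = ∑-mono xs (λ x → ind-mono (e x))

  count-∨ : ∀ xs (P Q : X → Bool) → count xs (λ x → P x ∨ Q x) ≤ count xs P + count xs Q
  count-∨ xs P Q = ≤-trans (∑-mono xs (λ x → ind-∨ (P x) (Q x))) (≤-reflexive (∑-+ xs _ _))

  count-∖ : ∀ xs (P Q : X → Bool) → count xs P ≤ count xs (λ x → P x ∧ Q x) + count xs (λ x → P x ∧ not (Q x))
  count-∖ xs P Q = ≤-trans (∑-mono xs (λ x → pt (P x) (Q x))) (≤-reflexive (∑-+ xs _ _))
    where pt : ∀ a b → ind a ≤ ind (a ∧ b) + ind (a ∧ not b)
          pt true true   = ≤-refl
          pt true false  = ≤-refl
          pt false b     = z≤n

  count≤length : ∀ xs P → count xs P ≤ length xs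
  count≤length xs P = ≤-trans (∑-mono xs (λ x → ind≤1 (P x))) (≤-reflexive (trans (∑-const xs 1) (*-identityʳ _)))

  count-false : ∀ xs {P : X → Bool} → (∀ x → P x ≡ false) → count xs P ≡ 0
  count-false xs e = trans (∑-cong xs (λ x → cong ind (e x))) (∑-zero xs)

  ∈⇒1≤count : ∀ {x xs} {P : X → Bool} → x ∈ xs → P x ≡ true → 1 ≤ count xs P
  ∈⇒1≤count (here refl) e rewrite e = s≤s z≤n
  ∈⇒1≤count (there i)   e = ≤-trans (∈⇒1≤count i e) (m≤n+m _ _)

  ∑-filter : ∀ P xs (f : X → ℕ) → ∑ (filterᵇ P xs) f ≡ ∑ xs (λ x → P x · f x)
  ∑-filter P []       f = refl
  ∑-filter P (x ∷ xs) f with P x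
  ... | true  = cong₂ _+_ (sym (+-identityʳ (f x))) (∑-filter P xs f)
  ... | false = ∑-filter P xs f

  ∑-filter≤ : ∀ P xs (f : X → ℕ) → ∑ (filterᵇ P xs) f ≤ ∑ xs f
  ∑-filter≤ P xs f = ≤-trans (≤-reflexive (∑-filter P xs f))
    (∑-mono xs (λ x → ≤-trans (*-monoˡ-≤ (f x) (ind≤1 (P x))) (≤-reflexive (+-identityʳ (f x)))))

  ∑-partition : ∀ P xs (f : X → ℕ) → ∑ xs f ≡ ∑ (filterᵇ P xs) f + ∑ (filterᵇ (λ x → not (P x)) xs) f
  ∑-partition P xs f = sym (trans (cong₂ _+_ (∑-filter P xs f) (∑-filter (λ x → not (P x)) xs f)) (trans (sym (∑-+ xs _ _)) (∑-cong xs (λ x → pt (P x) (f x)))))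
    where pt : ∀ b n → b · n + not b · n ≡ n
          pt true  n = trans (+-identityʳ _) (+-identityʳ n)
          pt false n = +-identityʳ n

  length≡∑1 : ∀ (xs : List X) → length xs ≡ ∑ xs (λ _ → 1)
  length≡∑1 xs = sym (trans (∑-const xs 1) (*-identityʳ _))

  length-filter : ∀ P (xs : List X) → length (filterᵇ P xs) ≡ count xs P
  length-filter P xs = trans (length≡∑1 (filterᵇ P xs)) (trans (∑-filter P xs _) (∑-cong xs (λ x → *-identityʳ _)))

  ∈-filter⁻ : ∀ P {x : X} xs → x ∈ filterᵇ P xs → x ∈ xs × P x ≡ true
  ∈-filter⁻ P (y ∷ xs) i with P y in eq
  ∈-filter⁻ P (y ∷ xs) (here refl) | true = here refl , eq
  ∈-filter⁻ P (y ∷ xs) (there i)   | true with ∈-filter⁻ P xs i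
  ... | j , e = there j , e
  ∈-filter⁻ P (y ∷ xs) i | false with ∈-filter⁻ P xs i
  ... | j , e = there j , e

  ∈-filter⁺ : ∀ P {x : X} {xs} → x ∈ xs → P x ≡ true → x ∈ filterᵇ P xs
  ∈-filter⁺ P {x} {.x ∷ xs} (here refl) e rewrite e = here refl
  ∈-filter⁺ P {x} {y ∷ xs} (there i) e with P y
  ... | true  = there (∈-filter⁺ P i e)
  ... | false = ∈-filter⁺ P i e

  1≤count⇒∈ : ∀ xs {P : X → Bool} → 1 ≤ count xs P → ∃ λ x → x ∈ xs × P x ≡ true
  1≤count⇒∈ (x ∷ xs) {P} le with P x in eq
  ... | true  = x , here refl , eq
  ... | false with 1≤count⇒∈ xs le
  ...   | y , i , e = y , there i , e

module _ {X Y : Set} where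

  ∑-swap : ∀ (xs : List X) (ys : List Y) (f : X → Y → ℕ) →
           ∑ xs (λ x → ∑ ys (f x)) ≡ ∑ ys (λ y → ∑ xs (λ x → f x y))
  ∑-swap []       ys f = sym (∑-zero ys)
  ∑-swap (x ∷ xs) ys f rewrite ∑-swap xs ys f = sym (∑-+ ys (f x) _)

  ∑-map : ∀ (g : X → Y) xs (f : Y → ℕ) → ∑ (map g xs) f ≡ ∑ xs (λ x → f (g x))
  ∑-map g []       f = refl
  ∑-map g (x ∷ xs) f = cong (f (g x) +_) (∑-map g xs f)

  ∑-concatMap : ∀ (g : X → List Y) xs (f : Y → ℕ) → ∑ (concatMap g xs) f ≡ ∑ xs (λ x → ∑ (g x) f)
  ∑-concatMap g []       f = refl
  ∑-concatMap g (x ∷ xs) f = trans (∑-++ (g x) _ f) (cong (∑ (g x) f +_) (∑-concatMap g xs f))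

  ∑-prod : ∀ (xs : List X) (ys : List Y) (f : X → ℕ) (g : Y → ℕ) →
           ∑ xs (λ x → ∑ ys (λ y → f x * g y)) ≡ ∑ xs f * ∑ ys g
  ∑-prod xs ys f g = trans (∑-cong xs (λ x → ∑-*ˡ ys (f x) g)) (∑-*ʳ xs (∑ ys g) f)

-- Tuples over a list

module _ {X : Set} where

  tuples : ∀ m → List X → List (Vec X m)
  tuples zero    xs = [] ∷ []
  tuples (suc m) xs = concatMap (λ x → map (x ∷_) (tuples m xs)) xs

  ∑-tuples : ∀ m xs (f : Vec X (suc m) → ℕ) →
             ∑ (tuples (suc m) xs) f ≡ ∑ xs (λ x → ∑ (tuples m xs) (λ u → f (x ∷ u)))
  ∑-tuples m xs f = trans (∑-concatMap _ xs f) (∑-cong xs (λ x → ∑-map (x ∷_) (tuples m xs) f))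

  allV : ∀ {m} → (X → Bool) → Vec X m → Bool
  allV P []      = true
  allV P (x ∷ u) = P x ∧ allV P u

  allV-lookup : ∀ {m} P (u : Vec X m) → allV P u ≡ true → ∀ i → P (lookup u i) ≡ true
  allV-lookup P (x ∷ u) e zero    = proj₁ (∧-elim e)
  allV-lookup P (x ∷ u) e (suc i) = allV-lookup P u (proj₂ (∧-elim {P x} e)) i

  allV-intro : ∀ {m} P (u : Vec X m) → (∀ i → P (lookup u i) ≡ true) → allV P u ≡ true
  allV-intro P []      e = refl
  allV-intro P (x ∷ u) e = ∧-intro (e zero) (allV-intro P u (λ i → e (suc i)))

  ∑-tuples-filter : ∀ m P xs (f : Vec X m → ℕ) →
                    ∑ (tuples m xs) (λ u → allV P u · f u) ≡ ∑ (tuples m (filterᵇ P xs)) f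
  ∑-tuples-filter zero    P xs f = +-identityʳ (f [] + 0)
  ∑-tuples-filter (suc m) P xs f = let open ≡-Reasoning in begin
    ∑ (tuples (suc m) xs) (λ u → allV P u · f u)
      ≡⟨ ∑-tuples m xs _ ⟩
    ∑ xs (λ x → ∑ (tuples m xs) (λ u → ind (P x ∧ allV P u) * f (x ∷ u)))
      ≡⟨ ∑-cong xs (λ x → trans (∑-cong (tuples m xs) (λ u → trans (cong (_* f (x ∷ u)) (ind-∧ (P x) (allV P u))) (*-assoc (ind (P x)) _ _))) (∑-*ˡ (tuples m xs) (ind (P x)) _)) ⟩
    ∑ xs (λ x → P x · ∑ (tuples m xs) (λ u → allV P u · f (x ∷ u)))
      ≡⟨ ∑-cong xs (λ x → cong (ind (P x) *_) (∑-tuples-filter m P xs (λ u → f (x ∷ u)))) ⟩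
    ∑ xs (λ x → P x · ∑ (tuples m (filterᵇ P xs)) (λ u → f (x ∷ u)))
      ≡⟨ sym (∑-filter P xs _) ⟩
    ∑ (filterᵇ P xs) (λ x → ∑ (tuples m (filterᵇ P xs)) (λ u → f (x ∷ u)))
      ≡⟨ sym (∑-tuples m (filterᵇ P xs) f) ⟩
    ∑ (tuples (suc m) (filterᵇ P xs)) f ∎

  count-allV : ∀ m P xs → count (tuples m xs) (allV P) ≡ count xs P ^ m
  count-allV zero    P xs = refl
  count-allV (suc m) P xs = trans (∑-tuples m xs _)
    (trans (∑-cong xs (λ x → ∑-cong (tuples m xs) (λ u → ind-∧ (P x) (allV P u))))
    (trans (∑-prod xs (tuples m xs) _ _) (cong (count xs P *_) (count-allV m P xs))))

  length-tuples : ∀ m (xs : List X) → length (tuples m xs) ≡ length xs ^ m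
  length-tuples m xs = trans (length≡∑1 (tuples m xs)) (trans (∑-cong (tuples m xs) (λ u → sym (allT u)))
      (trans (count-allV m (λ _ → true) xs) (cong (_^ m) (sym (length≡∑1 xs)))))
    where allT : ∀ {m} (u : Vec X m) → ind (allV (λ _ → true) u) ≡ 1
          allT []      = refl
          allT (x ∷ u) = allT u

  tuples-∈ : ∀ m (xs : List X) {u : Vec X m} → u ∈ tuples m xs → ∀ i → lookup u i ∈ xs
  tuples-∈ (suc m) xs i j with ∈-concatMap⁻ _ {xs = xs} i
  ... | k with find k
  ... | x , x∈ , l with ∈-map⁻ (x ∷_) l
  tuples-∈ (suc m) xs i zero    | k | x , x∈ , l | u , u∈ , refl = x∈
  tuples-∈ (suc m) xs i (suc j) | k | x , x∈ , l | u , u∈ , refl = tuples-∈ m xs u∈ j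

-- Inequalities for powers and power means

rearrange² : ∀ a b c d → a ≤ b → c ≤ d → a * d + b * c ≤ a * c + b * d
rearrange² a b c d a≤b c≤d with m≤n⇒∃[o]m+o≡n a≤b | m≤n⇒∃[o]m+o≡n c≤d
... | x , refl | y , refl = ≤-trans (m≤m+n _ (x * y)) (≤-reflexive (id4 a c x y))
  where id4 : ∀ a c x y → a * (c + y) + (a + x) * c + x * y ≡ a * c + (a + x) * (c + y)
        id4 = solve-∀

rearrange-power : ∀ N a b → a * b ^ N + b * a ^ N ≤ a * a ^ N + b * b ^ N
rearrange-power N a b with ≤-total a b
... | inj₁ a≤b = rearrange² a b (a ^ N) (b ^ N) a≤b (^-monoˡ-≤ N a≤b)
... | inj₂ b≤a = ≤-trans (≤-reflexive (+-comm (a * b ^ N) _))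
                 (≤-trans (rearrange² b a (b ^ N) (a ^ N) b≤a (^-monoˡ-≤ N b≤a)) (≤-reflexive (+-comm (b * b ^ N) _)))

[m*n]^k : ∀ m n k → (m * n) ^ k ≡ m ^ k * n ^ k
[m*n]^k m n zero    = refl
[m*n]^k m n (suc k) rewrite [m*n]^k m n k = lem m n (m ^ k) (n ^ k)
  where lem : ∀ a b c d → a * b * (c * d) ≡ a * c * (b * d)
        lem = solve-∀

module _ {X : Set} where

  -- f and f^N are similarly ordered, so the rearrangement inequality holds for every pair (x, y).
  -- Summing over all ordered pairs produces each side twice, hence the cancelled factor 2.
  chebyshev : ∀ (xs : List X) (f : X → ℕ) N → ∑ xs f * ∑ xs (λ x → f x ^ N) ≤ length xs * ∑ xs (λ x → f x ^ suc N)
  chebyshev xs f N = *-cancelˡ-≤ 2 (begin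
    2 * (∑ xs f * ∑ xs (λ x → f x ^ N))
      ≡⟨ cong (∑ xs f * ∑ xs (λ x → f x ^ N) +_) (+-identityʳ _) ⟩
    ∑ xs f * ∑ xs (λ x → f x ^ N) + ∑ xs f * ∑ xs (λ x → f x ^ N)
      ≡⟨ cong₂ _+_ (sym (∑-prod xs xs f _)) (trans (sym (∑-prod xs xs f _)) (∑-swap xs xs _)) ⟩
    ∑ xs (λ x → ∑ xs (λ y → f x * f y ^ N)) + ∑ xs (λ x → ∑ xs (λ y → f y * f x ^ N))
      ≡⟨ sym (∑-+ xs _ _) ⟩
    ∑ xs (λ x → ∑ xs (λ y → f x * f y ^ N) + ∑ xs (λ y → f y * f x ^ N))
      ≡⟨ ∑-cong xs (λ x → sym (∑-+ xs _ _)) ⟩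
    ∑ xs (λ x → ∑ xs (λ y → f x * f y ^ N + f y * f x ^ N))
      ≤⟨ ∑-mono xs (λ x → ∑-mono xs (λ y → rearrange-power N (f x) (f y))) ⟩
    ∑ xs (λ x → ∑ xs (λ y → f x ^ suc N + f y ^ suc N))
      ≡⟨ ∑-cong xs (λ x → ∑-+ xs _ _) ⟩
    ∑ xs (λ x → ∑ xs (λ y → f x ^ suc N) + S)
      ≡⟨ ∑-+ xs _ _ ⟩
    ∑ xs (λ x → ∑ xs (λ y → f x ^ suc N)) + ∑ xs (λ x → S)
      ≡⟨ cong₂ _+_ (trans (∑-swap xs xs _) (∑-const xs S)) (∑-const xs S) ⟩
    length xs * S + length xs * S
      ≡⟨ cong (length xs * S +_) (sym (+-identityʳ _)) ⟩
    2 * (length xs * S) ∎)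
    where open ≤-Reasoning
          S = ∑ xs (λ x → f x ^ suc N)

  power-mean⁺ : ∀ (xs : List X) (f : X → ℕ) N → ∑ xs f ^ suc N ≤ length xs ^ N * ∑ xs (λ x → f x ^ suc N)
  power-mean⁺ xs f zero    = ≤-reflexive (trans (*-identityʳ _) (trans (∑-cong xs (λ x → sym (*-identityʳ (f x)))) (sym (+-identityʳ _))))
  power-mean⁺ xs f (suc N) = begin
    ∑ xs f * ∑ xs f ^ suc N                                       ≤⟨ *-monoʳ-≤ (∑ xs f) (power-mean⁺ xs f N) ⟩
    ∑ xs f * (length xs ^ N * ∑ xs (λ x → f x ^ suc N))           ≡⟨ lem (∑ xs f) (length xs ^ N) _ ⟩
    length xs ^ N * (∑ xs f * ∑ xs (λ x → f x ^ suc N))           ≤⟨ *-monoʳ-≤ (length xs ^ N) (chebyshev xs f (suc N)) ⟩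
    length xs ^ N * (length xs * ∑ xs (λ x → f x ^ suc (suc N)))  ≡⟨ lem′ (length xs ^ N) (length xs) _ ⟩
    length xs ^ suc N * ∑ xs (λ x → f x ^ suc (suc N))            ∎
    where open ≤-Reasoning
          lem : ∀ a b c → a * (b * c) ≡ b * (a * c)
          lem = solve-∀
          lem′ : ∀ a b c → a * (b * c) ≡ (b * a) * c
          lem′ = solve-∀

  -- The additional factor `length xs` on both sides admits N = 0, where the form of `power-mean⁺`
  -- would need the exponent -1.
  power-mean : ∀ (xs : List X) (f : X → ℕ) N → ∑ xs f ^ N * length xs ≤ length xs ^ N * ∑ xs (λ x → f x ^ N)
  power-mean xs f zero    = ≤-reflexive (cong (1 *_) (length≡∑1 xs))
  power-mean xs f (suc N) = ≤-trans (*-monoˡ-≤ (length xs) (power-mean⁺ xs f N)) (≤-reflexive (lem (length xs ^ N) _ _))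
    where lem : ∀ a b c → a * b * c ≡ c * a * b
          lem = solve-∀

∸-half : ∀ x b → 2 * b ≤ x → x ≤ 2 * (x ∸ b)
∸-half x b le with m≤n⇒∃[o]m+o≡n le
... | o , refl = begin
  2 * b + o            ≤⟨ m≤m+n (2 * b + o) o ⟩
  2 * b + o + o        ≡⟨ lem b o ⟩
  2 * (b + o)          ≡⟨ cong (2 *_) (sym (m+n∸m≡n b (b + o))) ⟩
  2 * (b + (b + o) ∸ b) ≡⟨ cong (λ z → 2 * (z ∸ b)) (lem′ b o) ⟩
  2 * (2 * b + o ∸ b)  ∎
  where open ≤-Reasoning
        lem : ∀ b o → 2 * b + o + o ≡ 2 * (b + o)
        lem = solve-∀
        lem′ : ∀ b o → b + (b + o) ≡ 2 * b + o
        lem′ = solve-∀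

∸-half-^ : ∀ x b a → 2 * b ≤ x → x ^ a ≤ 2 ^ a * (x ∸ b) ^ a
∸-half-^ x b a le = ≤-trans (^-monoˡ-≤ a (∸-half x b le)) (≤-reflexive ([m*n]^k 2 (x ∸ b) a))

-- Discarding b choices costs a factor 2 per coordinate as long as 2·b ≤ x; below that, x^a is
-- itself at most a constant.
∸-half-^+ : ∀ x b a → x ^ a ≤ 2 ^ a * (x ∸ b) ^ a + (2 * b) ^ a
∸-half-^+ x b a with ≤-total (2 * b) x
... | inj₁ le = ≤-trans (∸-half-^ x b a le) (m≤m+n _ _)
... | inj₂ le = ≤-trans (^-monoˡ-≤ a le) (m≤n+m _ _)

-- Bernoulli's inequality in a subtractive form that survives b > n. It bounds the tuples in an
-- n-set that meet b given vertices.
bernoulli : ∀ n b s → n ^ suc s ≤ (n ∸ b) ^ suc s + suc s * b * n ^ s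
bernoulli n b zero    = begin
  n * 1                                ≡⟨ *-identityʳ n ⟩
  n                                    ≤⟨ m≤n+m∸n n b ⟩
  b + (n ∸ b)                          ≡⟨ lem b (n ∸ b) ⟩
  (n ∸ b) * 1 + 1 * b * 1              ∎
  where open ≤-Reasoning
        lem : ∀ b x → b + x ≡ x * 1 + 1 * b * 1
        lem = solve-∀
bernoulli n b (suc s) = begin
  n * n ^ suc s                                    ≤⟨ *-monoʳ-≤ n (bernoulli n b s) ⟩
  n * (m ^ suc s + suc s * b * n ^ s)              ≡⟨ lem₁ n (m ^ suc s) (suc s * b) (n ^ s) ⟩
  n * m ^ suc s + suc s * b * n ^ suc s            ≤⟨ +-monoˡ-≤ _ (*-monoˡ-≤ (m ^ suc s) (m≤n+m∸n n b)) ⟩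
  (b + m) * m ^ suc s + suc s * b * n ^ suc s      ≡⟨ lem₂ b m (m ^ suc s) (suc s * b * n ^ suc s) ⟩
  m ^ suc (suc s) + (b * m ^ suc s + suc s * b * n ^ suc s)
      ≤⟨ +-monoʳ-≤ (m ^ suc (suc s)) (+-monoˡ-≤ _ (*-monoʳ-≤ b (^-monoˡ-≤ (suc s) (m∸n≤m n b)))) ⟩
  m ^ suc (suc s) + (b * n ^ suc s + suc s * b * n ^ suc s)
      ≡⟨ cong (m ^ suc (suc s) +_) (lem₃ b (n ^ suc s) s) ⟩
  m ^ suc (suc s) + suc (suc s) * b * n ^ suc s    ∎
  where open ≤-Reasoning
        m = n ∸ b
        lem₁ : ∀ n x c y → n * (x + c * y) ≡ n * x + c * (n * y)
        lem₁ = solve-∀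
        lem₂ : ∀ b m x y → (b + m) * x + y ≡ m * x + (b * x + y)
        lem₂ = solve-∀
        lem₃ : ∀ b x s → b * x + suc s * b * x ≡ suc (suc s) * b * x
        lem₃ = solve-∀

[x+y]^N≤ : ∀ x y N → (x + y) ^ N ≤ 2 ^ N * (x ^ N + y ^ N)
[x+y]^N≤ x y N with ≤-total x y
... | inj₁ x≤y = ≤-trans (^-monoˡ-≤ N (≤-trans (+-monoˡ-≤ y x≤y) (≤-reflexive (cong (y +_) (sym (+-identityʳ y))))))
                 (≤-trans (≤-reflexive ([m*n]^k 2 y N)) (*-monoʳ-≤ (2 ^ N) (m≤n+m _ _)))
... | inj₂ y≤x = ≤-trans (^-monoˡ-≤ N (≤-trans (+-monoʳ-≤ x y≤x) (≤-reflexive (cong (x +_) (sym (+-identityʳ x))))))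
                 (≤-trans (≤-reflexive ([m*n]^k 2 x N)) (*-monoʳ-≤ (2 ^ N) (m≤m+n _ _)))

-- Tuples with distinct entries

module _ {A : Set} (_≟_ : DecidableEquality A) where

  mem : A → List A → Bool
  mem x []       = false
  mem x (y ∷ ys) = ⌊ x ≟ y ⌋ ∨ mem x ys

  mem-false : ∀ x ys → mem x ys ≡ false → x ∉ ys
  mem-false x (y ∷ ys) e (here refl) with x ≟ x
  mem-false x (y ∷ ys) () (here refl) | yes _
  ... | no x≢x = x≢x refl
  mem-false x (y ∷ ys) e (there i) with x ≟ y
  mem-false x (y ∷ ys) () (there i) | yes _
  ... | no _ = mem-false x ys e i

  mem-true : ∀ x ys → mem x ys ≡ true → x ∈ ys
  mem-true x (y ∷ ys) e with x ≟ y
  ... | yes refl = here refl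
  ... | no _     = there (mem-true x ys e)

  ∈⇒mem : ∀ {x ys} → x ∈ ys → mem x ys ≡ true
  ∈⇒mem {x} {ys} i with mem x ys in eq
  ... | true  = refl
  ... | false = ⊥-elim (mem-false x ys eq i)

  count-≡ : ∀ {xs} → Unique xs → ∀ y → count xs (λ x → ⌊ x ≟ y ⌋) ≤ 1
  count-≡ {[]}     []       y = z≤n
  count-≡ {x ∷ xs} (p ∷ ps) y with x ≟ y
  ... | no _     = count-≡ ps y
  ... | yes refl = s≤s (≤-reflexive (none xs p))
    where none : ∀ xs → All (x ≢_) xs → count xs (λ z → ⌊ z ≟ x ⌋) ≡ 0
          none []       []       = refl
          none (z ∷ zs) (q ∷ qs) with z ≟ x
          ... | yes refl = ⊥-elim (q refl)
          ... | no _     = none zs qs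

  count-mem : ∀ {xs} → Unique xs → ∀ ys → count xs (λ x → mem x ys) ≤ length ys
  count-mem {xs} un []       = ≤-reflexive (∑-zero xs)
  count-mem {xs} un (y ∷ ys) = ≤-trans (count-∨ xs (λ x → ⌊ x ≟ y ⌋) (λ x → mem x ys)) (+-mono-≤ (count-≡ un y) (count-mem un ys))

  distinct : ∀ {m} → List A → Vec A m → Bool
  distinct S []      = true
  distinct S (x ∷ u) = not (mem x S) ∧ distinct (x ∷ S) u

  distinct-∉ : ∀ {m} S (u : Vec A m) → distinct S u ≡ true → ∀ i → lookup u i ∉ S
  distinct-∉ S (x ∷ u) e zero    = mem-false x S (not-true (proj₁ (∧-elim e)))
  distinct-∉ S (x ∷ u) e (suc i) j = distinct-∉ (x ∷ S) u (proj₂ (∧-elim {not (mem x S)} e)) i (there j)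

  distinct-inj : ∀ {m} S (u : Vec A m) → distinct S u ≡ true → ∀ i j → lookup u i ≡ lookup u j → i ≡ j
  distinct-inj S (x ∷ u) e zero    zero    _ = refl
  distinct-inj S (x ∷ u) e zero    (suc j) q = ⊥-elim (distinct-∉ (x ∷ S) u (proj₂ (∧-elim {not (mem x S)} e)) j (here (sym q)))
  distinct-inj S (x ∷ u) e (suc i) zero    q = ⊥-elim (distinct-∉ (x ∷ S) u (proj₂ (∧-elim {not (mem x S)} e)) i (here q))
  distinct-inj S (x ∷ u) e (suc i) (suc j) q = cong suc (distinct-inj (x ∷ S) u (proj₂ (∧-elim {not (mem x S)} e)) i j q)

  -- A falling factorial, weakened to a pure power by letting every coordinate lose the same
  -- `length S + m` values; powers are what the convexity arguments accept.
  count-distinct : ∀ {xs} → Unique xs → ∀ P m S →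
    (count xs P ∸ (length S + m)) ^ m ≤ count (tuples m xs) (λ u → allV P u ∧ distinct S u)
  count-distinct un P zero    S = s≤s z≤n
  count-distinct {xs} un P (suc m) S = begin
    c * c ^ m
      ≤⟨ *-monoˡ-≤ (c ^ m) step ⟩
    count xs (λ x → P x ∧ not (mem x S)) * c ^ m
      ≡⟨ sym (∑-*ʳ xs (c ^ m) _) ⟩
    ∑ xs (λ x → (P x ∧ not (mem x S)) · c ^ m)
      ≤⟨ ∑-mono xs (λ x → *-monoʳ-≤ (ind (P x ∧ not (mem x S))) (≤-trans (≤-reflexive (cong (λ z → (count xs P ∸ z) ^ m) (+-suc (length S) m))) (count-distinct un P m (x ∷ S)))) ⟩
    ∑ xs (λ x → (P x ∧ not (mem x S)) · count (tuples m xs) (λ u → allV P u ∧ distinct (x ∷ S) u))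
      ≡⟨ ∑-cong xs (λ x → sym (∑-*ˡ (tuples m xs) (ind (P x ∧ not (mem x S))) _)) ⟩
    ∑ xs (λ x → ∑ (tuples m xs) (λ u → ind (P x ∧ not (mem x S)) * ind (allV P u ∧ distinct (x ∷ S) u)))
      ≡⟨ ∑-cong xs (λ x → ∑-cong (tuples m xs) (λ u → bool (P x) (not (mem x S)) (allV P u) (distinct (x ∷ S) u))) ⟩
    ∑ xs (λ x → count (tuples m xs) (λ u → allV P (x ∷ u) ∧ distinct S (x ∷ u)))
      ≡⟨ sym (∑-tuples m xs _) ⟩
    count (tuples (suc m) xs) (λ u → allV P u ∧ distinct S u) ∎
    where
    open ≤-Reasoning
    c = count xs P ∸ (length S + suc m)
    step : c ≤ count xs (λ x → P x ∧ not (mem x S))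
    step = m≤n+o⇒m∸n≤o (count xs P) (length S + suc m) (begin
      count xs P                                                                  ≤⟨ count-∖ xs P (λ x → mem x S) ⟩
      count xs (λ x → P x ∧ mem x S) + count xs (λ x → P x ∧ not (mem x S))       ≤⟨ +-monoˡ-≤ _ (count-mono xs (λ x e → proj₂ (∧-elim {P x} e))) ⟩
      count xs (λ x → mem x S) + count xs (λ x → P x ∧ not (mem x S))             ≤⟨ +-monoˡ-≤ _ (≤-trans (count-mem un S) (m≤m+n (length S) (suc m))) ⟩
      length S + suc m + count xs (λ x → P x ∧ not (mem x S))                     ∎)
    bool : ∀ a b c d → ind (a ∧ b) * ind (c ∧ d) ≡ ind ((a ∧ c) ∧ (b ∧ d))
    bool false b     c     d = refl
    bool true  false false d = refl
    bool true  false true  d = refl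
    bool true  true  c     d = +-identityʳ _

  -- The factor D on the left stands for the exponent m - 1 on the right: r has m possible positions
  -- and fixes one of the m entries.
  count-tuples-containing : ∀ {xs} → Unique xs → ∀ P D → count xs P ≤ D → ∀ r m →
    D * count (tuples m xs) (λ u → allV P u ∧ mem r (toList u)) ≤ m * D ^ m
  count-tuples-containing un P D le r zero = ≤-reflexive (*-zeroʳ D)
  count-tuples-containing {xs} un P D le r (suc m) = begin
    D * count (tuples (suc m) xs) (λ u → allV P u ∧ mem r (toList u))
      ≡⟨ cong (D *_) (∑-tuples m xs _) ⟩
    D * ∑ xs (λ x → count (tuples m xs) (λ u → (P x ∧ allV P u) ∧ (⌊ r ≟ x ⌋ ∨ mem r (toList u))))
      ≤⟨ *-monoʳ-≤ D (∑-mono xs (λ x → ∑-mono (tuples m xs) (λ u → bool (P x) (allV P u) ⌊ r ≟ x ⌋ (mem r (toList u)) ))) ⟩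
    D * ∑ xs (λ x → ∑ (tuples m xs) (λ u → ind ⌊ r ≟ x ⌋ * ind (allV P u) + ind (P x) * ind (allV P u ∧ mem r (toList u))))
      ≡⟨ cong (D *_) (trans (∑-cong xs (λ x → ∑-+ (tuples m xs) _ _)) (trans (∑-+ xs _ _) (cong₂ _+_ (∑-prod xs (tuples m xs) _ _) (∑-prod xs (tuples m xs) _ _)))) ⟩
    D * (count xs (λ x → ⌊ r ≟ x ⌋) * count (tuples m xs) (allV P) + count xs P * R)
      ≤⟨ *-monoʳ-≤ D (+-mono-≤ (*-mono-≤ (≤-trans (count-mono xs (λ x e → flip x e)) (count-≡ un r)) (≤-trans (≤-reflexive (count-allV m P xs)) (^-monoˡ-≤ m le))) (*-monoˡ-≤ R le)) ⟩
    D * (1 * D ^ m + D * R)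
      ≡⟨ lem D (D ^ m) R ⟩
    D ^ suc m + D * (D * R)
      ≤⟨ +-monoʳ-≤ _ (*-monoʳ-≤ D (count-tuples-containing un P D le r m)) ⟩
    D ^ suc m + D * (m * D ^ m)
      ≡⟨ lem′ D (D ^ m) m ⟩
    suc m * D ^ suc m ∎
    where
    open ≤-Reasoning
    R = count (tuples m xs) (λ u → allV P u ∧ mem r (toList u))
    flip : ∀ x → ⌊ r ≟ x ⌋ ≡ true → ⌊ x ≟ r ⌋ ≡ true
    flip x e with r ≟ x
    flip x e | yes refl with r ≟ r
    ... | yes _ = refl
    ... | no n  = ⊥-elim (n refl)
    bool : ∀ a b c d → ind ((a ∧ b) ∧ (c ∨ d)) ≤ ind c * ind b + ind a * ind (b ∧ d)
    bool false b     c     d     = z≤n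
    bool true  false c     d     = z≤n
    bool true  true  true  d     = s≤s z≤n
    bool true  true  false true  = s≤s z≤n
    bool true  true  false false = z≤n
    lem : ∀ D x R → D * (1 * x + D * R) ≡ D * x + D * (D * R)
    lem = solve-∀
    lem′ : ∀ D x m → D * x + D * (m * x) ≡ suc m * (D * x)
    lem′ = solve-∀

-- Threshold tests, searching and independent sets

true-or-false : ∀ b → b ≡ true ⊎ b ≡ false
true-or-false true  = inj₁ refl
true-or-false false = inj₂ refl

≤ᵇ-true : ∀ {m n} → (m ≤ᵇ n) ≡ true → m ≤ n
≤ᵇ-true {m} {n} e = ≤ᵇ⇒≤ m n (Equivalence.from T-≡ e)

≤ᵇ-false : ∀ {m n} → (m ≤ᵇ n) ≡ false → n ≤ m
≤ᵇ-false {m} {n} e with ≤-total n m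
... | inj₁ le = le
... | inj₂ le with trans (sym e) (Equivalence.to T-≡ (≤⇒≤ᵇ le))
...   | ()

module _ {X : Set} where

  count-true : ∀ (xs : List X) → count xs (λ _ → true) ≡ length xs
  count-true xs = sym (length≡∑1 xs)

  count-complement : ∀ (xs : List X) P → count xs P + count xs (λ x → not (P x)) ≡ length xs
  count-complement xs P = trans (sym (∑-+ xs _ _)) (trans (∑-cong xs (λ x → pt (P x))) (sym (length≡∑1 xs)))
    where pt : ∀ b → ind b + ind (not b) ≡ 1
          pt true  = refl
          pt false = refl

  search : ∀ (xs : List X) (f : X → ℕ) c → (∃ λ x → x ∈ xs × f x < c) ⊎ (∀ {x} → x ∈ xs → c ≤ f x)
  search []       f c = inj₂ λ ()
  search (x ∷ xs) f c with f x <? c | search xs f c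
  ... | yes p | _ = inj₁ (x , here refl , p)
  ... | no ¬p | inj₁ (y , i , q) = inj₁ (y , there i , q)
  ... | no ¬p | inj₂ all = inj₂ λ { (here refl) → ≮⇒≥ ¬p ; (there i) → all i }

  -- Turán's theorem with a weaker constant.
  independent-or-dense : ∀ p (conf : X → X → Bool) → (∀ x y → conf x y ≡ conf y x) → ∀ (xs : List X) →
    (Σ (Vec X p) λ u → (∀ i → lookup u i ∈ xs) × (∀ i j → i ≢ j → conf (lookup u i) (lookup u j) ≡ false))
    ⊎ length xs ^ 2 ≤ 4 ^ p * ∑ xs (λ x → count xs (conf x))
  independent-or-dense zero    conf cs xs = inj₁ ([] , (λ ()) , λ ())
  independent-or-dense (suc p) conf cs xs with search xs (λ x → 2 * count xs (conf x)) (length xs)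
  ... | inj₂ all = inj₂ (begin
    length xs ^ 2                               ≡⟨ cong (length xs *_) (*-identityʳ _) ⟩
    length xs * length xs                       ≡⟨ sym (∑-const xs (length xs)) ⟩
    ∑ xs (λ _ → length xs)                      ≤⟨ ∑-mono-∈ xs all ⟩
    ∑ xs (λ x → 2 * count xs (conf x))          ≡⟨ ∑-*ˡ xs 2 _ ⟩
    2 * ∑ xs (λ x → count xs (conf x))          ≤⟨ *-monoˡ-≤ _ (≤-trans (m≤m+n 2 2) (m≤m*n 4 (4 ^ p) {{m^n≢0 4 p}})) ⟩
    4 ^ suc p * ∑ xs (λ x → count xs (conf x))  ∎)
    where open ≤-Reasoning
  ... | inj₁ (x , x∈ , lt) with independent-or-dense p conf cs (filterᵇ (λ y → not (conf x y)) xs)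
  ...   | inj₁ (u , u∈ , nc) = inj₁ (x ∷ u , mem′ , nc′)
    where
    P = λ y → not (conf x y)
    mem′ : ∀ i → lookup (x ∷ u) i ∈ xs
    mem′ zero    = x∈
    mem′ (suc i) = proj₁ (∈-filter⁻ P xs (u∈ i))
    nc′ : ∀ i j → i ≢ j → conf (lookup (x ∷ u) i) (lookup (x ∷ u) j) ≡ false
    nc′ zero    zero    ne = ⊥-elim (ne refl)
    nc′ zero    (suc j) ne = not-true (proj₂ (∈-filter⁻ P xs (u∈ j)))
    nc′ (suc i) zero    ne = trans (cs _ _) (not-true (proj₂ (∈-filter⁻ P xs (u∈ i))))
    nc′ (suc i) (suc j) ne = nc i j (λ e → ne (cong suc e))
  ...   | inj₂ dense = inj₂ (begin
    length xs ^ 2                              ≤⟨ ^-monoˡ-≤ 2 half ⟩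
    (2 * length ys) ^ 2                        ≡⟨ [m*n]^k 2 (length ys) 2 ⟩
    4 * length ys ^ 2                          ≤⟨ *-monoʳ-≤ 4 dense ⟩
    4 * (4 ^ p * ∑ ys (λ y → count ys (conf y))) ≡⟨ sym (*-assoc 4 (4 ^ p) _) ⟩
    4 ^ suc p * ∑ ys (λ y → count ys (conf y)) ≤⟨ *-monoʳ-≤ (4 ^ suc p) sub ⟩
    4 ^ suc p * ∑ xs (λ y → count xs (conf y)) ∎)
    where
    open ≤-Reasoning
    P = λ y → not (conf x y)
    ys = filterᵇ P xs
    sub : ∑ ys (λ y → count ys (conf y)) ≤ ∑ xs (λ y → count xs (conf y))
    sub = ≤-trans (∑-filter≤ P xs _) (∑-mono xs (λ y → ∑-filter≤ P xs _))
    half : length xs ≤ 2 * length ys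
    half = +-cancelˡ-≤ (length xs) _ _ (begin
      length xs + length xs                               ≡⟨ cong₂ _+_ (sym (count-complement xs (conf x))) (sym (count-complement xs (conf x))) ⟩
      (c + c′) + (c + c′)                                 ≡⟨ lem c c′ ⟩
      2 * c + 2 * c′                                      ≤⟨ +-monoˡ-≤ _ (<⇒≤ lt) ⟩
      length xs + 2 * c′                                  ≡⟨ cong (λ z → length xs + 2 * z) (sym (length-filter P xs)) ⟩
      length xs + 2 * length ys ∎)
      where c  = count xs (conf x)
            c′ = count xs P
            lem : ∀ a b → (a + b) + (a + b) ≡ 2 * a + 2 * b
            lem = solve-∀

allV-swap : ∀ {X Y : Set} {m n} (R : X → Y → Bool) (w : Vec X m) (u : Vec Y n) →
            allV (λ x → allV (R x) u) w ≡ allV (λ y → allV (λ x → R x y) w) u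
allV-swap R w u with allV (λ x → allV (R x) u) w in e | allV (λ y → allV (λ x → R x y) w) u in e′
... | true  | true  = refl
... | false | false = refl
... | true  | false = trans (sym (allV-intro _ u (λ j → allV-intro _ w (λ i → allV-lookup _ u (allV-lookup _ w e i) j)))) e′
... | false | true  = trans (sym e) (allV-intro _ w (λ i → allV-intro _ u (λ j → allV-lookup _ w (allV-lookup _ u e′ j) i)))

-- Greedy selection and a Kővári-Sós-Turán count

filter-unique : ∀ {A : Set} (P : A → Bool) {xs} → Unique xs → Unique (filterᵇ P xs)
filter-unique P = Unique.filter⁺ _

-- The first summand makes the loss p·n^s in `dense⇒grid` at most half of the count. The second
-- keeps the tuples that meet the `p + t * s` vertices of a grid below the proportion 1/(2γ)^p.
gridSize : (p s t γ : ℕ) → ℕ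
gridSize p s t γ = 2 * γ * p + (2 * γ) ^ p * (s * (p + t * s))

module Picking {A : Set} (_≟_ : DecidableEquality A) where

  avoid : ∀ {xs} S → Unique xs → length S < length xs → ∃ λ x → x ∈ xs × x ∉ S
  avoid {xs} S un lt with ∑-∃< xs {λ x → ind (mem _≟_ x S)} {λ _ → 1} (≤-<-trans (count-mem _≟_ un S) (<-≤-trans lt (≤-reflexive (length≡∑1 xs))))
  ... | x , i , q = x , i , λ j → 1+n≰n (≤-trans (s≤s (≤-reflexive (cong ind (sym (∈⇒mem _≟_ j))))) q)

  -- Greedy choice: each chosen element moves into S, which leaves `length S + m` unchanged, so the
  -- size condition passes to the remaining lists.
  representatives : ∀ m (N : Fin m → List A) S → (∀ i → Unique (N i)) → (∀ i → length S + m ≤ length (N i)) →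
    Σ (Fin m → A) λ q → (∀ i → q i ∈ N i) × (∀ i → q i ∉ S) × (∀ i j → q i ≡ q j → i ≡ j)
  representatives zero    N S un le = (λ ()) , (λ ()) , (λ ()) , λ ()
  representatives (suc m) N S un le with avoid S (un zero) (≤-trans (s≤s (m≤m+n (length S) m)) (≤-trans (≤-reflexive (sym (+-suc (length S) m))) (le zero)))
  ... | x , x∈ , x∉ with representatives m (λ i → N (suc i)) (x ∷ S) (λ i → un (suc i)) (λ i → ≤-trans (≤-reflexive (sym (+-suc (length S) m))) (le (suc i)))
  ...   | q , q∈ , q∉ , inj = q′ , q∈′ , q∉′ , inj′
    where
    q′ : Fin (suc m) → A
    q′ zero    = x
    q′ (suc i) = q i
    q∈′ : ∀ i → q′ i ∈ N i
    q∈′ zero    = x∈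
    q∈′ (suc i) = q∈ i
    q∉′ : ∀ i → q′ i ∉ S
    q∉′ zero    = x∉
    q∉′ (suc i) j = q∉ i (there j)
    inj′ : ∀ i j → q′ i ≡ q′ j → i ≡ j
    inj′ zero    zero    e = refl
    inj′ zero    (suc j) e = ⊥-elim (q∉ j (here (sym e)))
    inj′ (suc i) zero    e = ⊥-elim (q∉ i (here e))
    inj′ (suc i) (suc j) e = cong suc (inj i j e)

  record DisjointTuples (s t : ℕ) (X S : List A) (Y : Vec A s → Bool) : Set where
    field
      U      : Fin t → Vec A s
      U-∈    : ∀ j i → lookup (U j) i ∈ X
      U-Y    : ∀ j → Y (U j) ≡ true
      U-∉    : ∀ j i → lookup (U j) i ∉ S
      U-inj  : ∀ j i j′ i′ → lookup (U j) i ≡ lookup (U j′) i′ → j ≡ j′ × i ≡ i′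

  lookup-∈ : ∀ {m} (u : Vec A m) i → lookup u i ∈ toList u
  lookup-∈ (x ∷ u) zero    = here refl
  lookup-∈ (x ∷ u) (suc i) = there (lookup-∈ u i)

  -- Greedy choice: the tuples meeting the at most b vertices used so far number at most
  -- s·b·n^(s-1), less than the n^s/Γ tuples in Y. The bound b is for the end of the process, so
  -- that one hypothesis on n serves every round.
  disjoint-tuples : ∀ s₀ X Γ b (Y : Vec A (suc s₀) → Bool) → Unique X → let s = suc s₀ ; n = length X in
    n ^ s ≤ Γ * count (tuples s X) Y → Γ * (s * b) < n →
    ∀ t S → length S + t * s ≤ b → DisjointTuples s t X S Y
  disjoint-tuples s₀ X Γ b Y un dense big zero S le = record { U = λ () ; U-∈ = λ () ; U-Y = λ () ; U-∉ = λ () ; U-inj = λ () }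
  disjoint-tuples s₀ X Γ b Y un dense big (suc t) S le with 1 ≤? count (tuples (suc s₀) X) (λ u → Y u ∧ distinct _≟_ S u)
  ... | no none = ⊥-elim (<⇒≱ big (*-cancelʳ-≤ n _ (n ^ s₀) {{m^n≢0 n s₀ {{>-nonZero (≤-<-trans z≤n big)}}}} (begin
    n * n ^ s₀                        ≤⟨ dense ⟩
    Γ * count Vs Y                     ≤⟨ *-monoʳ-≤ Γ (≤-trans (count-∖ Vs Y (distinct _≟_ S)) (≤-trans (+-monoˡ-≤ _ (≤-pred (≰⇒> none))) (count-mono Vs (λ u e → proj₂ (∧-elim {Y u} e))))) ⟩
    Γ * count Vs (λ u → not (distinct _≟_ S u))    ≤⟨ *-monoʳ-≤ Γ bad ⟩
    Γ * (s * b * n ^ s₀)              ≡⟨ sym (*-assoc Γ (s * b) _) ⟩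
    Γ * (s * b) * n ^ s₀              ∎)))
    where
    open ≤-Reasoning
    s = suc s₀
    n = length X
    Vs = tuples s X
    b′ = length S + s
    b′≤b : b′ ≤ b
    b′≤b = ≤-trans (+-monoʳ-≤ (length S) (m≤m+n s (t * s))) le
    bad : count Vs (λ u → not (distinct _≟_ S u)) ≤ s * b * n ^ s₀
    bad = +-cancelˡ-≤ ((n ∸ b′) ^ s) _ _ (begin
      (n ∸ b′) ^ s + count Vs (λ u → not (distinct _≟_ S u))
        ≤⟨ +-monoˡ-≤ _ (≤-trans (≤-reflexive (cong (λ z → (z ∸ b′) ^ s) (sym (count-true X)))) (≤-trans (count-distinct _≟_ un (λ _ → true) s S) (count-mono Vs (λ u e → proj₂ (∧-elim {allV (λ _ → true) u} e))))) ⟩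
      count Vs (distinct _≟_ S) + count Vs (λ u → not (distinct _≟_ S u))  ≡⟨ count-complement Vs (distinct _≟_ S) ⟩
      length Vs                               ≡⟨ length-tuples s X ⟩
      n ^ s                                  ≤⟨ bernoulli n b′ s₀ ⟩
      (n ∸ b′) ^ s + s * b′ * n ^ s₀         ≤⟨ +-monoʳ-≤ ((n ∸ b′) ^ s) (*-monoˡ-≤ (n ^ s₀) (*-monoʳ-≤ s b′≤b)) ⟩
      (n ∸ b′) ^ s + s * b * n ^ s₀          ∎)
  ... | yes one with 1≤count⇒∈ (tuples (suc s₀) X) one
  ...   | u , u∈ , e with ∧-elim {Y u} e
  ...     | Yu , du = record { U = U′ ; U-∈ = U-∈′ ; U-Y = U-Y′ ; U-∉ = U-∉′ ; U-inj = inj′ }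
    where
    s = suc s₀
    rest : DisjointTuples s t X (toList u ++ S) Y
    rest = disjoint-tuples s₀ X Γ b Y un dense big t (toList u ++ S) (≤-trans (≤-reflexive (trans (cong (_+ t * s) (trans (length-++ (toList u)) (cong (_+ length S) (length-toList u)))) (lem (length S) s (t * s)))) le)
      where lem : ∀ a b c → b + a + c ≡ a + (b + c)
            lem = solve-∀
    open DisjointTuples rest
    U′ : Fin (suc t) → Vec A s
    U′ zero    = u
    U′ (suc j) = U j
    U-∈′ : ∀ j i → lookup (U′ j) i ∈ X
    U-∈′ zero    = tuples-∈ s X u∈
    U-∈′ (suc j) = U-∈ j
    U-Y′ : ∀ j → Y (U′ j) ≡ true
    U-Y′ zero    = Yu
    U-Y′ (suc j) = U-Y j
    U-∉′ : ∀ j i → lookup (U′ j) i ∉ S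
    U-∉′ zero    i k = distinct-∉ _≟_ S u du i k
    U-∉′ (suc j) i k = U-∉ j i (∈-++⁺ʳ (toList u) k)
    inj′ : ∀ j i j′ i′ → lookup (U′ j) i ≡ lookup (U′ j′) i′ → j ≡ j′ × i ≡ i′
    inj′ zero    i zero     i′ q = refl , distinct-inj _≟_ S u du i i′ q
    inj′ zero    i (suc j′) i′ q = ⊥-elim (U-∉ j′ i′ (∈-++⁺ˡ (subst (_∈ toList u) q (lookup-∈ u i))))
    inj′ (suc j) i zero     i′ q = ⊥-elim (U-∉ j i (∈-++⁺ˡ (subst (_∈ toList u) (sym q) (lookup-∈ u i′))))
    inj′ (suc j) i (suc j′) i′ q with U-inj j i j′ i′ q
    ... | refl , e = refl , e

  record Grid (p s t : ℕ) (X : List A) (P : A → Vec A s → Bool) : Set where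
    field
      V      : Vec A p
      V-∈    : ∀ c → lookup V c ∈ X
      V-inj  : ∀ c c′ → lookup V c ≡ lookup V c′ → c ≡ c′
      tuples-disjoint : DisjointTuples s t X (toList V) (λ u → allV (λ v → P v u) V)

  -- Convexity applied to the numbers `f u` of vertices v related to u gives p distinct v's whose
  -- common tuples u still make up a proportion 1/(2γ)^p of all s-tuples, which is dense enough for
  -- `disjoint-tuples`.
  dense⇒grid : ∀ p s₀ t γ X (P : A → Vec A (suc s₀) → Bool) → Unique X → let s = suc s₀ ; n = length X in
    n ^ suc s ≤ γ * ∑ X (λ v → count (tuples s X) (P v)) → gridSize p s t γ < n → Grid p s t X P
  dense⇒grid p s₀ t γ X P un dense big = build (∑-∃≤ (tuples p X) tuples-nonempty averaged)
    where
    open ≤-Reasoning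
    s = suc s₀
    n = length X
    Vs = tuples s X
    Γ = (2 * γ) ^ p
    0<n : 0 < n
    0<n = ≤-<-trans z≤n big
    instance
      n≢0 : NonZero n
      n≢0 = >-nonZero 0<n
      ns≢0 : NonZero (n ^ s)
      ns≢0 = m^n≢0 n s
      nsp≢0 : NonZero ((n ^ s) ^ p)
      nsp≢0 = m^n≢0 (n ^ s) p
    f : Vec A s → ℕ
    f u = count X (λ v → P v u)
    2γp≤n : 2 * γ * p ≤ n
    2γp≤n = <⇒≤ (≤-<-trans (m≤m+n (2 * γ * p) _) big)
    R≤ : ∑ X (λ v → count Vs (P v)) ≤ ∑ Vs (λ u → f u ∸ p) + p * n ^ s
    R≤ = begin
      ∑ X (λ v → count Vs (P v))               ≡⟨ ∑-swap X Vs _ ⟩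
      ∑ Vs f                                   ≤⟨ ∑-mono Vs (λ u → m≤n+m∸n (f u) p) ⟩
      ∑ Vs (λ u → p + (f u ∸ p))               ≡⟨ ∑-+ Vs _ _ ⟩
      ∑ Vs (λ u → p) + ∑ Vs (λ u → f u ∸ p)     ≡⟨ cong (_+ ∑ Vs (λ u → f u ∸ p)) (trans (∑-const Vs p) (trans (cong (_* p) (length-tuples s X)) (*-comm (n ^ s) p))) ⟩
      p * n ^ s + ∑ Vs (λ u → f u ∸ p)         ≡⟨ +-comm (p * n ^ s) _ ⟩
      ∑ Vs (λ u → f u ∸ p) + p * n ^ s         ∎
    first : n * n ^ s ≤ 2 * γ * ∑ Vs (λ u → f u ∸ p)
    first = +-cancelʳ-≤ (n * n ^ s) _ _ (begin
      n * n ^ s + n * n ^ s                          ≡⟨ cong (n * n ^ s +_) (sym (+-identityʳ _)) ⟩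
      2 * n ^ suc s                                  ≤⟨ *-monoʳ-≤ 2 (≤-trans dense (*-monoʳ-≤ γ R≤)) ⟩
      2 * (γ * (∑ Vs (λ u → f u ∸ p) + p * n ^ s))    ≡⟨ lem γ _ p (n ^ s) ⟩
      2 * γ * ∑ Vs (λ u → f u ∸ p) + 2 * γ * p * n ^ s ≤⟨ +-monoʳ-≤ _ (*-monoˡ-≤ (n ^ s) 2γp≤n) ⟩
      2 * γ * ∑ Vs (λ u → f u ∸ p) + n * n ^ s ∎)
      where lem : ∀ g x p y → 2 * (g * (x + p * y)) ≡ 2 * g * x + 2 * g * p * y
            lem = solve-∀
    g : Vec A p → ℕ
    g vv = count Vs (λ u → allV (λ v → P v u) vv ∧ distinct _≟_ [] vv)
    second : ∑ Vs (λ u → (f u ∸ p) ^ p) ≤ ∑ (tuples p X) g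
    second = ≤-trans (∑-mono Vs (λ u → count-distinct _≟_ un (λ v → P v u) p [])) (≤-reflexive (∑-swap Vs (tuples p X) _))
    averaged : ∑ (tuples p X) (λ _ → n ^ s) ≤ ∑ (tuples p X) (λ vv → Γ * g vv)
    averaged = *-cancelˡ-≤ ((n ^ s) ^ p) (begin
      (n ^ s) ^ p * ∑ (tuples p X) (λ _ → n ^ s)        ≡⟨ cong ((n ^ s) ^ p *_) (trans (∑-const (tuples p X) (n ^ s)) (cong (_* n ^ s) (length-tuples p X))) ⟩
      (n ^ s) ^ p * (n ^ p * n ^ s)                     ≡⟨ lem₁ ((n ^ s) ^ p) (n ^ p) (n ^ s) ⟩
      n ^ p * (n ^ s) ^ p * n ^ s                       ≡⟨ cong (_* n ^ s) (sym ([m*n]^k n (n ^ s) p)) ⟩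
      (n * n ^ s) ^ p * n ^ s                           ≤⟨ *-monoˡ-≤ (n ^ s) (^-monoˡ-≤ p first) ⟩
      (2 * γ * ∑ Vs (λ u → f u ∸ p)) ^ p * n ^ s         ≡⟨ cong (_* n ^ s) ([m*n]^k (2 * γ) _ p) ⟩
      Γ * ∑ Vs (λ u → f u ∸ p) ^ p * n ^ s               ≡⟨ *-assoc Γ _ (n ^ s) ⟩
      Γ * (∑ Vs (λ u → f u ∸ p) ^ p * n ^ s)             ≤⟨ *-monoʳ-≤ Γ (≤-trans (≤-reflexive (cong (∑ Vs (λ u → f u ∸ p) ^ p *_) (sym (length-tuples s X)))) (power-mean Vs (λ u → f u ∸ p) p)) ⟩
      Γ * (length Vs ^ p * ∑ Vs (λ u → (f u ∸ p) ^ p))    ≡⟨ cong (λ z → Γ * (z ^ p * ∑ Vs (λ u → (f u ∸ p) ^ p))) (length-tuples s X) ⟩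
      Γ * ((n ^ s) ^ p * ∑ Vs (λ u → (f u ∸ p) ^ p))     ≤⟨ *-monoʳ-≤ Γ (*-monoʳ-≤ ((n ^ s) ^ p) second) ⟩
      Γ * ((n ^ s) ^ p * ∑ (tuples p X) g)              ≡⟨ lem₂ Γ ((n ^ s) ^ p) _ ⟩
      (n ^ s) ^ p * (Γ * ∑ (tuples p X) g)              ≡⟨ cong ((n ^ s) ^ p *_) (sym (∑-*ˡ (tuples p X) Γ g)) ⟩
      (n ^ s) ^ p * ∑ (tuples p X) (λ vv → Γ * g vv)    ∎)
      where lem₁ : ∀ a b c → a * (b * c) ≡ b * a * c
            lem₁ = solve-∀
            lem₂ : ∀ a b c → a * (b * c) ≡ b * (a * c)
            lem₂ = solve-∀
    tuples-nonempty : 0 < length (tuples p X)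
    tuples-nonempty = subst (0 <_) (sym (length-tuples p X)) (m^n>0 n p)
    build : (∃ λ vv → vv ∈ tuples p X × n ^ s ≤ Γ * g vv) → Grid p s t X P
    build (vv , vv∈ , le) = record { V = vv ; V-∈ = tuples-∈ p X vv∈ ; V-inj = distinct-inj _≟_ [] vv dist
      ; tuples-disjoint = disjoint-tuples s₀ X Γ (p + t * s) _ un
          (≤-trans le (*-monoʳ-≤ Γ (count-mono Vs (λ u e → proj₁ (∧-elim e)))))
          (≤-<-trans (m≤n+m _ (2 * γ * p)) big) t (toList vv) (≤-reflexive (cong (_+ t * s) (length-toList vv))) }
      where
      -- `g vv` is 0 when vv has a repetition, while n^s is positive; the averaging bound itself
      -- therefore forces distinctness.
      dist : distinct _≟_ [] vv ≡ true
      dist with true-or-false (distinct _≟_ [] vv)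
      ... | inj₁ e = e
      ... | inj₂ e = ⊥-elim (<⇒≱ (m^n>0 n s) (≤-trans le (≤-reflexive (trans (cong (Γ *_) (count-false Vs (λ u → trans (cong (allV (λ v → P v u) vv ∧_) e) (∧-false _)))) (*-zeroʳ Γ)))))
        where ∧-false : ∀ a → a ∧ false ≡ false
              ∧-false true  = refl
              ∧-false false = refl

-- A copy of T_{s,t,s'}ᵖ: v c and q c j are the copies of v₀ and q_j, the w i are
-- the roots below v₀ and the u j i those below q_j.
record Config {A : Set} (adj : A → A → Bool) (s t s' p : ℕ) : Set where
  field
    v : Fin p → A
    w : Fin s' → A
    u : Fin t → Fin s → A
    q : Fin p → Fin t → A
    v~w : ∀ c i → adj (v c) (w i) ≡ true
    v~q : ∀ c j → adj (v c) (q c j) ≡ true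
    q~u : ∀ c j i → adj (q c j) (u j i) ≡ true
    v-inj : ∀ {c c′} → v c ≡ v c′ → c ≡ c′
    w-inj : ∀ {i i′} → w i ≡ w i′ → i ≡ i′
    u-inj : ∀ {j i j′ i′} → u j i ≡ u j′ i′ → j ≡ j′ × i ≡ i′
    q-inj : ∀ {c j c′ j′} → q c j ≡ q c′ j′ → c ≡ c′ × j ≡ j′
    v≢u : ∀ {c j i} → v c ≢ u j i
    v≢q : ∀ {c c′ j} → v c ≢ q c′ j
    w≢u : ∀ {k j i} → w k ≢ u j i
    w≢q : ∀ {k c j} → w k ≢ q c j
    u≢q : ∀ {k i c j} → u k i ≢ q c j

-- The star bound

-- `2 * suc s` allows half of the common neighbours to be lost when a distinct roots are drawn from
-- them. The rest counts the p v's, the a w's and the t·s u's to be avoided by the q's, and the p·t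
-- q's themselves.
richness : (s t p : ℕ) → ℕ
richness s t p = 2 * suc s + (p + (suc s + t * s) + p * t)

-- The power of `gridSize` pays for common neighbourhoods too small to contain a grid, the power of
-- `richness` for tuples with few common neighbours.
starConst : (s t p : ℕ) → ℕ
starConst s t p = 2 * 2 ^ suc s * gridSize p s t (2 * 2 ^ suc s) ^ s + 2 * richness s t p ^ s

module Star {A : Set} (_≟_ : DecidableEquality A) (adj : A → A → Bool)
  (adj-sym : ∀ x y → adj x y ≡ adj y x) (adj-irrefl : ∀ x → adj x x ≡ false) where

  open Picking _≟_

  irr : ∀ {x y} → adj x y ≡ true → x ≢ y
  irr {x} e refl with trans (sym e) (adj-irrefl x)
  ... | ()

  common : ∀ {m} → List A → Vec A m → List A
  common vs u = filterᵇ (λ y → allV (adj y) u) vs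

  codeg : ∀ {m} → List A → Vec A m → ℕ
  codeg vs u = count vs (λ y → allV (adj y) u)

  deg : List A → A → ℕ
  deg vs y = count vs (adj y)

  -- The grid lies in the common neighbourhood X of w, so each v is adjacent to every w, and
  -- `s' ≤ suc s` provides enough w's for the roots below v₀. Richness of each pair (v, U j) leaves
  -- room for a private q.
  grid⇒config : ∀ {s t s' p vs X} (w : Vec A (suc s)) → Unique vs → s' ≤ suc s →
    (∀ i i′ → lookup w i ≡ lookup w i′ → i ≡ i′) → (∀ {x} → x ∈ X → ∀ i → adj (lookup w i) x ≡ true) →
    Grid p s t X (λ v u → richness s t p ≤ᵇ codeg vs (v ∷ u)) → Config adj s t s' p
  grid⇒config {s} {t} {s'} {p} {vs} {X} w un s'≤ w-inj w~X G = record
    { v = v ; w = w′ ; u = u ; q = λ c j → qq (combine c j)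
    ; v~w = λ c i → trans (adj-sym _ _) (w~X (V-∈ c) (inject≤ i s'≤))
    ; v~q = λ c j → trans (adj-sym _ _) (allV-lookup (adj (qq (combine c j))) (v c ∷ U j) (q-adj c j) zero)
    ; q~u = λ c j i → allV-lookup (adj (qq (combine c j))) (v c ∷ U j) (q-adj c j) (suc i)
    ; v-inj = λ {c} {c′} → V-inj c c′
    ; w-inj = λ {i} {i′} e → inject≤-injective s'≤ s'≤ i i′ (w-inj _ _ e)
    ; u-inj = λ {j} {i} {j′} {i′} → U-inj j i j′ i′
    ; q-inj = λ {c} {j} {c′} {j′} e → combine-injective c j c′ j′ (R-inj _ _ e)
    ; v≢u = λ {c} {j} {i} e → U-∉ j i (subst (_∈ toList V) e (lookup-∈ V c))
    ; v≢q = λ {c} {c′} {j} e → R-∉ (combine c′ j) (∈-++⁺ˡ (subst (_∈ toList V) e (lookup-∈ V c)))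
    ; w≢u = λ {k} {j} {i} → irr (w~X (U-∈ j i) (inject≤ k s'≤))
    ; w≢q = λ {k} {c} {j} e → R-∉ (combine c j) (∈-++⁺ʳ (toList V) (∈-++⁺ˡ (subst (_∈ toList w) e (lookup-∈ w _))))
    ; u≢q = λ {k} {i} {c} {j} e → R-∉ (combine c j) (∈-++⁺ʳ (toList V) (∈-++⁺ʳ (toList w) (subst (_∈ allU) e (∈-allU t U k i))))
    }
    where
    open Grid G
    open DisjointTuples tuples-disjoint
    v : Fin p → A
    v = lookup V
    w′ : Fin s' → A
    w′ i = lookup w (inject≤ i s'≤)
    u : Fin t → Fin s → A
    u j i = lookup (U j) i
    flatten : ∀ t → (Fin t → Vec A s) → List A
    flatten zero    U = []
    flatten (suc t) U = toList (U zero) ++ flatten t (λ j → U (suc j))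
    length-flatten : ∀ t U → length (flatten t U) ≡ t * s
    length-flatten zero    U = refl
    length-flatten (suc t) U = trans (length-++ (toList (U zero))) (cong₂ _+_ (length-toList (U zero)) (length-flatten t _))
    ∈-allU : ∀ t U k i → lookup (U k) i ∈ flatten t U
    ∈-allU (suc t) U zero    i = ∈-++⁺ˡ (lookup-∈ (U zero) i)
    ∈-allU (suc t) U (suc k) i = ∈-++⁺ʳ (toList (U zero)) (∈-allU t _ k i)
    allU = flatten t U
    S = toList V ++ (toList w ++ allU)
    length-S : length S ≡ p + (suc s + t * s)
    length-S = trans (length-++ (toList V)) (cong₂ _+_ (length-toList V) (trans (length-++ (toList w)) (cong₂ _+_ (length-toList w) (length-flatten t U))))
    N : Fin (p * t) → List A
    N k = common vs (v (proj₁ (remQuot {p} t k)) ∷ U (proj₂ (remQuot {p} t k)))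
    N-long : ∀ k → length S + p * t ≤ length (N k)
    N-long k = ≤-trans (≤-reflexive (cong (_+ p * t) length-S)) (≤-trans (m≤n+m _ (2 * suc s))
      (≤-trans (≤ᵇ-true (allV-lookup _ V (U-Y (proj₂ (remQuot {p} t k))) (proj₁ (remQuot {p} t k)))) (≤-reflexive (sym (length-filter _ vs)))))
    reps = representatives (p * t) N S (λ k → filter-unique _ un) N-long
    qq = proj₁ reps
    R-∉ = proj₁ (proj₂ (proj₂ reps))
    R-inj = proj₂ (proj₂ (proj₂ reps))
    q-adj : ∀ c j → allV (adj (qq (combine c j))) (v c ∷ U j) ≡ true
    q-adj c j = subst (λ z → allV (adj (qq (combine c j))) (v (proj₁ z) ∷ U (proj₂ z)) ≡ true) (remQuot-combine {p} {t} c j)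
      (proj₂ (∈-filter⁻ _ vs (proj₁ (proj₂ reps) (combine c j))))

  module _ (s₀ t s' p : ℕ) (s'≤a : s' ≤ suc (suc s₀)) (NC : ¬ Config adj (suc s₀) t s' p) (vs : List A) (un : Unique vs) where

    private
      s a L γ M₀ M : ℕ
      s = suc s₀
      a = suc s
      L = richness s t p
      γ = 2 * 2 ^ a
      M₀ = gridSize p s t γ
      M = γ * M₀ ^ s
      Vs : List (Vec A a)
      Vs = tuples a vs

      N : Vec A a → A → Bool
      N w y = allV (λ x → adj x y) w

      rich : Vec A a → Bool
      rich u = L ≤ᵇ codeg vs u

      r : Vec A a → ℕ
      r w = count Vs (λ u → allV (N w) u ∧ rich u)

      r-filter : ∀ w → r w ≡ ∑ (filterᵇ (N w) vs) (λ v → count (tuples s (filterᵇ (N w) vs)) (λ u → rich (v ∷ u)))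
      r-filter w = trans (∑-cong Vs (λ u → ind-∧ (allV (N w) u) (rich u)))
        (trans (∑-tuples-filter a (N w) vs (λ u → ind (rich u))) (∑-tuples s (filterᵇ (N w) vs) (λ u → ind (rich u))))

      -- If X = N(w) has at most M₀ vertices, then r w ≤ |X|^a ≤ M₀^s·|X|. If X is larger and γ·r w
      -- > |X|^a, then richness is dense on X and a grid with roots w gives the forbidden copy; this
      -- is where w must be distinct.
      few-rich : ∀ w → distinct _≟_ [] w ≡ true → γ * r w ≤ count vs (N w) ^ a + M * count vs (N w)
      few-rich w dw with γ * r w ≤? count vs (N w) ^ a
      ... | yes le = ≤-trans le (m≤m+n _ _)
      ... | no nle with count vs (N w) ≤? M₀
      ...   | yes small = begin
        γ * r w           ≤⟨ *-monoʳ-≤ γ (≤-trans (count-mono Vs (λ u e → proj₁ (∧-elim e))) (≤-reflexive (count-allV a (N w) vs))) ⟩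
        γ * (n * n ^ s)   ≤⟨ *-monoʳ-≤ γ (*-monoʳ-≤ n (^-monoˡ-≤ s small)) ⟩
        γ * (n * M₀ ^ s)  ≡⟨ lem γ n (M₀ ^ s) ⟩
        M * n             ≤⟨ m≤n+m _ _ ⟩
        n ^ a + M * n     ∎
        where open ≤-Reasoning
              n = count vs (N w)
              lem : ∀ a b c → a * (b * c) ≡ a * c * b
              lem = solve-∀
      ...   | no big = ⊥-elim (NC (grid⇒config w un s'≤a (distinct-inj _≟_ [] w dw)
                 (λ x∈ i → allV-lookup _ w (proj₂ (∈-filter⁻ (N w) vs x∈)) i)
                 (dense⇒grid p s₀ t γ X _ (filter-unique (N w) un)
                   (≤-trans (≤-reflexive (cong (_^ a) (length-filter (N w) vs))) (≤-trans (<⇒≤ (≰⇒> nle)) (≤-reflexive (cong (γ *_) (r-filter w)))))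
                   (<-≤-trans (≰⇒> big) (≤-reflexive (sym (length-filter (N w) vs)))))))
        where X = filterᵇ (N w) vs

    stars : ∑ Vs (codeg vs) ≡ ∑ vs (λ y → deg vs y ^ a)
    stars = trans (∑-swap Vs vs _) (∑-cong vs (λ y → count-allV a (adj y) vs))

    private
      S₁ S₂ : ℕ
      S₁ = ∑ Vs (codeg vs)
      S₂ = ∑ Vs (λ u → codeg vs u ^ a)

      AA : Vec A a → Vec A a → Bool
      AA u w = allV (λ x → allV (adj x) u) w

      AA-swap : ∀ u w → AA u w ≡ allV (N w) u
      AA-swap u w = allV-swap adj w u

      -- Both sides count homomorphic K_{a,a}, once from each part. This is what makes S₂ reappear
      -- on the right-hand side of `star-bound`.
      ∑n^a : ∑ Vs (λ w → count vs (N w) ^ a) ≡ S₂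
      ∑n^a = begin
        ∑ Vs (λ w → count vs (N w) ^ a)                  ≡⟨ ∑-cong Vs (λ w → sym (count-allV a (N w) vs)) ⟩
        ∑ Vs (λ w → count Vs (allV (N w)))                ≡⟨ ∑-swap Vs Vs _ ⟩
        ∑ Vs (λ u → count Vs (λ w → allV (N w) u))        ≡⟨ ∑-cong Vs (λ u → ∑-cong Vs (λ w → cong ind (sym (AA-swap u w)))) ⟩
        ∑ Vs (λ u → count Vs (AA u))                      ≡⟨ ∑-cong Vs (λ u → count-allV a _ vs) ⟩
        S₂ ∎
        where open ≡-Reasoning

      ∑n : ∑ Vs (λ w → count vs (N w)) ≡ S₁
      ∑n = begin
        ∑ Vs (λ w → count vs (N w))                                 ≡⟨ ∑-swap Vs vs _ ⟩
        ∑ vs (λ y → count Vs (allV (λ x → adj x y)))                ≡⟨ ∑-cong vs (λ y → count-allV a _ vs) ⟩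
        ∑ vs (λ y → count vs (λ x → adj x y) ^ a)                  ≡⟨ ∑-cong vs (λ y → cong (_^ a) (∑-cong vs (λ x → cong ind (adj-sym x y)))) ⟩
        ∑ vs (λ y → deg vs y ^ a)                                  ≡⟨ sym stars ⟩
        S₁ ∎
        where open ≡-Reasoning

      -- For rich u, half of the common neighbours survive the passage to distinct w. Otherwise
      -- codeg ≤ L, and all but one factor of the power are bounded by L.
      pointwise : ∀ u → codeg vs u ^ a ≤ 2 ^ a * ∑ Vs (λ w → ind (rich u) * ind (AA u w ∧ distinct _≟_ [] w)) + L ^ s * codeg vs u
      pointwise u with true-or-false (rich u)
      ... | inj₁ e rewrite e = ≤-trans (≤-trans (∸-half-^ (codeg vs u) a a (≤-trans (m≤m+n (2 * a) _) (≤ᵇ-true e)))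
              (*-monoʳ-≤ (2 ^ a) (≤-trans (count-distinct _≟_ un _ a []) (∑-mono Vs (λ w → ≤-reflexive (sym (+-identityʳ _))))))) (m≤m+n _ _)
      ... | inj₂ e = ≤-trans (≤-trans (*-monoʳ-≤ (codeg vs u) (^-monoˡ-≤ s (≤ᵇ-false {L} {codeg vs u} e))) (≤-reflexive (*-comm (codeg vs u) _))) (m≤n+m _ _)

      reorder : ∑ Vs (λ u → ∑ Vs (λ w → ind (rich u) * ind (AA u w ∧ distinct _≟_ [] w))) ≡ ∑ Vs (λ w → distinct _≟_ [] w · r w)
      reorder = trans (∑-swap Vs Vs _) (∑-cong Vs (λ w → trans (∑-cong Vs (λ u → trans (cong (λ z → ind (rich u) * ind (z ∧ distinct _≟_ [] w)) (AA-swap u w)) (bool (rich u) (allV (N w) u) _))) (∑-*ˡ Vs (ind (distinct _≟_ [] w)) _)))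
        where bool : ∀ a b c → ind a * ind (b ∧ c) ≡ ind c * ind (b ∧ a)
              bool true  true  true  = refl
              bool true  true  false = refl
              bool true  false true  = refl
              bool true  false false = refl
              bool false true  true  = refl
              bool false true  false = refl
              bool false false true  = refl
              bool false false false = refl

    -- γ equals 2·2^a so that, once S₂ is doubled and the factor 2^a of `pointwise` is paid,
    -- `few-rich` returns exactly one S₂, which cancels. What remains is linear in the number of
    -- stars.
    star-bound : S₂ ≤ starConst s t p * ∑ vs (λ y → deg vs y ^ a)
    star-bound = ≤-trans (+-cancelˡ-≤ S₂ _ _ (begin
      S₂ + S₂                                        ≡⟨ cong (S₂ +_) (sym (+-identityʳ S₂)) ⟩
      2 * S₂                                         ≤⟨ *-monoʳ-≤ 2 (∑-mono Vs pointwise) ⟩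
      2 * ∑ Vs (λ u → 2 ^ a * Q u + L ^ s * codeg vs u)
        ≡⟨ cong (2 *_) (trans (∑-+ Vs _ _) (cong₂ _+_ (∑-*ˡ Vs (2 ^ a) Q) (∑-*ˡ Vs (L ^ s) (codeg vs)))) ⟩
      2 * (2 ^ a * ∑ Vs Q + L ^ s * S₁)               ≡⟨ cong (λ z → 2 * (2 ^ a * z + L ^ s * S₁)) reorder ⟩
      2 * (2 ^ a * ∑ Vs (λ w → distinct _≟_ [] w · r w) + L ^ s * S₁)  ≡⟨ lem₁ (2 ^ a) _ (L ^ s) S₁ ⟩
      γ * ∑ Vs (λ w → distinct _≟_ [] w · r w) + 2 * L ^ s * S₁        ≡⟨ cong (_+ 2 * L ^ s * S₁) (sym (∑-*ˡ Vs γ _)) ⟩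
      ∑ Vs (λ w → γ * (distinct _≟_ [] w · r w)) + 2 * L ^ s * S₁      ≤⟨ +-monoˡ-≤ _ (∑-mono Vs claim) ⟩
      ∑ Vs (λ w → count vs (N w) ^ a + M * count vs (N w)) + 2 * L ^ s * S₁
        ≡⟨ cong (_+ 2 * L ^ s * S₁) (trans (∑-+ Vs _ _) (cong₂ _+_ ∑n^a (trans (∑-*ˡ Vs M _) (cong (M *_) ∑n)))) ⟩
      S₂ + M * S₁ + 2 * L ^ s * S₁                   ≡⟨ lem₂ S₂ M (2 * L ^ s) S₁ ⟩
      S₂ + starConst s t p * S₁                            ∎)) (≤-reflexive (cong (starConst s t p *_) stars))
      where
      open ≤-Reasoning
      Q : Vec A a → ℕ
      Q u = ∑ Vs (λ w → ind (rich u) * ind (AA u w ∧ distinct _≟_ [] w))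
      claim : ∀ w → γ * (distinct _≟_ [] w · r w) ≤ count vs (N w) ^ a + M * count vs (N w)
      claim w with true-or-false (distinct _≟_ [] w)
      ... | inj₁ e rewrite e = ≤-trans (≤-reflexive (cong (γ *_) (+-identityʳ (r w)))) (few-rich w e)
      ... | inj₂ e rewrite e = ≤-trans (≤-reflexive (*-zeroʳ γ)) z≤n
      lem₁ : ∀ x y l z → 2 * (x * y + l * z) ≡ 2 * x * y + 2 * l * z
      lem₁ = solve-∀
      lem₂ : ∀ x m l z → x + m * z + l * z ≡ x + (m + l) * z
      lem₂ = solve-∀

-- The second moment

anyV : ∀ {X : Set} {m} → (X → Bool) → Vec X m → Bool
anyV R []      = false
anyV R (x ∷ u) = R x ∨ anyV R u

∨-introˡ : ∀ {a b} → a ≡ true → a ∨ b ≡ true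
∨-introˡ refl = refl

∨-introʳ : ∀ {a b} → b ≡ true → a ∨ b ≡ true
∨-introʳ {true}  refl = refl
∨-introʳ {false} refl = refl

∨-false : ∀ {a b} → a ∨ b ≡ false → a ≡ false × b ≡ false
∨-false {false} e = refl , e

absurdᵇ : ∀ {b} → b ≡ true → b ≡ false → ⊥
absurdᵇ refl ()

anyV-intro : ∀ {X : Set} {m} (R : X → Bool) (u : Vec X m) i → R (lookup u i) ≡ true → anyV R u ≡ true
anyV-intro R (x ∷ u) zero    e = ∨-introˡ e
anyV-intro R (x ∷ u) (suc i) e = ∨-introʳ {R x} (anyV-intro R u i e)

count-anyV : ∀ {X : Set} (xs : List X) (P R : X → Bool) m →
  count (tuples (suc m) xs) (λ u → allV P u ∧ anyV R u) ≤ suc m * (count xs P ^ m * count xs R)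
count-anyV xs P R m = begin
  count (tuples (suc m) xs) (λ u → allV P u ∧ anyV R u)
    ≡⟨ ∑-tuples m xs _ ⟩
  ∑ xs (λ x → count Vs (λ u → (P x ∧ allV P u) ∧ (R x ∨ anyV R u)))
    ≤⟨ ∑-mono xs (λ x → ∑-mono Vs (λ u → bool (P x) (allV P u) (R x) (anyV R u))) ⟩
  ∑ xs (λ x → ∑ Vs (λ u → ind (R x) * ind (allV P u) + ind (P x) * ind (allV P u ∧ anyV R u)))
    ≡⟨ trans (∑-cong xs (λ x → ∑-+ Vs _ _)) (trans (∑-+ xs _ _) (cong₂ _+_ (∑-prod xs Vs _ _) (∑-prod xs Vs _ _))) ⟩
  r * count Vs (allV P) + z * count Vs (λ u → allV P u ∧ anyV R u)
    ≡⟨ cong (λ y → r * y + z * count Vs (λ u → allV P u ∧ anyV R u)) (count-allV m P xs) ⟩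
  r * z ^ m + z * count Vs (λ u → allV P u ∧ anyV R u)
    ≤⟨ rest m ⟩
  suc m * (z ^ m * r) ∎
  where
  open ≤-Reasoning
  Vs = tuples m xs
  z = count xs P
  r = count xs R
  bool : ∀ a b c d → ind ((a ∧ b) ∧ (c ∨ d)) ≤ ind c * ind b + ind a * ind (b ∧ d)
  bool false b     c     d     = z≤n
  bool true  false c     d     = z≤n
  bool true  true  true  d     = s≤s z≤n
  bool true  true  false true  = s≤s z≤n
  bool true  true  false false = z≤n
  rest : ∀ m → r * z ^ m + z * count (tuples m xs) (λ u → allV P u ∧ anyV R u) ≤ suc m * (z ^ m * r)
  rest zero    = ≤-reflexive (lem r z)
    where lem : ∀ r z → r * 1 + z * 0 ≡ 1 * (1 * r)
          lem = solve-∀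
  rest (suc m) = ≤-trans (+-monoʳ-≤ (r * z ^ suc m) (*-monoʳ-≤ z (count-anyV xs P R m))) (≤-reflexive (lem r z (z ^ m) m))
    where lem : ∀ r z y m → r * (z * y) + z * (suc m * (y * r)) ≡ suc (suc m) * (z * y * r)
          lem = solve-∀

1≤⇒x≤x^ : ∀ x s → 1 ≤ x → x ≤ x ^ suc s
1≤⇒x≤x^ x s le = m≤m*n x (x ^ s) {{m^n≢0 x s {{>-nonZero le}}}}

module Parameters (s₀ t₀ s' L₀ : ℕ) where

  -- `slack` bounds the combined avoidance lists of two centres: s' roots each at the start, then s
  -- + L₀ further vertices each in every one of t rounds. One listed vertex spoils at most (s +
  -- 1)·D^s tuples, whence `c`.
  s t a N slack c : ℕ
  s = suc s₀
  t = suc t₀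
  a = suc s
  N = s' + t
  slack = s' + s' + t * (2 * (s + L₀))
  c = slack * suc s

  lightConst firstConst nearConst : ℕ → ℕ
  lightConst κ = 2 * (κ ^ a * (2 * 2 ^ a * L₀))
  firstConst c₁ = (2 * c₁) ^ N
  nearConst L = 2 ^ N * (L + 2 ^ N * 2)

  module Constants (p₀ L : ℕ) where
    -- The summand 2·μ of `lam` lets the second moment absorb the term in `shared`; the summand 2·c
    -- makes the avoidance loss c·D^s at most half of `common-β` in the large case of the dichotomy.
    p μ lam secondConst : ℕ
    p = suc p₀
    μ = 4 ^ p * (t * 2 ^ t)
    lam = 2 * μ + 2 * c
    secondConst = 4 ^ p * (lam ^ suc t * nearConst L)

  finalConst : (p₀ L κ : ℕ) → ℕ
  finalConst p₀ L κ = firstConst (lightConst κ) ^ 2 * Constants.secondConst p₀ L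

  -- The first summand absorbs the stars lost to repeated leaves, the second the c·D^s tuples that
  -- each centre loses to avoidance.
  threshold : ℕ → ℕ
  threshold κ = 4 * (κ ^ a * (2 * a) ^ a) + 2 * lightConst κ * c

-- Light stars and the vertices that tuples must avoid

module Core {A : Set} (_≟_ : DecidableEquality A) (adj : A → A → Bool)
  (adj-sym : ∀ x y → adj x y ≡ adj y x) (adj-irrefl : ∀ x → adj x x ≡ false)
  (vs : List A) (un : Unique vs) (s₀ t₀ s' : ℕ) (L₀ D : ℕ) (deg≤D : ∀ y → count vs (adj y) ≤ D) (1≤D : 1 ≤ D) where

  open Parameters s₀ t₀ s' L₀
  open Star _≟_ adj adj-sym adj-irrefl hiding (deg; codeg; common)
  open Picking _≟_ using (lookup-∈)

  instance
    D≢0 : NonZero D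
    D≢0 = >-nonZero 1≤D

  k : ℕ
  k = length vs

  deg : A → ℕ
  deg y = count vs (adj y)

  codeg : ∀ {m} → Vec A m → ℕ
  codeg u = count vs (λ y → allV (adj y) u)

  common : ∀ {m} → Vec A m → List A
  common u = filterᵇ (λ y → allV (adj y) u) vs

  Vs : List (Vec A a)
  Vs = tuples a vs
  Ts : List (Vec A s)
  Ts = tuples s vs
  Tt : List (Vec (Vec A s) t)
  Tt = tuples t Ts

  -- At least one common neighbour is required to serve as a q; at most L₀ are allowed so that all
  -- of them can be avoided by the other tuples.
  light : Vec A a → Bool
  light u = (1 ≤ᵇ codeg u) ∧ ((codeg u ≤ᵇ L₀) ∧ distinct _≟_ [] u)

  b : A → Vec A s → Bool
  b v u = light (v ∷ u)

  β : A → ℕ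
  β v = count Ts (b v)

  b⇒codeg : ∀ v u → b v u ≡ true → 1 ≤ codeg (v ∷ u)
  b⇒codeg v u e = ≤ᵇ-true {1} {codeg (v ∷ u)} (proj₁ (∧-elim e))

  b⇒common : ∀ v u → b v u ≡ true → length (common (v ∷ u)) ≤ L₀
  b⇒common v u e = ≤-trans (≤-reflexive (length-filter _ vs))
    (≤ᵇ-true {codeg (v ∷ u)} {L₀} (proj₁ (∧-elim {codeg (v ∷ u) ≤ᵇ L₀} (proj₂ (∧-elim {1 ≤ᵇ codeg (v ∷ u)} e)))))

  b⇒distinct : ∀ v u → b v u ≡ true → distinct _≟_ [] (v ∷ u) ≡ true
  b⇒distinct v u e = proj₂ (∧-elim {codeg (v ∷ u) ≤ᵇ L₀} (proj₂ (∧-elim {1 ≤ᵇ codeg (v ∷ u)} e)))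

  -- A light star has a common neighbour z, so every u counted lies in N(z) for one of the deg v
  -- neighbours z of v.
  count-via : ∀ v (P : Vec A s → Bool) m → (∀ z → count Ts (λ u → allV (adj z) u ∧ P u) ≤ m) →
              count Ts (λ u → b v u ∧ P u) ≤ deg v * m
  count-via v P m le = begin
    count Ts (λ u → b v u ∧ P u)
      ≤⟨ ∑-mono Ts pt ⟩
    ∑ Ts (λ u → ∑ vs (λ z → adj v z · ind (allV (adj z) u ∧ P u)))
      ≡⟨ ∑-swap Ts vs _ ⟩
    ∑ vs (λ z → ∑ Ts (λ u → adj v z · ind (allV (adj z) u ∧ P u)))
      ≡⟨ ∑-cong vs (λ z → ∑-*ˡ Ts (ind (adj v z)) _) ⟩
    ∑ vs (λ z → adj v z · count Ts (λ u → allV (adj z) u ∧ P u))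
      ≤⟨ ∑-mono vs (λ z → *-monoʳ-≤ (ind (adj v z)) (le z)) ⟩
    ∑ vs (λ z → adj v z · m)
      ≡⟨ ∑-*ʳ vs m _ ⟩
    deg v * m ∎
    where
    open ≤-Reasoning
    pt : ∀ u → ind (b v u ∧ P u) ≤ ∑ vs (λ z → adj v z · ind (allV (adj z) u ∧ P u))
    pt u with b v u in e | P u
    ... | false | _     = z≤n
    ... | true  | false = z≤n
    ... | true  | true  = ≤-trans (b⇒codeg v u e) (∑-mono vs (λ z → bool (adj z v) (adj v z) (allV (adj z) u) (adj-sym z v)))
      where bool : ∀ c c′ d → c ≡ c′ → ind (c ∧ d) ≤ ind c′ * ind (d ∧ true)
            bool false .false d     refl = z≤n
            bool true  .true  true  refl = ≤-refl
            bool true  .true  false refl = z≤n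

  β≤ : ∀ v → β v ≤ deg v * D ^ s
  β≤ v = ≤-trans (count-mono Ts (λ u e → ∧-intro e refl)) (count-via v (λ _ → true) (D ^ s)
    (λ z → ≤-trans (count-mono Ts (λ u e → proj₁ (∧-elim e))) (≤-trans (≤-reflexive (count-allV s (adj z) vs)) (^-monoˡ-≤ s (deg≤D z)))))

  hits : A → Vec A s → Bool
  hits y u = mem _≟_ y (toList u) ∨ allV (adj y) u

  bad : List A → Vec A s → Bool
  bad []      u = false
  bad (y ∷ S) u = hits y u ∨ bad S u

  -- Tuples inside N(y) number at most D^s. Those with y as an entry are reached through a neighbour
  -- of v, giving D·(s·D^(s-1)).
  count-hits : ∀ v y → count Ts (λ u → b v u ∧ hits y u) ≤ suc s * D ^ s
  count-hits v y = begin
    count Ts (λ u → b v u ∧ hits y u)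
      ≤⟨ ∑-mono Ts (λ u → bool (b v u) (mem _≟_ y (toList u)) (allV (adj y) u)) ⟩
    ∑ Ts (λ u → ind (allV (adj y) u) + ind (b v u ∧ mem _≟_ y (toList u)))
      ≡⟨ ∑-+ Ts _ _ ⟩
    count Ts (allV (adj y)) + count Ts (λ u → b v u ∧ mem _≟_ y (toList u))
      ≤⟨ +-mono-≤ (≤-trans (≤-reflexive (count-allV s (adj y) vs)) (^-monoˡ-≤ s (deg≤D y)))
           (≤-trans (count-via v (λ u → mem _≟_ y (toList u)) _ inner) (*-monoˡ-≤ (s * D ^ s₀) (deg≤D v))) ⟩
    D ^ s + D * (s * D ^ s₀)
      ≡⟨ lem D (D ^ s₀) s ⟩
    suc s * D ^ s ∎
    where
    open ≤-Reasoning
    bool : ∀ a c d → ind (a ∧ (c ∨ d)) ≤ ind d + ind (a ∧ c)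
    bool false c     d     = z≤n
    bool true  true  true  = s≤s z≤n
    bool true  true  false = s≤s z≤n
    bool true  false true  = s≤s z≤n
    bool true  false false = z≤n
    inner : ∀ z → count Ts (λ u → allV (adj z) u ∧ mem _≟_ y (toList u)) ≤ s * D ^ s₀
    inner z = *-cancelˡ-≤ D (≤-trans (count-tuples-containing _≟_ un (adj z) D (deg≤D z) y s) (≤-reflexive (lem′ D (D ^ s₀) s)))
      where lem′ : ∀ D x s → s * (D * x) ≡ D * (s * x)
            lem′ = solve-∀
    lem : ∀ D x s → D * x + D * (s * x) ≡ suc s * (D * x)
    lem = solve-∀

  count-bad : ∀ v S → count Ts (λ u → b v u ∧ bad S u) ≤ length S * (suc s * D ^ s)
  count-bad v []      = ≤-reflexive (count-false Ts (λ u → ∧-false (b v u)))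
    where ∧-false : ∀ a → a ∧ false ≡ false
          ∧-false true  = refl
          ∧-false false = refl
  count-bad v (y ∷ S) = ≤-trans (∑-mono Ts (λ u → bool (b v u) (hits y u) (bad S u))) (≤-trans (≤-reflexive (∑-+ Ts _ _)) (+-mono-≤ (count-hits v y) (count-bad v S)))
    where bool : ∀ a c d → ind (a ∧ (c ∨ d)) ≤ ind (a ∧ c) + ind (a ∧ d)
          bool false c     d     = z≤n
          bool true  true  true  = s≤s z≤n
          bool true  true  false = s≤s z≤n
          bool true  false true  = s≤s z≤n
          bool true  false false = z≤n

  -- Clearing u also from the common neighbours of v and the earlier tuples makes
  -- every choice of the q's for v and us distinct, and distinct from the roots.
  ok : ∀ {m} → List A → A → Vec (Vec A s) m → Bool
  ok S v []       = true
  ok S v (u ∷ us) = (b v u ∧ not (bad S u)) ∧ ok (toList u ++ (common (v ∷ u) ++ S)) v us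

  ok⇒b : ∀ {m} S v (us : Vec (Vec A s) m) → ok S v us ≡ true → allV (b v) us ≡ true
  ok⇒b S v []       e = refl
  ok⇒b S v (u ∷ us) e with ∧-elim {b v u ∧ not (bad S u)} e
  ... | e₁ , e₂ = ∧-intro (proj₁ (∧-elim e₁)) (ok⇒b _ v us e₂)

  -- The two centres share the tuples but not the lists, since the common neighbourhoods added to a
  -- list depend on its centre. With v = v′ this also yields the count for a single centre.
  count-ok : ∀ v v′ ℓ m S S′ → length S + length S′ + m * (2 * (s + L₀)) ≤ ℓ →
    (count Ts (λ u → b v u ∧ b v′ u) ∸ ℓ * (suc s * D ^ s)) ^ m ≤ count (tuples m Ts) (λ us → ok S v us ∧ ok S′ v′ us)
  count-ok v v′ ℓ zero    S S′ le = s≤s z≤n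
  count-ok v v′ ℓ (suc m) S S′ le = begin
    y * y ^ m
      ≤⟨ *-monoˡ-≤ (y ^ m) (m≤n+o⇒m∸n≤o (count Ts bb) (ℓ * B) first) ⟩
    count Ts clean * y ^ m
      ≡⟨ sym (∑-*ʳ Ts (y ^ m) _) ⟩
    ∑ Ts (λ u → clean u · y ^ m)
      ≤⟨ ∑-mono Ts step ⟩
    ∑ Ts (λ u → count (tuples m Ts) (λ us → ok S v (u ∷ us) ∧ ok S′ v′ (u ∷ us)))
      ≡⟨ sym (∑-tuples m Ts _) ⟩
    count (tuples (suc m) Ts) (λ us → ok S v us ∧ ok S′ v′ us) ∎
    where
    open ≤-Reasoning
    B = suc s * D ^ s
    bb : Vec A s → Bool
    bb u = b v u ∧ b v′ u
    y = count Ts bb ∸ ℓ * B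
    fresh clean : Vec A s → Bool
    fresh u = b v u ∧ not (bad S u)
    clean u = fresh u ∧ (b v′ u ∧ not (bad S′ u))
    first : count Ts bb ≤ ℓ * B + count Ts clean
    first = begin
      count Ts bb
        ≤⟨ ∑-mono Ts (λ u → bool (b v u) (b v′ u) (bad S u) (bad S′ u)) ⟩
      ∑ Ts (λ u → (ind (b v u ∧ bad S u) + ind (b v′ u ∧ bad S′ u)) + ind (clean u))
        ≡⟨ trans (∑-+ Ts _ _) (cong (_+ count Ts clean) (∑-+ Ts _ _)) ⟩
      (count Ts (λ u → b v u ∧ bad S u) + count Ts (λ u → b v′ u ∧ bad S′ u)) + count Ts clean
        ≤⟨ +-monoˡ-≤ (count Ts clean) (+-mono-≤ (count-bad v S) (count-bad v′ S′)) ⟩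
      (length S * B + length S′ * B) + count Ts clean
        ≡⟨ cong (_+ count Ts clean) (sym (*-distribʳ-+ B (length S) (length S′))) ⟩
      (length S + length S′) * B + count Ts clean
        ≤⟨ +-monoˡ-≤ (count Ts clean) (*-monoˡ-≤ B (≤-trans (m≤m+n (length S + length S′) _) le)) ⟩
      ℓ * B + count Ts clean ∎
      where bool : ∀ x y p q → ind (x ∧ y) ≤ (ind (x ∧ p) + ind (y ∧ q)) + ind ((x ∧ not p) ∧ (y ∧ not q))
            bool false y     p     q     = z≤n
            bool true  false p     q     = z≤n
            bool true  true  true  q     = s≤s z≤n
            bool true  true  false true  = s≤s z≤n
            bool true  true  false false = s≤s z≤n
    step : ∀ u → clean u · y ^ m ≤ count (tuples m Ts) (λ us → ok S v (u ∷ us) ∧ ok S′ v′ (u ∷ us))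
    step u with true-or-false (fresh u) | true-or-false (b v′ u ∧ not (bad S′ u))
    ... | inj₂ e | _ rewrite e = z≤n
    ... | inj₁ e | inj₂ e′ rewrite e | e′ = z≤n
    ... | inj₁ e | inj₁ e′ rewrite e | e′ = ≤-trans (≤-reflexive (+-identityʳ (y ^ m))) (count-ok v v′ ℓ m _ _ len)
      where
      grow : ∀ w R → b w u ≡ true → length (toList u ++ (common (w ∷ u) ++ R)) ≤ (s + L₀) + length R
      grow w R bw = begin
        length (toList u ++ (common (w ∷ u) ++ R))  ≡⟨ trans (length-++ (toList u)) (cong₂ _+_ (length-toList u) (length-++ (common (w ∷ u)))) ⟩
        s + (length (common (w ∷ u)) + length R)    ≤⟨ +-monoʳ-≤ s (+-monoˡ-≤ (length R) (b⇒common w u bw)) ⟩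
        s + (L₀ + length R)                         ≡⟨ sym (+-assoc s L₀ (length R)) ⟩
        (s + L₀) + length R                         ∎
      len : length (toList u ++ (common (v ∷ u) ++ S)) + length (toList u ++ (common (v′ ∷ u) ++ S′)) + m * (2 * (s + L₀)) ≤ ℓ
      len = ≤-trans (+-monoˡ-≤ _ (+-mono-≤ (grow v S (proj₁ (∧-elim e))) (grow v′ S′ (proj₁ (∧-elim e′)))))
        (≤-trans (≤-reflexive (lem (s + L₀) (length S) (length S′) m)) le)
        where lem : ∀ x y z m → (x + y) + (x + z) + m * (2 * x) ≡ y + z + (2 * x + m * (2 * x))
              lem = solve-∀

  -- Abundance of light stars

  S₁ : ℕ
  S₁ = ∑ vs (λ y → deg y ^ a)

  ∑β : ∑ vs β ≡ count Vs light
  ∑β = sym (∑-tuples s vs _)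

  -- A star with codegree at least L₀ satisfies L₀^s·codeg ≤ codeg^a, so by the star bound the heavy
  -- stars weigh at most L·S₁/L₀^s. As 2·2^a·L ≤ L₀ ≤ L₀^s, this is absorbed by S₁; each light star
  -- weighs at most L₀.
  many-light : ∀ L → ∑ Vs (λ u → codeg u ^ a) ≤ L * S₁ → 2 * 2 ^ a * L ≤ L₀ → 1 ≤ L₀ →
    S₁ ≤ 2 * 2 ^ a * L₀ * ∑ vs β + 2 * (2 * a) ^ a * k
  many-light L star L≤ 1≤L₀ = *-cancelˡ-≤ (L₀ ^ s) {{m^n≢0 L₀ s {{>-nonZero 1≤L₀}}}} (+-cancelˡ-≤ (L₀ ^ s * S₁) _ _ (begin
    L₀ ^ s * S₁ + L₀ ^ s * S₁
      ≡⟨ sym (cong (L₀ ^ s * S₁ +_) (+-identityʳ _)) ⟩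
    2 * (L₀ ^ s * S₁)
      ≤⟨ *-monoʳ-≤ 2 (*-monoʳ-≤ (L₀ ^ s) lower) ⟩
    2 * (L₀ ^ s * (2 ^ a * ∑ Vs ds + k * (2 * a) ^ a))
      ≡⟨ lem₁ (L₀ ^ s) (2 ^ a) (∑ Vs ds) (k * (2 * a) ^ a) ⟩
    2 * 2 ^ a * (L₀ ^ s * ∑ Vs ds) + 2 * (L₀ ^ s * (k * (2 * a) ^ a))
      ≤⟨ +-monoˡ-≤ _ (*-monoʳ-≤ (2 * 2 ^ a) upper) ⟩
    2 * 2 ^ a * (L₀ ^ a * B + L * S₁) + 2 * (L₀ ^ s * (k * (2 * a) ^ a))
      ≡⟨ lem₂ (2 * 2 ^ a) L₀ (L₀ ^ s) B L S₁ k ((2 * a) ^ a) ⟩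
    2 * 2 ^ a * L * S₁ + L₀ ^ s * (2 * 2 ^ a * L₀ * B + 2 * (2 * a) ^ a * k)
      ≤⟨ +-monoˡ-≤ _ (*-monoˡ-≤ S₁ (≤-trans L≤ (1≤⇒x≤x^ L₀ s₀ 1≤L₀))) ⟩
    L₀ ^ s * S₁ + L₀ ^ s * (2 * 2 ^ a * L₀ * B + 2 * (2 * a) ^ a * k) ∎))
    where
    open ≤-Reasoning
    B = ∑ vs β
    ds : Vec A a → ℕ
    ds u = ind (distinct _≟_ [] u) * codeg u
    lem₁ : ∀ l p x y → 2 * (l * (p * x + y)) ≡ 2 * p * (l * x) + 2 * (l * y)
    lem₁ = solve-∀
    lem₂ : ∀ p l ls B L S k q → p * (l * ls * B + L * S) + 2 * (ls * (k * q)) ≡ p * L * S + ls * (p * l * B + 2 * q * k)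
    lem₂ = solve-∀
    upper : L₀ ^ s * ∑ Vs ds ≤ L₀ ^ a * B + L * S₁
    upper = begin
      L₀ ^ s * ∑ Vs ds
        ≡⟨ sym (∑-*ˡ Vs (L₀ ^ s) ds) ⟩
      ∑ Vs (λ u → L₀ ^ s * ds u)
        ≤⟨ ∑-mono Vs pt ⟩
      ∑ Vs (λ u → L₀ ^ a * ind (light u) + codeg u ^ a)
        ≡⟨ trans (∑-+ Vs _ _) (cong (_+ ∑ Vs (λ u → codeg u ^ a)) (trans (∑-*ˡ Vs (L₀ ^ a) _) (cong (L₀ ^ a *_) (sym ∑β)))) ⟩
      L₀ ^ a * B + ∑ Vs (λ u → codeg u ^ a)
        ≤⟨ +-monoʳ-≤ (L₀ ^ a * B) star ⟩
      L₀ ^ a * B + L * S₁ ∎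
      where
      pt : ∀ u → L₀ ^ s * ds u ≤ L₀ ^ a * ind (light u) + codeg u ^ a
      pt u with true-or-false (distinct _≟_ [] u)
      ... | inj₂ e rewrite e = ≤-trans (≤-reflexive (*-zeroʳ (L₀ ^ s))) z≤n
      ... | inj₁ e rewrite e with true-or-false (codeg u ≤ᵇ L₀)
      ...   | inj₂ h = ≤-trans (≤-trans (*-monoˡ-≤ (codeg u + 0) (^-monoˡ-≤ s (≤ᵇ-false {codeg u} {L₀} h))) (≤-reflexive (lem (codeg u) (codeg u ^ s)))) (m≤n+m _ _)
        where lem : ∀ c x → x * (c + 0) ≡ c * x
              lem = solve-∀
      ...   | inj₁ h with true-or-false (1 ≤ᵇ codeg u)
      ...     | inj₁ h′ rewrite h | h′ = ≤-trans (≤-trans (*-monoʳ-≤ (L₀ ^ s) (≤-trans (≤-reflexive (+-identityʳ _)) (≤ᵇ-true {codeg u} {L₀} h))) (≤-reflexive (lem L₀ (L₀ ^ s)))) (m≤m+n _ _)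
        where lem : ∀ c x → x * c ≡ c * x * 1
              lem = solve-∀
      ...     | inj₂ h′ rewrite n≤0⇒n≡0 (≤-pred (≰⇒> (λ (le : 1 ≤ codeg u) → absurdᵇ (Equivalence.to T-≡ (≤⇒≤ᵇ le)) h′))) = ≤-trans (≤-reflexive (*-zeroʳ (L₀ ^ s))) z≤n
    lower : S₁ ≤ 2 ^ a * ∑ Vs ds + k * (2 * a) ^ a
    lower = begin
      S₁
        ≤⟨ ∑-mono vs (λ y → ∸-half-^+ (deg y) a a) ⟩
      ∑ vs (λ y → 2 ^ a * (deg y ∸ a) ^ a + (2 * a) ^ a)
        ≡⟨ trans (∑-+ vs _ _) (cong₂ _+_ (∑-*ˡ vs (2 ^ a) _) (∑-const vs _)) ⟩
      2 ^ a * ∑ vs (λ y → (deg y ∸ a) ^ a) + k * (2 * a) ^ a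
        ≤⟨ +-monoˡ-≤ _ (*-monoʳ-≤ (2 ^ a) (∑-mono vs (λ y → count-distinct _≟_ un (adj y) a []))) ⟩
      2 ^ a * ∑ vs (λ y → count Vs (λ u → allV (adj y) u ∧ distinct _≟_ [] u)) + k * (2 * a) ^ a
        ≡⟨ cong (λ z → 2 ^ a * z + k * (2 * a) ^ a) (trans (∑-swap vs Vs _) (∑-cong Vs (λ u → trans (∑-cong vs (λ y → trans (ind-∧ (allV (adj y) u) _) (*-comm _ (ind (distinct _≟_ [] u))))) (∑-*ˡ vs (ind (distinct _≟_ [] u)) _)))) ⟩
      2 ^ a * ∑ Vs ds + k * (2 * a) ^ a ∎

  -- Convexity turns the lower bound on the average degree into k·D^a ≤ κ^a·S₁. The error term of
  -- `many-light` is linear in k and disappears for large D.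
  β-sum : ∀ κ L → ∑ Vs (λ u → codeg u ^ a) ≤ L * S₁ → 2 * 2 ^ a * L ≤ L₀ → 1 ≤ L₀ → 1 ≤ k →
    k * D ≤ κ * ∑ vs deg → 4 * (κ ^ a * (2 * a) ^ a) ≤ D → k * D ^ a ≤ lightConst κ * ∑ vs β
  β-sum κ L star L≤ 1≤L₀ 1≤k avg big = +-cancelʳ-≤ (k * D ^ a) _ _ (begin
    k * D ^ a + k * D ^ a
      ≡⟨ sym (cong (k * D ^ a +_) (+-identityʳ _)) ⟩
    2 * (k * D ^ a)
      ≤⟨ *-monoʳ-≤ 2 (≤-trans convex (*-monoʳ-≤ (κ ^ a) (many-light L star L≤ 1≤L₀))) ⟩
    2 * (κ ^ a * (2 * 2 ^ a * L₀ * B + 2 * (2 * a) ^ a * k))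
      ≡⟨ lem (κ ^ a) (2 * 2 ^ a * L₀) B ((2 * a) ^ a) k ⟩
    lightConst κ * B + k * (4 * (κ ^ a * (2 * a) ^ a))
      ≤⟨ +-monoʳ-≤ _ (*-monoʳ-≤ k (≤-trans big (1≤⇒x≤x^ D s 1≤D))) ⟩
    lightConst κ * B + k * D ^ a ∎)
    where
    open ≤-Reasoning
    B = ∑ vs β
    lem : ∀ x p B q k → 2 * (x * (p * B + 2 * q * k)) ≡ 2 * (x * p) * B + k * (4 * (x * q))
    lem = solve-∀
    convex : k * D ^ a ≤ κ ^ a * S₁
    convex = *-cancelˡ-≤ (k ^ s) {{m^n≢0 k s {{>-nonZero 1≤k}}}} (begin
      k ^ s * (k * D ^ a)            ≡⟨ lem₁ (k ^ s) k (D ^ a) ⟩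
      k ^ a * D ^ a                  ≡⟨ sym ([m*n]^k k D a) ⟩
      (k * D) ^ a                    ≤⟨ ^-monoˡ-≤ a avg ⟩
      (κ * ∑ vs deg) ^ a             ≡⟨ [m*n]^k κ (∑ vs deg) a ⟩
      κ ^ a * ∑ vs deg ^ a           ≤⟨ *-monoʳ-≤ (κ ^ a) (power-mean⁺ vs deg s) ⟩
      κ ^ a * (k ^ s * S₁)           ≡⟨ lem₂ (κ ^ a) (k ^ s) S₁ ⟩
      k ^ s * (κ ^ a * S₁)           ∎)
      where lem₁ : ∀ x y z → x * (y * z) ≡ y * x * z
            lem₁ = solve-∀
            lem₂ : ∀ x y z → x * (y * z) ≡ y * (x * z)
            lem₂ = solve-∀

  -- Choices of roots and the first moment

  Roots : Set
  Roots = Vec A s' × Vec (Vec A s) t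

  Ws : List Roots
  Ws = concatMap (λ w → map (w ,_) Tt) (tuples s' vs)

  ∑-Ws : ∀ (f : Roots → ℕ) → ∑ Ws f ≡ ∑ (tuples s' vs) (λ w → ∑ Tt (λ us → f (w , us)))
  ∑-Ws f = trans (∑-concatMap _ (tuples s' vs) f) (∑-cong (tuples s' vs) (λ w → ∑-map (w ,_) Tt f))

  length-Ws : length Ws ≡ k ^ s' * (k ^ s) ^ t
  length-Ws = trans (length≡∑1 Ws) (trans (∑-Ws (λ _ → 1)) (trans (∑-cong (tuples s' vs) (λ w → sym (length≡∑1 Tt)))
    (trans (∑-const (tuples s' vs) _) (cong₂ _*_ (length-tuples s' vs) (trans (length-tuples t Ts) (cong (_^ t) (length-tuples s vs)))))))

  leaves : A → Vec A s' → Bool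
  leaves v w = allV (adj v) w ∧ distinct _≟_ [] w

  good : A → Roots → Bool
  good v (w , us) = leaves v w ∧ ok (toList w) v us

  pairs : A → A → Vec A s' → Bool
  pairs v v′ w = (allV (adj v) w ∧ allV (adj v′) w) ∧ distinct _≟_ [] w

  common-β : A → A → ℕ
  common-β v v′ = count Ts (λ u → b v u ∧ b v′ u)

  shared : A → A → ℕ
  shared v v′ = ∑ Ws (λ W → ind (good v W ∧ good v′ W))

  shared-≥ : ∀ v v′ → count (tuples s' vs) (pairs v v′) * (common-β v v′ ∸ c * D ^ s) ^ t ≤ shared v v′
  shared-≥ v v′ = begin
    count (tuples s' vs) (pairs v v′) * y ^ t
      ≡⟨ sym (∑-*ʳ (tuples s' vs) (y ^ t) _) ⟩
    ∑ (tuples s' vs) (λ w → pairs v v′ w · y ^ t)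
      ≤⟨ ∑-mono (tuples s' vs) step ⟩
    ∑ (tuples s' vs) (λ w → ∑ Tt (λ us → ind (good v (w , us) ∧ good v′ (w , us))))
      ≡⟨ sym (∑-Ws _) ⟩
    shared v v′ ∎
    where
    open ≤-Reasoning
    y = common-β v v′ ∸ c * D ^ s
    step : ∀ w → pairs v v′ w · y ^ t ≤ ∑ Tt (λ us → ind (good v (w , us) ∧ good v′ (w , us)))
    step w = begin
      pairs v v′ w · y ^ t
        ≡⟨ cong (λ z → pairs v v′ w · (common-β v v′ ∸ z) ^ t) (*-assoc slack (suc s) (D ^ s)) ⟩
      pairs v v′ w · (common-β v v′ ∸ slack * (suc s * D ^ s)) ^ t
        ≤⟨ *-monoʳ-≤ (ind (pairs v v′ w)) (count-ok v v′ slack t (toList w) (toList w) (≤-reflexive (cong (λ z → z + z + t * (2 * (s + L₀))) (length-toList w)))) ⟩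
      pairs v v′ w · count Tt (λ us → ok (toList w) v us ∧ ok (toList w) v′ us)
        ≡⟨ sym (∑-*ˡ Tt (ind (pairs v v′ w)) _) ⟩
      ∑ Tt (λ us → ind (pairs v v′ w) * ind (ok (toList w) v us ∧ ok (toList w) v′ us))
        ≡⟨ ∑-cong Tt (λ us → bool (allV (adj v) w) (allV (adj v′) w) (distinct _≟_ [] w) (ok (toList w) v us) (ok (toList w) v′ us)) ⟩
      ∑ Tt (λ us → ind (good v (w , us) ∧ good v′ (w , us))) ∎
      where
      bool : ∀ x y d p q → ind ((x ∧ y) ∧ d) * ind (p ∧ q) ≡ ind (((x ∧ d) ∧ p) ∧ ((y ∧ d) ∧ q))
      bool false y     d     p     q = refl
      bool true  false false p     q = refl
      bool true  false true  false q = refl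
      bool true  false true  true  q = refl
      bool true  true  false p     q = refl
      bool true  true  true  false q = refl
      bool true  true  true  true  q = +-identityʳ _

  G₁ : ℕ
  G₁ = ∑ Ws (λ W → count vs (λ v → good v W))

  good-≥ : ∀ v → (deg v ∸ s') ^ s' * (β v ∸ c * D ^ s) ^ t ≤ count Ws (good v)
  good-≥ v = begin
    (deg v ∸ s') ^ s' * (β v ∸ c * D ^ s) ^ t
      ≤⟨ *-monoˡ-≤ _ (count-distinct _≟_ un (adj v) s' []) ⟩
    count (tuples s' vs) (leaves v) * (β v ∸ c * D ^ s) ^ t
      ≡⟨ cong₂ (λ y z → y * (z ∸ c * D ^ s) ^ t) (∑-cong (tuples s' vs) (λ w → cong (λ z → ind (z ∧ distinct _≟_ [] w)) (sym (∧-idem _)))) (∑-cong Ts (λ u → cong ind (sym (∧-idem _)))) ⟩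
    count (tuples s' vs) (pairs v v) * (common-β v v ∸ c * D ^ s) ^ t
      ≤⟨ shared-≥ v v ⟩
    shared v v
      ≡⟨ ∑-cong Ws (λ W → cong ind (∧-idem (good v W))) ⟩
    count Ws (good v) ∎
    where open ≤-Reasoning

  -- A centre contributes about deg^s'·β^t, a mixed product. Since β v ≤ deg v·D^s, multiplying by
  -- D^(s·s') bounds it below by the pure power y^N, to which the power mean applies; the exponents
  -- match because s·s' + s·t + N = a·N.
  first-moment : ∀ c₁ → 1 ≤ k → k * D ^ a ≤ c₁ * ∑ vs β → 2 * c₁ * c ≤ D → k * D ^ (s * t + N) ≤ firstConst c₁ * G₁
  first-moment c₁ 1≤k Σβ big = *-cancelˡ-≤ (D ^ (s * s')) {{m^n≢0 D (s * s')}} (*-cancelˡ-≤ (k ^ N₀) {{m^n≢0 k N₀ {{>-nonZero 1≤k}}}} (begin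
    k ^ N₀ * (D ^ (s * s') * (k * D ^ (s * t + N)))  ≡⟨ lem₁ (k ^ N₀) (D ^ (s * s')) k (D ^ (s * t + N)) ⟩
    k ^ suc N₀ * (D ^ (s * s') * D ^ (s * t + N))    ≡⟨ cong₂ _*_ (cong (k ^_) (sym N≡)) exponents ⟩
    k ^ N * (D ^ a) ^ N                              ≡⟨ sym ([m*n]^k k (D ^ a) N) ⟩
    (k * D ^ a) ^ N                                  ≤⟨ ^-monoˡ-≤ N average ⟩
    (2 * c₁ * ∑ vs y) ^ N                            ≡⟨ [m*n]^k (2 * c₁) (∑ vs y) N ⟩
    F * ∑ vs y ^ N                                   ≤⟨ *-monoʳ-≤ F (≤-trans (≤-reflexive (cong (∑ vs y ^_) N≡)) (power-mean⁺ vs y N₀)) ⟩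
    F * (k ^ N₀ * ∑ vs (λ v → y v ^ suc N₀))         ≡⟨ cong (λ z → F * (k ^ N₀ * z)) (∑-cong vs (λ v → cong (y v ^_) (sym N≡))) ⟩
    F * (k ^ N₀ * ∑ vs (λ v → y v ^ N))              ≤⟨ *-monoʳ-≤ F (*-monoʳ-≤ (k ^ N₀) (∑-mono vs pt)) ⟩
    F * (k ^ N₀ * ∑ vs (λ v → D ^ (s * s') * count Ws (good v)))  ≡⟨ cong (λ z → F * (k ^ N₀ * z)) (trans (∑-*ˡ vs (D ^ (s * s')) _) (cong (D ^ (s * s') *_) (∑-swap vs Ws _))) ⟩
    F * (k ^ N₀ * (D ^ (s * s') * G₁))               ≡⟨ lem₂ F (k ^ N₀) (D ^ (s * s')) G₁ ⟩
    k ^ N₀ * (D ^ (s * s') * (F * G₁))               ∎))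
    where
    open ≤-Reasoning
    F = firstConst c₁
    N₀ = s' + t₀
    N≡ : N ≡ suc N₀
    N≡ = +-suc s' t₀
    y : A → ℕ
    y v = β v ∸ c * D ^ s
    lem₁ : ∀ x d k e → x * (d * (k * e)) ≡ k * x * (d * e)
    lem₁ = solve-∀
    lem₂ : ∀ f x d g → f * (x * (d * g)) ≡ x * (d * (f * g))
    lem₂ = solve-∀
    exponents : D ^ (s * s') * D ^ (s * t + N) ≡ (D ^ a) ^ N
    exponents = trans (sym (^-distribˡ-+-* D (s * s') (s * t + N))) (trans (cong (D ^_) (lem s s' t)) (sym (^-*-assoc D a N)))
      where lem : ∀ s s' t → s * s' + (s * t + (s' + t)) ≡ suc s * (s' + t)
            lem = solve-∀
    average : k * D ^ a ≤ 2 * c₁ * ∑ vs y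
    average = +-cancelʳ-≤ (k * D ^ a) _ _ (begin
      k * D ^ a + k * D ^ a                                  ≡⟨ sym (cong (k * D ^ a +_) (+-identityʳ _)) ⟩
      2 * (k * D ^ a)                                        ≤⟨ *-monoʳ-≤ 2 (≤-trans Σβ (*-monoʳ-≤ c₁ (≤-trans (∑-mono vs (λ v → m≤n+m∸n (β v) (c * D ^ s))) (≤-reflexive (trans (∑-+ vs _ _) (cong (_+ ∑ vs y) (∑-const vs _))))))) ⟩
      2 * (c₁ * (k * (c * D ^ s) + ∑ vs y))                  ≡⟨ lem c₁ k c (D ^ s) (∑ vs y) ⟩
      2 * c₁ * ∑ vs y + k * (2 * c₁ * c * D ^ s)             ≤⟨ +-monoʳ-≤ _ (*-monoʳ-≤ k (*-monoˡ-≤ (D ^ s) big)) ⟩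
      2 * c₁ * ∑ vs y + k * D ^ a                            ∎)
      where lem : ∀ x k c d y → 2 * (x * (k * (c * d) + y)) ≡ 2 * x * y + k * (2 * x * c * d)
            lem = solve-∀
    s'≤c : s' ≤ c
    s'≤c = ≤-trans (≤-trans (m≤m+n s' s') (m≤m+n (s' + s') _)) (m≤m*n slack (suc s))
    y≤ : ∀ v → y v ≤ (deg v ∸ s') * D ^ s
    y≤ v = ≤-trans (∸-mono (β≤ v) (*-monoˡ-≤ (D ^ s) s'≤c)) (≤-reflexive (sym (*-distribʳ-∸ (D ^ s) (deg v) s')))
    pt : ∀ v → y v ^ N ≤ D ^ (s * s') * count Ws (good v)
    pt v = begin
      y v ^ N                                                       ≡⟨ ^-distribˡ-+-* (y v) s' t ⟩
      y v ^ s' * y v ^ t                                            ≤⟨ *-monoˡ-≤ (y v ^ t) (^-monoˡ-≤ s' (y≤ v)) ⟩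
      ((deg v ∸ s') * D ^ s) ^ s' * y v ^ t                         ≡⟨ cong (_* y v ^ t) (trans ([m*n]^k (deg v ∸ s') (D ^ s) s') (cong ((deg v ∸ s') ^ s' *_) (^-*-assoc D s s'))) ⟩
      (deg v ∸ s') ^ s' * D ^ (s * s') * y v ^ t                    ≡⟨ lem ((deg v ∸ s') ^ s') (D ^ (s * s')) (y v ^ t) ⟩
      D ^ (s * s') * ((deg v ∸ s') ^ s' * y v ^ t)                  ≤⟨ *-monoʳ-≤ (D ^ (s * s')) (good-≥ v) ⟩
      D ^ (s * s') * count Ws (good v)                              ∎
      where lem : ∀ x y z → x * y * z ≡ y * (x * z)
            lem = solve-∀
  -- Conflicts are tested with closed neighbourhoods so that they also cover the
  -- coincidences v = v′ and v = q′.
  nb : A → A → Bool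
  nb v y = adj v y ∨ ⌊ v ≟ y ⌋

  nb-refl : ∀ v → nb v v ≡ true
  nb-refl v with v ≟ v
  ... | yes _ = ∨-introʳ {adj v v} refl
  ... | no n  = ⊥-elim (n refl)

  conflict : ∀ {m} → Vec (Vec A s) m → A → A → Bool
  conflict us v v′ = 1 ≤ᵇ count vs (λ y → (nb v y ∧ nb v′ y) ∧ anyV (λ u → allV (adj y) u) us)

  conflict-sym : ∀ {m} (us : Vec (Vec A s) m) v v′ → conflict us v v′ ≡ conflict us v′ v
  conflict-sym us v v′ = cong (1 ≤ᵇ_) (∑-cong vs (λ y → cong (λ z → ind (z ∧ anyV (λ u → allV (adj y) u) us)) (∧-comm (nb v y) (nb v′ y))))

  no-conflict : ∀ {m} (us : Vec (Vec A s) m) v v′ → conflict us v v′ ≡ false →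
    ∀ {y} j → y ∈ vs → nb v y ≡ true → nb v′ y ≡ true → allV (adj y) (lookup us j) ≡ true → ⊥
  no-conflict us v v′ e j y∈ n n′ a = absurdᵇ (Equivalence.to T-≡ (≤⇒≤ᵇ (∈⇒1≤count y∈ (∧-intro (∧-intro n n′) (anyV-intro _ us j a))))) e

  -- Independent centres form a copy of the power

  record Clear (y : A) (u : Vec A s) : Set where
    constructor clear
    field
      not-in  : ∀ i → y ≢ lookup u i
      not-adj : allV (adj y) u ≡ true → ⊥

  bad⇒clear : ∀ S u → bad S u ≡ false → ∀ {y} → y ∈ S → Clear y u
  bad⇒clear (y ∷ S) u e (here refl) with ∨-false {mem _≟_ y (toList u)} (proj₁ (∨-false {hits y u} e))
  ... | e₁ , e₂ = clear (λ i q → mem-false _≟_ y (toList u) e₁ (subst (_∈ toList u) (sym q) (lookup-∈ u i))) (λ h → absurdᵇ h e₂)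
  bad⇒clear (y ∷ S) u e (there i) = bad⇒clear S u (proj₂ (∨-false {hits y u} e)) i

  ok⇒clear : ∀ {m} S v (us : Vec (Vec A s) m) → ok S v us ≡ true → ∀ {y} → y ∈ S → ∀ j → Clear y (lookup us j)
  ok⇒clear S v (u ∷ us) e i zero    = bad⇒clear S u (not-true (proj₂ (∧-elim {b v u} (proj₁ (∧-elim e))))) i
  ok⇒clear S v (u ∷ us) e i (suc j) = ok⇒clear _ v us (proj₂ (∧-elim {b v u ∧ not (bad S u)} e)) (∈-++⁺ʳ (toList u) (∈-++⁺ʳ (common (v ∷ u)) i)) j

  record Separated (v : A) (u u′ : Vec A s) : Set where
    field
      disjoint  : ∀ i i′ → lookup u i ≢ lookup u′ i′
      no-member : ∀ {y} → y ∈ common (v ∷ u) → ∀ i → y ≢ lookup u′ i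
      no-shared : ∀ {y} → y ∈ common (v ∷ u) → y ∈ common (v ∷ u′) → ⊥

  common-adj : ∀ v (u : Vec A s) {y} → y ∈ common (v ∷ u) → allV (adj y) u ≡ true
  common-adj v u {y} i = proj₂ (∧-elim {adj y v} (proj₂ (∈-filter⁻ (λ y → allV (adj y) (v ∷ u)) vs i)))

  ok⇒separated : ∀ {m} S v (us : Vec (Vec A s) m) → ok S v us ≡ true → ∀ i j → i ≢ j → Separated v (lookup us i) (lookup us j)
  ok⇒separated S v (u ∷ us) e zero    zero    ne = ⊥-elim (ne refl)
  ok⇒separated S v (u ∷ us) e (suc i) (suc j) ne = ok⇒separated _ v us (proj₂ (∧-elim {b v u ∧ not (bad S u)} e)) i j (λ q → ne (cong suc q))
  ok⇒separated S v (u ∷ us) e zero    (suc j) ne = record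
    { disjoint  = λ i i′ q → Clear.not-in (later (∈-++⁺ˡ (lookup-∈ u i))) i′ q
    ; no-member = λ y∈ → Clear.not-in (later (∈-++⁺ʳ (toList u) (∈-++⁺ˡ y∈)))
    ; no-shared = λ y∈ y∈′ → Clear.not-adj (later (∈-++⁺ʳ (toList u) (∈-++⁺ˡ y∈))) (common-adj v (lookup us j) y∈′) }
    where
    later : ∀ {y} → y ∈ toList u ++ (common (v ∷ u) ++ S) → Clear y (lookup us j)
    later i = ok⇒clear _ v us (proj₂ (∧-elim {b v u ∧ not (bad S u)} e)) i j
  ok⇒separated S v (u ∷ us) e (suc j) zero    ne = record
    { disjoint  = λ i i′ q → Clear.not-in (later (∈-++⁺ˡ (lookup-∈ u i′))) i (sym q)
    -- Backwards in time the lists do not help directly: y belongs to the common neighbourhood of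
    -- the later tuple. But an entry of the earlier tuple is listed, hence not adjacent to all of
    -- the later one; this is why `hits` tests adjacency as well as membership.
    ; no-member = λ {y} y∈ i q → Clear.not-adj (later (∈-++⁺ˡ (subst (_∈ toList u) (sym q) (lookup-∈ u i)))) (common-adj v (lookup us j) y∈)
    ; no-shared = λ y∈ y∈′ → Clear.not-adj (later (∈-++⁺ʳ (toList u) (∈-++⁺ˡ y∈′))) (common-adj v (lookup us j) y∈) }
    where
    later : ∀ {y} → y ∈ toList u ++ (common (v ∷ u) ++ S) → Clear y (lookup us j)
    later i = ok⇒clear _ v us (proj₂ (∧-elim {b v u ∧ not (bad S u)} e)) i j

  -- An arbitrary common neighbour serves as each q. For one centre, `ok` keeps the entire common
  -- neighbourhoods apart; for two centres, a shared q would be a conflict.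
  independent⇒config : ∀ {p₀} w us (V : Vec A (suc p₀)) → (∀ c → good (lookup V c) (w , us) ≡ true) →
    (∀ c c′ → c ≢ c′ → conflict us (lookup V c) (lookup V c′) ≡ false) → Config adj s t s' (suc p₀)
  independent⇒config {p₀} w us V gd nc = record
    { v = v ; w = lookup w ; u = λ j i → lookup (U j) i ; q = q
    ; v~w = λ c i → allV-lookup (adj (v c)) w (proj₁ (∧-elim {allV (adj (v c)) w} (lv c))) i
    ; v~q = v~q
    ; q~u = λ c j i → allV-lookup (adj (q c j)) (U j) (q~U c j) i
    ; v-inj = v-inj
    ; w-inj = λ {i} {i′} → distinct-inj _≟_ [] w (proj₂ (∧-elim {allV (adj (v zero)) w} (lv zero))) i i′
    ; u-inj = u-inj
    ; q-inj = q-inj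
    ; v≢u = λ {c} {j} {i} e → distinct-∉ _≟_ (v c ∷ []) (U j) (b⇒distinct (v c) (U j) (bb c j)) i (here (sym e))
    ; v≢q = v≢q
    ; w≢u = λ {k} {j} {i} → Clear.not-in (ok⇒clear (toList w) (v zero) us (okv zero) (lookup-∈ w k) j) i
    ; w≢q = λ {k} {c} {j} e → Clear.not-adj (ok⇒clear (toList w) (v c) us (okv c) (lookup-∈ w k) j) (subst (λ z → allV (adj z) (U j) ≡ true) (sym e) (q~U c j))
    ; u≢q = u≢q
    }
    where
    p = suc p₀
    v = lookup V
    U = lookup us
    lv : ∀ c → leaves (v c) w ≡ true
    lv c = proj₁ (∧-elim {leaves (v c) w} (gd c))
    okv : ∀ c → ok (toList w) (v c) us ≡ true
    okv c = proj₂ (∧-elim {leaves (v c) w} (gd c))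
    bb : ∀ c j → b (v c) (U j) ≡ true
    bb c j = allV-lookup (b (v c)) us (ok⇒b (toList w) (v c) us (okv c)) j
    connector : ∀ c j → ∃ λ y → y ∈ vs × allV (adj y) (v c ∷ U j) ≡ true
    connector c j = 1≤count⇒∈ vs (b⇒codeg (v c) (U j) (bb c j))
    q : Fin p → Fin t → A
    q c j = proj₁ (connector c j)
    q∈ : ∀ c j → q c j ∈ vs
    q∈ c j = proj₁ (proj₂ (connector c j))
    q∈common : ∀ c j → q c j ∈ common (v c ∷ U j)
    q∈common c j = ∈-filter⁺ (λ y → allV (adj y) (v c ∷ U j)) (q∈ c j) (proj₂ (proj₂ (connector c j)))
    q~U : ∀ c j → allV (adj (q c j)) (U j) ≡ true
    q~U c j = common-adj (v c) (U j) (q∈common c j)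
    v~q : ∀ c j → adj (v c) (q c j) ≡ true
    v~q c j = trans (adj-sym _ _) (proj₁ (∧-elim (proj₂ (proj₂ (connector c j)))))
    v-inj : ∀ {c c′} → v c ≡ v c′ → c ≡ c′
    v-inj {c} {c′} e with c Fin.≟ c′
    ... | yes q = q
    -- Equal centres would share the q below index `zero`, which exists because t is positive.
    ... | no ne = ⊥-elim (no-conflict us (v c) (v c′) (nc c c′ ne) zero (q∈ c zero) (∨-introˡ (v~q c zero))
                    (subst (λ z → nb z (q c zero) ≡ true) e (∨-introˡ (v~q c zero))) (q~U c zero))
    u-inj : ∀ {j i j′ i′} → lookup (U j) i ≡ lookup (U j′) i′ → j ≡ j′ × i ≡ i′
    u-inj {j} {i} {j′} {i′} e with j Fin.≟ j′
    ... | yes refl = refl , distinct-inj _≟_ (v zero ∷ []) (U j) (b⇒distinct (v zero) (U j) (bb zero j)) i i′ e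
    ... | no ne = ⊥-elim (Separated.disjoint (ok⇒separated (toList w) (v zero) us (okv zero) j j′ ne) i i′ e)
    q-inj : ∀ {c j c′ j′} → q c j ≡ q c′ j′ → c ≡ c′ × j ≡ j′
    q-inj {c} {j} {c′} {j′} e with c Fin.≟ c′
    ... | no ne = ⊥-elim (no-conflict us (v c) (v c′) (nc c c′ ne) j (q∈ c j) (∨-introˡ (v~q c j)) (∨-introˡ (subst (λ z → adj (v c′) z ≡ true) (sym e) (v~q c′ j′))) (q~U c j))
    ... | yes refl with j Fin.≟ j′
    ...   | yes refl = refl , refl
    ...   | no ne = ⊥-elim (Separated.no-shared (ok⇒separated (toList w) (v c) us (okv c) j j′ ne) (q∈common c j) (subst (_∈ common (v c ∷ U j′)) (sym e) (q∈common c j′)))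
    v≢q : ∀ {c c′ j} → v c ≢ q c′ j
    v≢q {c} {c′} {j} e with c Fin.≟ c′
    ... | yes refl = irr (v~q c j) e
    ... | no ne = no-conflict us (v c) (v c′) (nc c c′ ne) j (q∈ c′ j) (subst (λ z → nb (v c) z ≡ true) e (nb-refl (v c))) (∨-introˡ (v~q c′ j)) (q~U c′ j)
    u≢q : ∀ {k i c j} → lookup (U k) i ≢ q c j
    u≢q {k} {i} {c} {j} e with k Fin.≟ j
    ... | yes refl = irr (allV-lookup (adj (q c j)) (U j) (q~U c j) i) (sym e)
    ... | no ne = Separated.no-member (ok⇒separated (toList w) (v c) us (okv c) j k (λ z → ne (sym z))) (q∈common c j) i (sym e)

  -- Common neighbourhoods of two centres

  both near : A → A → ℕ
  both v v′ = count vs (λ y → adj v y ∧ adj v′ y)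
  near v v′ = count vs (λ y → nb v y ∧ nb v′ y)

  -- Homomorphic K_{2,a} counted from either side.
  both-powers : ∑ vs (λ v → ∑ vs (λ v′ → both v v′ ^ a)) ≡ ∑ Vs (λ u → codeg u ^ 2)
  both-powers = begin
    ∑ vs (λ v → ∑ vs (λ v′ → both v v′ ^ a))
      ≡⟨ ∑-cong vs (λ v → ∑-cong vs (λ v′ → sym (count-allV a _ vs))) ⟩
    ∑ vs (λ v → ∑ vs (λ v′ → count Vs (allV (λ y → adj v y ∧ adj v′ y))))
      ≡⟨ ∑-cong vs (λ v → ∑-swap vs Vs _) ⟩
    ∑ vs (λ v → ∑ Vs (λ u → ∑ vs (λ v′ → ind (allV (λ y → adj v y ∧ adj v′ y) u))))
      ≡⟨ ∑-swap vs Vs _ ⟩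
    ∑ Vs (λ u → ∑ vs (λ v → ∑ vs (λ v′ → ind (allV (λ y → adj v y ∧ adj v′ y) u))))
      ≡⟨ ∑-cong Vs (λ u → ∑-cong vs (λ v → ∑-cong vs (λ v′ → split v v′ u))) ⟩
    ∑ Vs (λ u → ∑ vs (λ v → ∑ vs (λ v′ → ind (allV (adj v) u) * ind (allV (adj v′) u))))
      ≡⟨ ∑-cong Vs (λ u → trans (∑-prod vs vs _ _) (cong (codeg u *_) (sym (*-identityʳ _)))) ⟩
    ∑ Vs (λ u → codeg u ^ 2) ∎
    where
    open ≡-Reasoning
    split : ∀ {m} v v′ (u : Vec A m) → ind (allV (λ y → adj v y ∧ adj v′ y) u) ≡ ind (allV (adj v) u) * ind (allV (adj v′) u)
    split v v′ []      = refl
    split v v′ (x ∷ u) = trans (ind-∧ (adj v x ∧ adj v′ x) _) (trans (cong₂ _*_ (ind-∧ (adj v x) (adj v′ x)) (split v v′ u))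
        (trans (lem (ind (adj v x)) (ind (adj v′ x)) _ _) (sym (cong₂ _*_ (ind-∧ (adj v x) _) (ind-∧ (adj v′ x) _)))))
      where lem : ∀ a b c d → a * b * (c * d) ≡ a * c * (b * d)
            lem = solve-∀

  S₁≤ : S₁ ≤ k * D ^ a
  S₁≤ = ≤-trans (∑-mono vs (λ y → ^-monoˡ-≤ a (deg≤D y))) (≤-reflexive (∑-const vs _))

  -- Since a ≥ 2, codeg² is at most codeg^a, so the star bound for K_{a,a} also controls K_{2,a}.
  ∑both^a≤ : ∀ L → ∑ Vs (λ u → codeg u ^ a) ≤ L * S₁ → ∑ vs (λ v → ∑ vs (λ v′ → both v v′ ^ a)) ≤ L * (k * D ^ a)
  ∑both^a≤ L star = ≤-trans (≤-reflexive both-powers) (≤-trans (∑-mono Vs (λ u → square≤ (codeg u))) (≤-trans star (*-monoʳ-≤ L S₁≤)))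
    where square≤ : ∀ x → x ^ 2 ≤ x ^ a
          square≤ zero    = z≤n
          square≤ (suc x) = ^-monoʳ-≤ (suc x) {2} {a} (s≤s (s≤s z≤n))

  -- Closing the neighbourhoods can add only y = v or y = v′, and only when v and v′ are equal or
  -- adjacent.
  near≤ : ∀ v v′ → near v v′ ≤ both v v′ + 2 * ind (nb v v′)
  near≤ v v′ = begin
    near v v′
      ≤⟨ ∑-mono vs pt ⟩
    ∑ vs (λ y → ind (adj v y ∧ adj v′ y) + (ind ⌊ y ≟ v ⌋ * ν + ind ⌊ y ≟ v′ ⌋ * ν))
      ≡⟨ trans (∑-+ vs _ _) (cong (both v v′ +_) (trans (∑-+ vs _ _) (cong₂ _+_ (∑-*ʳ vs ν _) (∑-*ʳ vs ν _)))) ⟩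
    both v v′ + (count vs (λ y → ⌊ y ≟ v ⌋) * ν + count vs (λ y → ⌊ y ≟ v′ ⌋) * ν)
      ≤⟨ +-monoʳ-≤ (both v v′) (+-mono-≤ (*-monoˡ-≤ ν (count-≡ _≟_ un v)) (*-monoˡ-≤ ν (count-≡ _≟_ un v′))) ⟩
    both v v′ + (1 * ν + 1 * ν)
      ≡⟨ cong (both v v′ +_) (lem ν) ⟩
    both v v′ + 2 * ν ∎
    where
    open ≤-Reasoning
    ν = ind (nb v v′)
    lem : ∀ x → 1 * x + 1 * x ≡ 2 * x
    lem = solve-∀
    nb-cases : ∀ x y → nb x y ≡ true → adj x y ≡ true ⊎ x ≡ y
    nb-cases x y e with adj x y | x ≟ y
    ... | true  | _     = inj₁ refl
    ... | false | yes q = inj₂ q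
    nb-sym : ∀ x y → nb x y ≡ true → nb y x ≡ true
    nb-sym x y e with nb-cases x y e
    ... | inj₁ h    = ∨-introˡ (trans (adj-sym y x) h)
    ... | inj₂ refl = nb-refl x
    ≟-refl : ∀ x → ⌊ x ≟ x ⌋ ≡ true
    ≟-refl x with x ≟ x
    ... | yes _ = refl
    ... | no n  = ⊥-elim (n refl)
    pt : ∀ y → ind (nb v y ∧ nb v′ y) ≤ ind (adj v y ∧ adj v′ y) + (ind ⌊ y ≟ v ⌋ * ν + ind ⌊ y ≟ v′ ⌋ * ν)
    pt y with true-or-false (nb v y ∧ nb v′ y)
    ... | inj₂ e rewrite e = z≤n
    ... | inj₁ e = ≤-trans (ind≤1 _) (cover _ _ _ _ (which (nb-cases v y (proj₁ (∧-elim e))) (nb-cases v′ y (proj₂ (∧-elim {nb v y} e)))))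
      where
      cover : ∀ p q r n → p ≡ true ⊎ (n ≡ true × (q ≡ true ⊎ r ≡ true)) → 1 ≤ ind p + (ind q * ind n + ind r * ind n)
      cover _ q    r    n (inj₁ refl)                 = s≤s z≤n
      cover p _    r    _ (inj₂ (refl , inj₁ refl))   = ≤-trans (s≤s z≤n) (m≤n+m _ (ind p))
      cover p q    _    _ (inj₂ (refl , inj₂ refl))   = ≤-trans (m≤n+m 1 (ind q * 1)) (m≤n+m _ (ind p))
      which : adj v y ≡ true ⊎ v ≡ y → adj v′ y ≡ true ⊎ v′ ≡ y →
              adj v y ∧ adj v′ y ≡ true ⊎ (nb v v′ ≡ true × (⌊ y ≟ v ⌋ ≡ true ⊎ ⌊ y ≟ v′ ⌋ ≡ true))
      which (inj₁ h)    (inj₁ h′)   = inj₁ (∧-intro h h′)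
      which (inj₂ refl) _           = inj₂ (nb-sym v′ v (proj₂ (∧-elim {nb v v} e)) , inj₁ (≟-refl v))
      which (inj₁ h)    (inj₂ refl) = inj₂ (proj₁ (∧-elim {nb v v′} e) , inj₂ (≟-refl v′))

  ∑nb≤ : ∀ v → ∑ vs (λ v′ → ind (nb v v′)) ≤ 2 * D
  ∑nb≤ v = begin
    ∑ vs (λ v′ → ind (nb v v′))                     ≤⟨ count-∨ vs (adj v) (λ v′ → ⌊ v ≟ v′ ⌋) ⟩
    deg v + count vs (λ v′ → ⌊ v ≟ v′ ⌋)            ≤⟨ +-mono-≤ (deg≤D v) (≤-trans (count-mono vs (λ x e → flip x e)) (count-≡ _≟_ un v)) ⟩
    D + 1                                           ≤⟨ +-monoʳ-≤ D (≤-trans 1≤D (≤-reflexive (sym (+-identityʳ D)))) ⟩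
    2 * D                                           ∎
    where
    open ≤-Reasoning
    flip : ∀ x → ⌊ v ≟ x ⌋ ≡ true → ⌊ x ≟ v ⌋ ≡ true
    flip x e with v ≟ x
    flip x e | yes refl with v ≟ v
    ... | yes _ = refl
    ... | no n  = ⊥-elim (n refl)

  -- This is where `a ≤ N` enters: N - a of the factors are bounded by D and the remaining a-th
  -- power by the star bound. Equal or adjacent pairs contribute O(k·D), which is within O(k·D^N) as
  -- N ≥ 1.
  ∑near^N≤ : ∀ L → ∑ Vs (λ u → codeg u ^ a) ≤ L * S₁ → a ≤ N →
    ∑ vs (λ v → ∑ vs (λ v′ → near v v′ ^ N)) ≤ nearConst L * (k * D ^ N)
  ∑near^N≤ L star a≤N = begin
    ∑ vs (λ v → ∑ vs (λ v′ → near v v′ ^ N))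
      ≤⟨ ∑-mono vs (λ v → ∑-mono vs (λ v′ → pt v v′)) ⟩
    ∑ vs (λ v → ∑ vs (λ v′ → 2 ^ N * (both v v′ ^ a * D ^ o + 2 ^ N * ind (nb v v′))))
      ≡⟨ trans (∑-cong vs (λ v → trans (∑-*ˡ vs (2 ^ N) _) (cong (2 ^ N *_) (trans (∑-+ vs _ _) (cong₂ _+_ (∑-*ʳ vs (D ^ o) _) (∑-*ˡ vs (2 ^ N) _)))))) (trans (∑-*ˡ vs (2 ^ N) _) (cong (2 ^ N *_) (trans (∑-+ vs _ _) (cong₂ _+_ (∑-*ʳ vs (D ^ o) _) (∑-*ˡ vs (2 ^ N) _))))) ⟩
    2 ^ N * (∑ vs (λ v → ∑ vs (λ v′ → both v v′ ^ a)) * D ^ o + 2 ^ N * ∑ vs (λ v → ∑ vs (λ v′ → ind (nb v v′))))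
      ≤⟨ *-monoʳ-≤ (2 ^ N) (+-mono-≤ (*-monoˡ-≤ (D ^ o) (∑both^a≤ L star)) (*-monoʳ-≤ (2 ^ N) (≤-trans (∑-mono vs ∑nb≤) (≤-reflexive (∑-const vs (2 * D)))))) ⟩
    2 ^ N * (L * (k * D ^ a) * D ^ o + 2 ^ N * (k * (2 * D)))
      ≤⟨ *-monoʳ-≤ (2 ^ N) (+-monoʳ-≤ (L * (k * D ^ a) * D ^ o) (*-monoʳ-≤ (2 ^ N) (*-monoʳ-≤ k (*-monoʳ-≤ 2 D≤)))) ⟩
    2 ^ N * (L * (k * D ^ a) * D ^ o + 2 ^ N * (k * (2 * D ^ N)))
      ≡⟨ cong (2 ^ N *_) (trans (cong₂ _+_ (lem₁ L k (D ^ a) (D ^ o)) refl) (cong (λ z → L * (k * z) + 2 ^ N * (k * (2 * D ^ N))) (trans (sym (^-distribˡ-+-* D a o)) (cong (D ^_) a+o)))) ⟩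
    2 ^ N * (L * (k * D ^ N) + 2 ^ N * (k * (2 * D ^ N)))
      ≡⟨ lem₂ (2 ^ N) L k (D ^ N) ⟩
    nearConst L * (k * D ^ N) ∎
    where
    open ≤-Reasoning
    o = N ∸ a
    a+o : a + o ≡ N
    a+o = m+[n∸m]≡n a≤N
    D≤ : D ≤ D ^ N
    D≤ = ≤-trans (1≤⇒x≤x^ D (s' + t₀) 1≤D) (≤-reflexive (cong (D ^_) (sym (+-suc s' t₀))))
    lem₁ : ∀ l k x y → l * (k * x) * y ≡ l * (k * (x * y))
    lem₁ = solve-∀
    lem₂ : ∀ p l k x → p * (l * (k * x) + p * (k * (2 * x))) ≡ p * (l + p * 2) * (k * x)
    lem₂ = solve-∀
    2ν : ∀ β → (2 * ind β) ^ N ≤ 2 ^ N * ind β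
    2ν true  = ≤-reflexive (sym (*-identityʳ (2 ^ N)))
    2ν false = ≤-reflexive (trans (cong (0 ^_) (+-suc s' t₀)) (sym (*-zeroʳ (2 ^ N))))
    both≤ : ∀ v v′ → both v v′ ^ N ≤ both v v′ ^ a * D ^ o
    both≤ v v′ = ≤-trans (≤-reflexive (trans (cong (both v v′ ^_) (sym a+o)) (^-distribˡ-+-* (both v v′) a o)))
      (*-monoʳ-≤ (both v v′ ^ a) (^-monoˡ-≤ o (≤-trans (count-mono vs (λ y e → proj₁ (∧-elim e))) (deg≤D v))))
    pt : ∀ v v′ → near v v′ ^ N ≤ 2 ^ N * (both v v′ ^ a * D ^ o + 2 ^ N * ind (nb v v′))
    pt v v′ = ≤-trans (^-monoˡ-≤ N (near≤ v v′)) (≤-trans ([x+y]^N≤ (both v v′) (2 * ind (nb v v′)) N) (*-monoʳ-≤ (2 ^ N) (+-mono-≤ (both≤ v v′) (2ν (nb v v′)))))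

  -- Conflicting pairs of centres

  clashes : A → A → ℕ
  clashes v v′ = ∑ Ws (λ W → ind ((good v W ∧ good v′ W) ∧ conflict (proj₂ W) v v′))

  module _ (v v′ : A) where
    private
      ω z x : ℕ
      ω = count (tuples s' vs) (pairs v v′)
      z = common-β v v′
      x = near v v′
      bb : Vec A s → Bool
      bb u = b v u ∧ b v′ u

      ok-both : ∀ S (us : Vec (Vec A s) t) → ok S v us ≡ true → ok S v′ us ≡ true → allV bb us ≡ true
      ok-both S us e e′ = allV-intro bb us (λ j → ∧-intro (allV-lookup (b v) us (ok⇒b S v us e) j) (allV-lookup (b v′) us (ok⇒b S v′ us e′) j))

      split : ∀ w us → good v (w , us) ∧ good v′ (w , us) ≡ true → pairs v v′ w ≡ true × allV bb us ≡ true
      split w us e with ∧-elim {good v (w , us)} e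
      ... | e₁ , e₂ with ∧-elim {leaves v w} e₁ | ∧-elim {leaves v′ w} e₂
      ...   | l , o | l′ , o′ = ∧-intro (∧-intro (proj₁ (∧-elim {allV (adj v) w} l)) (proj₁ (∧-elim {allV (adj v′) w} l′))) (proj₂ (∧-elim {allV (adj v) w} l)) , ok-both (toList w) us o o′

      factor : ∀ (P : Roots → Bool) (Q : Vec (Vec A s) t → Bool) → (∀ w us → P (w , us) ≡ true → pairs v v′ w ≡ true × Q us ≡ true) →
               count Ws P ≤ ω * count Tt Q
      factor P Q h = ≤-trans (≤-reflexive (∑-Ws _)) (≤-trans (∑-mono (tuples s' vs) (λ w → ∑-mono Tt (λ us →
          ≤-trans (ind-mono (λ e → ∧-intro (proj₁ (h w us e)) (proj₂ (h w us e)))) (≤-reflexive (ind-∧ (pairs v v′ w) (Q us))))))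
        (≤-reflexive (∑-prod (tuples s' vs) Tt _ _)))

    clashes≤₁ : clashes v v′ ≤ ω * z ^ t
    clashes≤₁ = ≤-trans (factor _ (allV bb) (λ w us e → split w us (proj₁ (∧-elim e)))) (≤-reflexive (cong (ω *_) (count-allV t bb Ts)))

    -- A conflict names a y near both centres and one of the t tuples inside N(y). That tuple has at
    -- most D^s choices instead of z, so one factor z is traded for x·t·D^s.
    clashes≤₂ : clashes v v′ ≤ ω * (x * (t * (z ^ t₀ * D ^ s)))
    clashes≤₂ = ≤-trans (factor _ (λ us → allV bb us ∧ conflict us v v′) (λ w us e → proj₁ (split w us (proj₁ (∧-elim e))) , ∧-intro (proj₂ (split w us (proj₁ (∧-elim e)))) (proj₂ (∧-elim {good v (w , us) ∧ good v′ (w , us)} e))))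
      (*-monoʳ-≤ ω (begin
        count Tt (λ us → allV bb us ∧ conflict us v v′)
          ≤⟨ ∑-mono Tt pt ⟩
        ∑ Tt (λ us → ∑ vs (λ y → (nb v y ∧ nb v′ y) · ind (allV bb us ∧ anyV (λ u → allV (adj y) u) us)))
          ≡⟨ trans (∑-swap Tt vs _) (∑-cong vs (λ y → ∑-*ˡ Tt (ind (nb v y ∧ nb v′ y)) _)) ⟩
        ∑ vs (λ y → (nb v y ∧ nb v′ y) · count Tt (λ us → allV bb us ∧ anyV (λ u → allV (adj y) u) us))
          ≤⟨ ∑-mono vs (λ y → *-monoʳ-≤ (ind (nb v y ∧ nb v′ y)) (≤-trans (count-anyV Ts bb (λ u → allV (adj y) u) t₀) (*-monoʳ-≤ t (*-monoʳ-≤ (z ^ t₀) (≤-trans (≤-reflexive (count-allV s (adj y) vs)) (^-monoˡ-≤ s (deg≤D y))))))) ⟩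
        ∑ vs (λ y → (nb v y ∧ nb v′ y) · (t * (z ^ t₀ * D ^ s)))
          ≡⟨ ∑-*ʳ vs _ _ ⟩
        x * (t * (z ^ t₀ * D ^ s)) ∎))
      where
      open ≤-Reasoning
      ind-≤ᵇ : ∀ n → ind (1 ≤ᵇ n) ≤ n
      ind-≤ᵇ zero    = z≤n
      ind-≤ᵇ (suc n) = s≤s z≤n
      pt : ∀ us → ind (allV bb us ∧ conflict us v v′) ≤ ∑ vs (λ y → (nb v y ∧ nb v′ y) · ind (allV bb us ∧ anyV (λ u → allV (adj y) u) us))
      pt us with allV bb us
      ... | false = z≤n
      ... | true  = ≤-trans (ind-≤ᵇ _) (≤-reflexive (∑-cong vs (λ y → ind-∧ (nb v y ∧ nb v′ y) _)))

    ω≤ : ω ≤ x ^ s'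
    ω≤ = ≤-trans (count-mono (tuples s' vs) (λ w e → allV-intro _ w (λ i →
           ∧-intro (∨-introˡ (allV-lookup (adj v) w (proj₁ (∧-elim (proj₁ (∧-elim e)))) i))
                   (∨-introˡ (allV-lookup (adj v′) w (proj₂ (∧-elim {allV (adj v) w} (proj₁ (∧-elim e)))) i)))))
         (≤-reflexive (count-allV s' (λ y → nb v y ∧ nb v′ y) vs))

    -- If many u are compatible with both v and v′, then few of them conflict;
    -- otherwise even the number of all W for v and v′ is controlled by near v v′.
    clash-dichotomy : ∀ lam → 2 * c ≤ lam →
      lam * clashes v v′ ≤ t * 2 ^ t * shared v v′ + lam ^ suc t * D ^ (s * t) * x ^ N
    clash-dichotomy lam big with z ≤? lam * (x * D ^ s)
    ... | yes small = ≤-trans (begin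
      lam * clashes v v′                           ≤⟨ *-monoʳ-≤ lam clashes≤₁ ⟩
      lam * (ω * z ^ t)                            ≤⟨ *-monoʳ-≤ lam (*-mono-≤ ω≤ (^-monoˡ-≤ t small)) ⟩
      lam * (x ^ s' * (lam * (x * D ^ s)) ^ t)     ≡⟨ cong (λ y → lam * (x ^ s' * y)) (trans ([m*n]^k lam (x * D ^ s) t) (cong (lam ^ t *_) (trans ([m*n]^k x (D ^ s) t) (cong (x ^ t *_) (^-*-assoc D s t))))) ⟩
      lam * (x ^ s' * (lam ^ t * (x ^ t * D ^ (s * t))))  ≡⟨ lem lam (x ^ s') (lam ^ t) (x ^ t) (D ^ (s * t)) ⟩
      lam ^ suc t * D ^ (s * t) * (x ^ s' * x ^ t) ≡⟨ cong (lam ^ suc t * D ^ (s * t) *_) (sym (^-distribˡ-+-* x s' t)) ⟩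
      lam ^ suc t * D ^ (s * t) * x ^ N            ∎) (m≤n+m _ _)
      where open ≤-Reasoning
            lem : ∀ l a b c d → l * (a * (b * (c * d))) ≡ l * b * d * (a * c)
            lem = solve-∀
    ... | no large with x in eqx
    -- Without a common closed neighbour there is no conflict at all. In the other branch x ≥ 1, and
    -- this is what makes z exceed lam·D^s ≥ 2·c·D^s.
    ...   | zero = ≤-trans (≤-reflexive (trans (cong (lam *_) (n≤0⇒n≡0 (≤-trans clashes≤₂ (≤-reflexive (trans (cong (λ y → ω * (y * (t * (z ^ t₀ * D ^ s)))) eqx) (*-zeroʳ ω)))))) (*-zeroʳ lam))) z≤n
    ...   | suc x₀ = ≤-trans (begin
      lam * clashes v v′                             ≤⟨ *-monoʳ-≤ lam clashes≤₂ ⟩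
      lam * (ω * (x * (t * (z ^ t₀ * D ^ s))))       ≡⟨ lem₁ lam ω x t (z ^ t₀) (D ^ s) ⟩
      t * ω * (lam * (x * D ^ s) * z ^ t₀)           ≤⟨ *-monoʳ-≤ (t * ω) (*-monoˡ-≤ (z ^ t₀) (<⇒≤ (subst (λ y → lam * (y * D ^ s) < z) (sym eqx) (≰⇒> large)))) ⟩
      t * ω * z ^ t                                  ≤⟨ *-monoʳ-≤ (t * ω) (∸-half-^ z (c * D ^ s) t cD≤) ⟩
      t * ω * (2 ^ t * (z ∸ c * D ^ s) ^ t)          ≡⟨ lem₂ t ω (2 ^ t) _ ⟩
      t * 2 ^ t * (ω * (z ∸ c * D ^ s) ^ t)          ≤⟨ *-monoʳ-≤ (t * 2 ^ t) (shared-≥ v v′) ⟩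
      t * 2 ^ t * shared v v′                        ∎) (m≤m+n _ _)
      where
      open ≤-Reasoning
      lem₁ : ∀ l w x t z d → l * (w * (x * (t * (z * d)))) ≡ t * w * (l * (x * d) * z)
      lem₁ = solve-∀
      lem₂ : ∀ t w p y → t * w * (p * y) ≡ t * p * (w * y)
      lem₂ = solve-∀
      cD≤ : 2 * (c * D ^ s) ≤ z
      cD≤ = begin
        2 * (c * D ^ s)               ≡⟨ sym (*-assoc 2 c (D ^ s)) ⟩
        2 * c * D ^ s                 ≤⟨ *-monoˡ-≤ (D ^ s) big ⟩
        lam * D ^ s                   ≤⟨ *-monoʳ-≤ lam (m≤m+n (D ^ s) (x₀ * D ^ s)) ⟩
        lam * (suc x₀ * D ^ s)        ≤⟨ <⇒≤ (≰⇒> large) ⟩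
        z                             ∎

  -- Comparison of the two moments

  f : Roots → ℕ
  f W = count vs (λ v → good v W)

  M₂ : ℕ
  M₂ = ∑ Ws (λ W → f W ^ 2)

  ∑shared : ∑ vs (λ v → ∑ vs (λ v′ → shared v v′)) ≡ M₂
  ∑shared = begin
    ∑ vs (λ v → ∑ vs (λ v′ → shared v v′))
      ≡⟨ ∑-cong vs (λ v → ∑-swap vs Ws _) ⟩
    ∑ vs (λ v → ∑ Ws (λ W → ∑ vs (λ v′ → ind (good v W ∧ good v′ W))))
      ≡⟨ ∑-swap vs Ws _ ⟩
    ∑ Ws (λ W → ∑ vs (λ v → ∑ vs (λ v′ → ind (good v W ∧ good v′ W))))
      ≡⟨ ∑-cong Ws (λ W → trans (∑-cong vs (λ v → ∑-cong vs (λ v′ → ind-∧ (good v W) (good v′ W)))) (trans (∑-prod vs vs _ _) (cong (f W *_) (sym (*-identityʳ _))))) ⟩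
    M₂ ∎
    where open ≡-Reasoning

  M₂≤clashes : ∀ p₀ → ¬ Config adj s t s' (suc p₀) → M₂ ≤ 4 ^ suc p₀ * ∑ vs (λ v → ∑ vs (λ v′ → clashes v v′))
  M₂≤clashes p₀ NC = begin
    M₂
      ≤⟨ ∑-mono Ws turan ⟩
    ∑ Ws (λ W → 4 ^ p * ∑ vs (λ v → ∑ vs (λ v′ → ind ((good v W ∧ good v′ W) ∧ conflict (proj₂ W) v v′))))
      ≡⟨ ∑-*ˡ Ws (4 ^ p) _ ⟩
    4 ^ p * ∑ Ws (λ W → ∑ vs (λ v → ∑ vs (λ v′ → ind ((good v W ∧ good v′ W) ∧ conflict (proj₂ W) v v′))))
      ≡⟨ cong (4 ^ p *_) (trans (∑-swap Ws vs _) (∑-cong vs (λ v → ∑-swap Ws vs _))) ⟩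
    4 ^ p * ∑ vs (λ v → ∑ vs (λ v′ → clashes v v′)) ∎
    where
    open ≤-Reasoning
    p = suc p₀
    turan : ∀ W → f W ^ 2 ≤ 4 ^ p * ∑ vs (λ v → ∑ vs (λ v′ → ind ((good v W ∧ good v′ W) ∧ conflict (proj₂ W) v v′)))
    turan (w , us) with independent-or-dense p (conflict us) (conflict-sym us) (filterᵇ (λ v → good v (w , us)) vs)
    ... | inj₁ (V , V∈ , nc) = ⊥-elim (NC (independent⇒config w us V (λ c → proj₂ (∈-filter⁻ (λ v → good v (w , us)) vs (V∈ c))) nc))
    ... | inj₂ dense = ≤-trans (≤-reflexive (cong (_^ 2) (sym (length-filter (λ v → good v (w , us)) vs)))) (≤-trans dense (≤-reflexive (cong (4 ^ p *_) unfilter)))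
      where
      P = λ v → good v (w , us)
      unfilter : ∑ (filterᵇ P vs) (λ v → count (filterᵇ P vs) (conflict us v)) ≡ ∑ vs (λ v → ∑ vs (λ v′ → ind ((P v ∧ P v′) ∧ conflict us v v′)))
      unfilter = trans (∑-filter P vs _) (∑-cong vs (λ v → trans (cong (ind (P v) *_) (∑-filter P vs _)) (trans (sym (∑-*ˡ vs (ind (P v)) _)) (∑-cong vs (λ v′ →
        sym (trans (ind-∧ (P v ∧ P v′) _) (trans (cong (_* ind (conflict us v v′)) (ind-∧ (P v) (P v′))) (*-assoc (ind (P v)) _ _))))))))

  -- Turán's bound is multiplied by `lam`, and the dichotomy then returns μ·M₂ plus the moments of
  -- `near`. As lam ≥ 2·μ, one μ·M₂ cancels and the other, at least M₂, remains on the left.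
  second-moment : ∀ p₀ L → ¬ Config adj s t s' (suc p₀) → ∑ Vs (λ u → codeg u ^ a) ≤ L * S₁ → a ≤ N →
    M₂ ≤ Constants.secondConst p₀ L * (k * D ^ (s * t + N))
  second-moment p₀ L NC star a≤N = ≤-trans (≤-trans (≤-reflexive (sym (*-identityˡ M₂))) (*-monoˡ-≤ M₂ 1≤μ)) (+-cancelˡ-≤ (μ * M₂) _ _ (begin
    μ * M₂ + μ * M₂
      ≡⟨ lem₁ μ M₂ ⟩
    2 * μ * M₂
      ≤⟨ *-monoˡ-≤ M₂ (m≤m+n (2 * μ) (2 * c)) ⟩
    lam * M₂
      ≤⟨ *-monoʳ-≤ lam (M₂≤clashes p₀ NC) ⟩
    lam * (4 ^ p * ∑ vs (λ v → ∑ vs (λ v′ → clashes v v′)))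
      ≡⟨ lem₂ lam (4 ^ p) _ ⟩
    4 ^ p * (lam * ∑ vs (λ v → ∑ vs (λ v′ → clashes v v′)))
      ≡⟨ cong (4 ^ p *_) (trans (sym (∑-*ˡ vs lam _)) (∑-cong vs (λ v → sym (∑-*ˡ vs lam _)))) ⟩
    4 ^ p * ∑ vs (λ v → ∑ vs (λ v′ → lam * clashes v v′))
      ≤⟨ *-monoʳ-≤ (4 ^ p) (∑-mono vs (λ v → ∑-mono vs (λ v′ → clash-dichotomy v v′ lam (m≤n+m (2 * c) (2 * μ))))) ⟩
    4 ^ p * ∑ vs (λ v → ∑ vs (λ v′ → t * 2 ^ t * shared v v′ + E * near v v′ ^ N))
      ≡⟨ cong (4 ^ p *_) (trans (∑-cong vs (λ v → trans (∑-+ vs _ _) (cong₂ _+_ (∑-*ˡ vs (t * 2 ^ t) _) (∑-*ˡ vs E _)))) (trans (∑-+ vs _ _) (cong₂ _+_ (∑-*ˡ vs (t * 2 ^ t) _) (∑-*ˡ vs E _)))) ⟩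
    4 ^ p * (t * 2 ^ t * ∑ vs (λ v → ∑ vs (λ v′ → shared v v′)) + E * ∑ vs (λ v → ∑ vs (λ v′ → near v v′ ^ N)))
      ≤⟨ *-monoʳ-≤ (4 ^ p) (+-mono-≤ (≤-reflexive (cong (t * 2 ^ t *_) ∑shared)) (*-monoʳ-≤ E (∑near^N≤ L star a≤N))) ⟩
    4 ^ p * (t * 2 ^ t * M₂ + E * (nearConst L * (k * D ^ N)))
      ≡⟨ lem₃ (4 ^ p) (t * 2 ^ t) M₂ (lam ^ suc t) (D ^ (s * t)) (nearConst L) k (D ^ N) ⟩
    μ * M₂ + secondConst * (k * (D ^ (s * t) * D ^ N))
      ≡⟨ cong (λ y → μ * M₂ + secondConst * (k * y)) (sym (^-distribˡ-+-* D (s * t) N)) ⟩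
    μ * M₂ + secondConst * (k * D ^ (s * t + N)) ∎))
    where
    open ≤-Reasoning
    open Constants p₀ L
    E = lam ^ suc t * D ^ (s * t)
    1≤μ : 1 ≤ μ
    1≤μ = *-mono-≤ (m^n>0 4 p) (*-mono-≤ (s≤s {0} {t₀} z≤n) (m^n>0 2 t))
    lem₁ : ∀ m x → m * x + m * x ≡ 2 * m * x
    lem₁ = solve-∀
    lem₂ : ∀ l p x → l * (p * x) ≡ p * (l * x)
    lem₂ = solve-∀
    lem₃ : ∀ p t M l d n k e → p * (t * M + l * d * (n * (k * e))) ≡ p * t * M + p * (l * n) * (k * (d * e))
    lem₃ = solve-∀

  -- Cauchy-Schwarz over the choices of roots gives Q² on the left, while the second moment is
  -- linear in Q; cancelling Q leaves the number of choices of roots as upper bound.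
  core-bound : ∀ p₀ L κ → ¬ Config adj s t s' (suc p₀) → ∑ Vs (λ u → codeg u ^ a) ≤ L * S₁ → a ≤ N →
    2 * 2 ^ a * L ≤ L₀ → 1 ≤ L₀ → 1 ≤ k → k * D ≤ κ * ∑ vs deg → threshold κ ≤ D →
    k * D ^ (s * t + N) ≤ finalConst p₀ L κ * (k ^ s' * (k ^ s) ^ t)
  core-bound p₀ L κ NC star a≤N L≤ 1≤L₀ 1≤k avg big = *-cancelˡ-≤ Q {{>-nonZero 1≤Q}} (begin
    Q * Q                                        ≤⟨ *-mono-≤ first first ⟩
    F * G₁ * (F * G₁)                            ≡⟨ lem₁ F G₁ ⟩
    F ^ 2 * G₁ ^ 2                               ≤⟨ *-monoʳ-≤ (F ^ 2) (power-mean⁺ Ws f 1) ⟩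
    F ^ 2 * (length Ws ^ 1 * M₂)                 ≡⟨ cong (λ y → F ^ 2 * (y * M₂)) (trans (*-identityʳ _) length-Ws) ⟩
    F ^ 2 * (R * M₂)                             ≤⟨ *-monoʳ-≤ (F ^ 2) (*-monoʳ-≤ R (second-moment p₀ L NC star a≤N)) ⟩
    F ^ 2 * (R * (secondConst * Q))              ≡⟨ lem₂ (F ^ 2) R secondConst Q ⟩
    Q * (F ^ 2 * secondConst * R)                ∎)
    where
    open ≤-Reasoning
    open Constants p₀ L using (secondConst)
    Q = k * D ^ (s * t + N)
    F = firstConst (lightConst κ)
    R = k ^ s' * (k ^ s) ^ t
    1≤Q : 1 ≤ Q
    1≤Q = *-mono-≤ 1≤k (m^n>0 D (s * t + N))
    first : Q ≤ F * G₁
    first = first-moment (lightConst κ) 1≤k (β-sum κ L star L≤ 1≤L₀ 1≤k avg (≤-trans (m≤m+n _ _) big)) (≤-trans (m≤n+m _ _) big)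
    lem₁ : ∀ f g → f * g * (f * g) ≡ f * (f * 1) * (g * (g * 1))
    lem₁ = solve-∀
    lem₂ : ∀ f r c q → f * (r * (c * q)) ≡ q * (f * c * r)
    lem₂ = solve-∀

-- Passing to bounded maximum degree

-- Averaging over K consecutive chunks: if the head chunk carries less than its share, then the rest
-- has more than its share and, by induction, contains a chunk heavier than the head.
largest-chunk : ∀ {X : Set} K c (xs : List X) (f : X → ℕ) → Unique xs → length xs ≤ K * c →
  ∃ λ zs → Unique zs × (∀ {z} → z ∈ zs → z ∈ xs) × length zs ≤ c × ∑ xs f ≤ K * ∑ zs f
largest-chunk zero    c [] f un le = [] , [] , (λ ()) , z≤n , z≤n
largest-chunk (suc K) c xs f un le with ∑ xs f ≤? suc K * ∑ (take c xs) f
... | yes p = take c xs , Unique.take⁺ c un , (λ {z} i → subst (z ∈_) (take++drop≡id c xs) (∈-++⁺ˡ i))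
            , ≤-trans (≤-reflexive (length-take c xs)) (m⊓n≤m c (length xs)) , p
... | no ¬p with largest-chunk K c (drop c xs) f (Unique.drop⁺ c un) (≤-trans (≤-reflexive (length-drop c xs)) (m≤n+o⇒m∸n≤o (length xs) c le))
...   | zs , un′ , sub , short , heavy = zs , un′ , (λ {z} i → subst (z ∈_) (take++drop≡id c xs) (∈-++⁺ʳ (take c xs) (sub i))) , short ,
  (begin
    ∑ xs f                  ≡⟨ parts ⟩
    h + r                   ≤⟨ +-mono-≤ (<⇒≤ h<z) heavy ⟩
    suc K * ∑ zs f          ∎)
  where
  open ≤-Reasoning
  h = ∑ (take c xs) f
  r = ∑ (drop c xs) f
  parts : ∑ xs f ≡ h + r
  parts = trans (cong (λ l → ∑ l f) (sym (take++drop≡id c xs))) (∑-++ (take c xs) (drop c xs) f)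
  h<z : h < ∑ zs f
  h<z = *-cancelˡ-< K h _ (<-≤-trans (+-cancelˡ-< h _ _ (<-≤-trans (≰⇒> ¬p) (≤-reflexive parts))) heavy)

-- The class consists of almost regular graphs: D bounds all degrees and is at most κ times the
-- average degree. The degree bound concerns every y of A, even outside `vs`.
RegularBound : (A : Set) → DecidableEquality A → (s t s' p κ thr e g C : ℕ) → Set
RegularBound A _≟_ s t s' p κ thr e g C =
  (adj : A → A → Bool) → (∀ x y → adj x y ≡ adj y x) → (∀ x → adj x x ≡ false) →
  ¬ Config adj s t s' p → ∀ vs → Unique vs → ∀ D → 1 ≤ D → (∀ y → count vs (adj y) ≤ D) →
  1 ≤ length vs → length vs * D ≤ κ * ∑ vs (λ y → count vs (adj y)) → thr ≤ D →
  D ^ e ≤ C * length vs ^ g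

module _ (s₀ t₀ s' p₀ : ℕ) where

  lightness : ℕ
  lightness = 2 * 2 ^ suc (suc s₀) * starConst (suc s₀) (suc t₀) (suc p₀) + 1

  -- There are k^(s·t + s') choices of roots; dividing `core-bound` by k leaves the exponent g = s·t
  -- + s' - 1 = e - m.
  regular-bound : s' ≤ suc (suc s₀) → suc (suc s₀) ≤ s' + suc t₀ → ∀ {g} → suc s₀ * suc t₀ + s' ≡ suc g →
    ∀ κ {A : Set} (_≟_ : DecidableEquality A) →
    RegularBound A _≟_ (suc s₀) (suc t₀) s' (suc p₀) κ (Parameters.threshold s₀ t₀ s' lightness κ) (suc s₀ * suc t₀ + (s' + suc t₀)) g
      (Parameters.finalConst s₀ t₀ s' lightness p₀ (starConst (suc s₀) (suc t₀) (suc p₀)) κ)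
  regular-bound s'≤a a≤N {g} g≡ κ _≟_ adj adj-sym adj-irrefl NC vs un D 1≤D deg≤D 1≤k avg big = *-cancelˡ-≤ k {{>-nonZero 1≤k}} (begin
    k * D ^ e                        ≤⟨ Core.core-bound _≟_ adj adj-sym adj-irrefl vs un s₀ t₀ s' lightness D deg≤D 1≤D p₀ L κ NC
                                          (Star.star-bound _≟_ adj adj-sym adj-irrefl s₀ t s' (suc p₀) s'≤a NC vs un)
                                          a≤N (m≤m+n _ 1) (m≤n+m 1 _) 1≤k avg big ⟩
    C * (k ^ s' * (k ^ s) ^ t)       ≡⟨ cong (C *_) (trans (cong (k ^ s' *_) (^-*-assoc k s t)) (trans (sym (^-distribˡ-+-* k s' (s * t))) (cong (k ^_) (trans (+-comm s' (s * t)) g≡)))) ⟩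
    C * (k * k ^ g)                  ≡⟨ lem C k (k ^ g) ⟩
    k * (C * k ^ g)                  ∎)
    where
    open ≤-Reasoning
    s t e k L C : ℕ
    s = suc s₀
    t = suc t₀
    e = s * t + (s' + t)
    k = length vs
    L = starConst s t (suc p₀)
    C = Parameters.finalConst s₀ t₀ s' lightness p₀ L κ
    lem : ∀ c k x → c * (k * x) ≡ k * (c * x)
    lem = solve-∀

-- K is both the ratio of the degree cutoff to the average degree and the number of chunks.
-- `K-large` beats the constants lost in `heavy-case`; `K^≤C` settles graphs with at most K vertices
-- and `thr^≤C` those whose D would not exceed the threshold.
module Regularise (s t s' p e₀ g K C thr C₃ : ℕ) (e≡ : suc e₀ ≡ suc t + g) (1≤g : 1 ≤ g) (5≤K : 5 ≤ K)
  (K-large : 4 ^ (suc e₀ + (suc e₀ + g)) ≤ K) (K^≤C : K ^ suc t ≤ C) (thr^≤C : suc thr ^ suc e₀ ≤ C) (C₃≤C : C₃ ≤ C)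
  {A : Set} (_≟_ : DecidableEquality A) (regular : RegularBound A _≟_ s t s' p (4 * K) thr (suc e₀) g C₃) where

  e κ : ℕ
  e = suc e₀
  κ = 4 * K

  instance
    K≢0 : NonZero K
    K≢0 = >-nonZero (≤-trans (s≤s z≤n) 5≤K)

  1≤C : 1 ≤ C
  1≤C = ≤-trans (m^n>0 K (suc t)) K^≤C

  module _ (adj : A → A → Bool) (adj-sym : ∀ x y → adj x y ≡ adj y x) (adj-irrefl : ∀ x → adj x x ≡ false)
           (NC : ¬ Config adj s t s' p) where

    E : List A → List A → ℕ
    E xs ys = ∑ xs (λ x → count ys (adj x))

    -- The cleared form of E = O(k^(2 - m/e)), since e + g = 2·e - m. E counts ordered pairs, so
    -- each edge contributes twice.
    Bounded : List A → Set
    Bounded vs = E vs vs ^ e ≤ C * length vs ^ (e + g)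

    E-sym : ∀ xs ys → E xs ys ≡ E ys xs
    E-sym xs ys = trans (∑-swap xs ys _) (∑-cong ys (λ y → ∑-cong xs (λ x → cong ind (adj-sym x y))))

    small-bounded : ∀ vs → length vs ≤ K → Bounded vs
    small-bounded vs small = begin
      E vs vs ^ e              ≤⟨ ^-monoˡ-≤ e (≤-trans (∑-mono vs (λ x → count≤length vs (adj x))) (≤-reflexive (∑-const vs k))) ⟩
      (k * k) ^ e              ≡⟨ [m*n]^k k k e ⟩
      k ^ e * k ^ e            ≡⟨ cong (k ^ e *_) (trans (cong (k ^_) e≡) (^-distribˡ-+-* k (suc t) g)) ⟩
      k ^ e * (k ^ suc t * k ^ g)  ≡⟨ lem (k ^ e) (k ^ suc t) (k ^ g) ⟩
      k ^ suc t * (k ^ e * k ^ g)  ≡⟨ cong (k ^ suc t *_) (sym (^-distribˡ-+-* k e g)) ⟩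
      k ^ suc t * k ^ (e + g)  ≤⟨ *-monoˡ-≤ (k ^ (e + g)) (≤-trans (^-monoˡ-≤ (suc t) small) K^≤C) ⟩
      C * k ^ (e + g)          ∎
      where
      open ≤-Reasoning
      k = length vs
      lem : ∀ x y z → x * (y * z) ≡ y * (x * z)
      lem = solve-∀

    module Step (vs : List A) (un : Unique vs) (IH : ∀ ys → Unique ys → length ys < length vs → Bounded ys)
                (unbounded : C * length vs ^ (e + g) < E vs vs ^ e) (K<k : K < length vs) where

      open ≤-Reasoning

      k Ev : ℕ
      k = length vs
      Ev = E vs vs

      instance
        k≢0 : NonZero k
        k≢0 = >-nonZero (≤-<-trans z≤n K<k)

      k≤Ev : k ≤ Ev
      k≤Ev with k ≤? Ev
      ... | yes p = p
      ... | no ¬p = ⊥-elim (<⇒≱ unbounded (begin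
        Ev ^ e             ≤⟨ ^-monoˡ-≤ e (<⇒≤ (≰⇒> ¬p)) ⟩
        k ^ e              ≤⟨ m≤m*n (k ^ e) (k ^ g) {{m^n≢0 k g}} ⟩
        k ^ e * k ^ g      ≡⟨ sym (^-distribˡ-+-* k e g) ⟩
        k ^ (e + g)        ≤⟨ m≤n*m (k ^ (e + g)) C {{>-nonZero 1≤C}} ⟩
        C * k ^ (e + g)    ∎))

      instance
        Ev≢0 : NonZero Ev
        Ev≢0 = >-nonZero (<-≤-trans (≤-<-trans z≤n K<k) k≤Ev)

      floor-above : ∀ m n .{{_ : NonZero n}} → m < suc (m / n) * n
      floor-above m n = begin-strict
        m                    ≡⟨ m≡m%n+[m/n]*n m n ⟩
        m % n + m / n * n    <⟨ +-monoˡ-< (m / n * n) (m%n<n m n) ⟩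
        suc (m / n) * n      ∎

      floor-below : ∀ m n .{{_ : NonZero n}} → n ≤ m → suc (m / n) * n ≤ 2 * m
      floor-below m n le = begin
        n + m / n * n        ≤⟨ +-mono-≤ le (m/n*n≤m m n) ⟩
        m + m                ≡⟨ cong (m +_) (sym (+-identityʳ m)) ⟩
        2 * m                ∎

      -- c is just above k/K and D just above K times the average degree Ev/k, so fewer than c
      -- vertices can reach degree D.
      c D : ℕ
      c = suc (k / K)
      D = suc (K * Ev / k)

      KE<Dk : K * Ev < D * k
      KE<Dk = floor-above (K * Ev) k

      Dk≤2KE : D * k ≤ 2 * (K * Ev)
      Dk≤2KE = floor-below (K * Ev) k (≤-trans k≤Ev (m≤n*m Ev K))

      deg : A → ℕ
      deg y = count vs (adj y)

      P : A → Bool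
      P y = D ≤ᵇ deg y

      B B′ : List A
      B = filterᵇ P vs
      B′ = filterᵇ (λ y → not (P y)) vs

      |B|<c : length B < c
      |B|<c = *-cancelʳ-< K (length B) c (≤-<-trans (*-cancelʳ-≤ (length B * K) k Ev (begin
        length B * K * Ev        ≡⟨ *-assoc (length B) K Ev ⟩
        length B * (K * Ev)      ≤⟨ *-monoʳ-≤ (length B) (<⇒≤ KE<Dk) ⟩
        length B * (D * k)       ≡⟨ sym (*-assoc (length B) D k) ⟩
        length B * D * k         ≤⟨ *-monoˡ-≤ k |B|D≤E ⟩
        Ev * k                   ≡⟨ *-comm Ev k ⟩
        k * Ev                   ∎)) (floor-above k K))
        where
        |B|D≤E : length B * D ≤ Ev
        |B|D≤E = begin
          length B * D         ≡⟨ sym (∑-const B D) ⟩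
          ∑ B (λ _ → D)        ≤⟨ ∑-mono-∈ B (λ {y} i → ≤ᵇ-true {D} {deg y} (proj₂ (∈-filter⁻ P vs i))) ⟩
          ∑ B deg              ≤⟨ ∑-filter≤ P vs deg ⟩
          Ev                   ∎

      E-split : ∀ xs → E xs vs ≡ E xs B + E xs B′
      E-split xs = trans (∑-cong xs (λ x → ∑-partition P vs _)) (∑-+ xs _ _)

      Ev≤ : Ev ≤ 2 * E B vs + E B′ B′
      Ev≤ = begin
        Ev                                        ≡⟨ ∑-partition P vs deg ⟩
        E B vs + E B′ vs                          ≡⟨ cong (E B vs +_) (E-split B′) ⟩
        E B vs + (E B′ B + E B′ B′)               ≡⟨ cong (λ z → E B vs + (z + E B′ B′)) (E-sym B′ B) ⟩
        E B vs + (E B B′ + E B′ B′)               ≤⟨ +-monoʳ-≤ (E B vs) (+-monoˡ-≤ (E B′ B′) (≤-trans (m≤n+m (E B B′) (E B B)) (≤-reflexive (sym (E-split B))))) ⟩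
        E B vs + (E B vs + E B′ B′)               ≡⟨ lem (E B vs) (E B′ B′) ⟩
        2 * E B vs + E B′ B′                      ∎
        where lem : ∀ x y → x + (x + y) ≡ 2 * x + y
              lem = solve-∀

      -- B together with the heaviest of K chunks of B′ spans at most 4k/K vertices but keeps a
      -- share 1/(4K) of Ev. The induction hypothesis then gives Ev^e ≤ 4^(2e+g)·K^(-g)·C·k^(e+g),
      -- which `K-large` turns into the bound assumed to fail.
      heavy-case : Ev ≤ 4 * E B vs → ⊥
      heavy-case heavy with largest-chunk K c B′ (λ z → count B (λ x → adj x z)) (filter-unique _ un)
          (≤-trans (≤-trans (≤-reflexive (length-filter _ vs)) (count≤length vs _)) (≤-trans (<⇒≤ (floor-above k K)) (≤-reflexive (*-comm c K))))
      ... | Z , unZ , Z⊆ , short , hz = <⇒≱ unbounded (*-cancelˡ-≤ (K ^ (e + g)) {{m^n≢0 K (e + g)}} (begin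
        K ^ (e + g) * Ev ^ e
          ≤⟨ *-monoʳ-≤ (K ^ (e + g)) (^-monoˡ-≤ e (≤-trans heavy (*-monoʳ-≤ 4 dense))) ⟩
        K ^ (e + g) * (4 * (K * E S S)) ^ e
          ≡⟨ cong (K ^ (e + g) *_) (trans ([m*n]^k 4 (K * E S S) e) (cong (4 ^ e *_) ([m*n]^k K (E S S) e))) ⟩
        K ^ (e + g) * (4 ^ e * (K ^ e * E S S ^ e))
          ≤⟨ *-monoʳ-≤ (K ^ (e + g)) (*-monoʳ-≤ (4 ^ e) (*-monoʳ-≤ (K ^ e) (≤-trans (IH S unS |S|<k) (*-monoʳ-≤ C (^-monoˡ-≤ (e + g) |S|≤2c))))) ⟩
        K ^ (e + g) * (4 ^ e * (K ^ e * (C * (c + c) ^ (e + g))))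
          ≡⟨ lem₁ (K ^ (e + g)) (4 ^ e) (K ^ e) C ((c + c) ^ (e + g)) ⟩
        4 ^ e * K ^ e * C * ((c + c) ^ (e + g) * K ^ (e + g))
          ≡⟨ cong (4 ^ e * K ^ e * C *_) (sym ([m*n]^k (c + c) K (e + g))) ⟩
        4 ^ e * K ^ e * C * ((c + c) * K) ^ (e + g)
          ≤⟨ *-monoʳ-≤ (4 ^ e * K ^ e * C) (≤-trans (^-monoˡ-≤ (e + g) 2cK≤4k) (≤-reflexive ([m*n]^k 4 k (e + g)))) ⟩
        4 ^ e * K ^ e * C * (4 ^ (e + g) * k ^ (e + g))
          ≡⟨ lem₂ (4 ^ e) (K ^ e) C (4 ^ (e + g)) (k ^ (e + g)) ⟩
        K ^ e * (4 ^ e * 4 ^ (e + g)) * (C * k ^ (e + g))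
          ≤⟨ *-monoˡ-≤ (C * k ^ (e + g)) (*-monoʳ-≤ (K ^ e) 4≤K^g) ⟩
        K ^ e * K ^ g * (C * k ^ (e + g))
          ≡⟨ cong (_* (C * k ^ (e + g))) (sym (^-distribˡ-+-* K e g)) ⟩
        K ^ (e + g) * (C * k ^ (e + g)) ∎))
        where
        S = B ++ Z
        lem₁ : ∀ a b x y z → a * (b * (x * (y * z))) ≡ b * x * y * (z * a)
        lem₁ = solve-∀
        lem₂ : ∀ a b x y z → a * b * x * (y * z) ≡ b * (a * y) * (x * z)
        lem₂ = solve-∀
        4≤K^g : 4 ^ e * 4 ^ (e + g) ≤ K ^ g
        4≤K^g = begin
          4 ^ e * 4 ^ (e + g)    ≡⟨ sym (^-distribˡ-+-* 4 e (e + g)) ⟩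
          4 ^ (e + (e + g))      ≤⟨ K-large ⟩
          K                      ≡⟨ sym (*-identityʳ K) ⟩
          K ^ 1                  ≤⟨ ^-monoʳ-≤ K 1≤g ⟩
          K ^ g                  ∎
        2cK≤4k : (c + c) * K ≤ 4 * k
        2cK≤4k = begin
          (c + c) * K            ≡⟨ *-distribʳ-+ K c c ⟩
          c * K + c * K          ≤⟨ +-mono-≤ (floor-below k K (<⇒≤ K<k)) (floor-below k K (<⇒≤ K<k)) ⟩
          2 * k + 2 * k          ≡⟨ sym (*-distribʳ-+ k 2 2) ⟩
          4 * k                  ∎
        |S|≤2c : length S ≤ c + c
        |S|≤2c = ≤-trans (≤-reflexive (length-++ B)) (+-mono-≤ (<⇒≤ |B|<c) short)
        |S|<k : length S < k
        -- The strict decrease comes from (c + c)·K ≤ 4·k < K·k, which is why K is at least 5.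
        |S|<k = ≤-<-trans |S|≤2c (*-cancelʳ-< K (c + c) k (≤-<-trans 2cK≤4k (<-≤-trans (*-monoˡ-< k (≤-refl {5})) (≤-trans (*-monoˡ-≤ k 5≤K) (≤-reflexive (*-comm K k))))))
        unS : Unique S
        unS = Unique.++⁺ (filter-unique P un) unZ (λ { (i , j) → absurdᵇ (proj₂ (∈-filter⁻ P vs i)) (not-true (proj₂ (∈-filter⁻ (λ y → not (P y)) vs (Z⊆ j)))) })
        dense : E B vs ≤ K * E S S
        dense = begin
          E B vs                          ≡⟨ E-split B ⟩
          E B B + E B B′                  ≤⟨ +-mono-≤ (m≤n*m (E B B) K) (≤-trans (≤-reflexive (∑-swap B B′ _)) (≤-trans hz (≤-reflexive (cong (K *_) (∑-swap Z B _))))) ⟩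
          K * E B B + K * E B Z           ≡⟨ sym (*-distribˡ-+ K (E B B) (E B Z)) ⟩
          K * (E B B + E B Z)             ≡⟨ cong (K *_) (sym (trans (∑-cong B (λ x → ∑-++ B Z _)) (∑-+ B _ _))) ⟩
          K * E B S                       ≤⟨ *-monoʳ-≤ K (≤-trans (m≤m+n (E B S) (E Z S)) (≤-reflexive (sym (∑-++ B Z _)))) ⟩
          K * E S S                       ∎

      -- Deleting B keeps at least half of Ev and caps the degrees at D, and D·k ≤ 2·K·Ev makes D at
      -- most 4·K times the new average degree. So `regular` applies and contradicts D^e > C·k^g.
      light-case : 4 * E B vs < Ev → ⊥
      light-case thin = <⇒≱ D^e> (begin
        D ^ e                        ≤⟨ regular adj′ adj′-sym adj′-irrefl NC′ B′ (filter-unique _ un) D (s≤s z≤n) deg≤D 1≤k′ average (<⇒≤ thr<D) ⟩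
        C₃ * length B′ ^ g           ≤⟨ *-mono-≤ C₃≤C (^-monoˡ-≤ g k′≤k) ⟩
        C * k ^ g                    ∎)
        where
        k′≤k : length B′ ≤ k
        k′≤k = ≤-trans (≤-reflexive (length-filter _ vs)) (count≤length vs _)
        Ev≤2E′ : Ev ≤ 2 * E B′ B′
        Ev≤2E′ = +-cancelˡ-≤ Ev _ _ (begin
          Ev + Ev                          ≡⟨ cong (Ev +_) (sym (+-identityʳ Ev)) ⟩
          2 * Ev                           ≤⟨ *-monoʳ-≤ 2 Ev≤ ⟩
          2 * (2 * E B vs + E B′ B′)       ≡⟨ lem (E B vs) (E B′ B′) ⟩
          4 * E B vs + 2 * E B′ B′         ≤⟨ +-monoˡ-≤ _ (<⇒≤ thin) ⟩
          Ev + 2 * E B′ B′                 ∎)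
          where lem : ∀ x y → 2 * (2 * x + y) ≡ 4 * x + 2 * y
                lem = solve-∀
        D^e> : C * k ^ g < D ^ e
        D^e> = *-cancelˡ-< (k ^ e) _ _ (begin-strict
          k ^ e * (C * k ^ g)      ≡⟨ lem (k ^ e) C (k ^ g) ⟩
          C * (k ^ e * k ^ g)      ≡⟨ cong (C *_) (sym (^-distribˡ-+-* k e g)) ⟩
          C * k ^ (e + g)          <⟨ unbounded ⟩
          Ev ^ e                   ≤⟨ ^-monoˡ-≤ e (≤-trans (m≤n*m Ev K) (<⇒≤ KE<Dk)) ⟩
          (D * k) ^ e              ≡⟨ trans ([m*n]^k D k e) (*-comm (D ^ e) (k ^ e)) ⟩
          k ^ e * D ^ e            ∎)
          where lem : ∀ x y z → x * (y * z) ≡ y * (x * z)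
                lem = solve-∀
        thr<D : thr < D
        thr<D with thr <? D
        ... | yes p = p
        ... | no ¬p = ⊥-elim (<⇒≱ D^e> (begin
          D ^ e           ≤⟨ ^-monoˡ-≤ e (≤-trans (≮⇒≥ ¬p) (n≤1+n _)) ⟩
          suc thr ^ e     ≤⟨ thr^≤C ⟩
          C               ≤⟨ m≤m*n C (k ^ g) {{m^n≢0 k g}} ⟩
          C * k ^ g       ∎))
        -- Edges leaving B′ are removed because `regular` asks for the degree bound at every vertex
        -- of A, including those of B.
        adj′ : A → A → Bool
        adj′ x y = adj x y ∧ (mem _≟_ x B′ ∧ mem _≟_ y B′)
        adj′-sym : ∀ x y → adj′ x y ≡ adj′ y x
        adj′-sym x y = cong₂ _∧_ (adj-sym x y) (∧-comm (mem _≟_ x B′) (mem _≟_ y B′))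
        adj′-irrefl : ∀ x → adj′ x x ≡ false
        adj′-irrefl x rewrite adj-irrefl x = refl
        NC′ : ¬ Config adj′ s t s' p
        NC′ F = NC (record { v = v ; w = w ; u = u ; q = q
          ; v~w = λ c i → proj₁ (∧-elim (v~w c i)) ; v~q = λ c j → proj₁ (∧-elim (v~q c j)) ; q~u = λ c j i → proj₁ (∧-elim (q~u c j i))
          ; v-inj = v-inj ; w-inj = w-inj ; u-inj = u-inj ; q-inj = q-inj
          ; v≢u = v≢u ; v≢q = v≢q ; w≢u = w≢u ; w≢q = w≢q ; u≢q = u≢q })
          where open Config F
        deg≤D : ∀ y → count B′ (adj′ y) ≤ D
        deg≤D y with true-or-false (mem _≟_ y B′)
        ... | inj₂ out = ≤-trans (≤-reflexive (count-false B′ (λ x → outside (adj y x) (mem _≟_ x B′) out))) z≤n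
          where outside : ∀ a b {m} → m ≡ false → a ∧ (m ∧ b) ≡ false
                outside true  b refl = refl
                outside false b refl = refl
        ... | inj₁ inside = ≤-trans (count-mono B′ (λ x h → proj₁ (∧-elim h))) (≤-trans (∑-filter≤ (λ y → not (P y)) vs _)
                (≤ᵇ-false {D} {deg y} (not-true (proj₂ (∈-filter⁻ (λ y → not (P y)) vs (mem-true _≟_ y B′ inside))))))
        E′ : E B′ B′ ≤ ∑ B′ (λ y → count B′ (adj′ y))
        E′ = ∑-mono-∈ B′ (λ x∈ → ∑-mono-∈ B′ (λ y∈ → ind-mono (λ h → ∧-intro h (∧-intro (∈⇒mem _≟_ x∈) (∈⇒mem _≟_ y∈)))))
        1≤k′ : 1 ≤ length B′
        1≤k′ with B′ in eq
        ... | _ ∷ _ = s≤s z≤n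
        ... | []    = ⊥-elim (<⇒≱ (≤-<-trans z≤n K<k) (≤-trans k≤Ev (≤-trans Ev≤2E′ (≤-reflexive (cong (λ l → 2 * E l l) eq)))))
        average : length B′ * D ≤ κ * ∑ B′ (λ y → count B′ (adj′ y))
        average = begin
          length B′ * D                 ≤⟨ *-monoˡ-≤ D k′≤k ⟩
          k * D                         ≡⟨ *-comm k D ⟩
          D * k                         ≤⟨ Dk≤2KE ⟩
          2 * (K * Ev)                  ≤⟨ *-monoʳ-≤ 2 (*-monoʳ-≤ K Ev≤2E′) ⟩
          2 * (K * (2 * E B′ B′))       ≡⟨ lem K (E B′ B′) ⟩
          κ * E B′ B′                   ≤⟨ *-monoʳ-≤ κ E′ ⟩
          κ * ∑ B′ (λ y → count B′ (adj′ y)) ∎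
          where lem : ∀ k x → 2 * (k * (2 * x)) ≡ 4 * k * x
                lem = solve-∀

      impossible : ⊥
      impossible with Ev ≤? 4 * E B vs
      ... | yes p = heavy-case p
      ... | no ¬p = light-case (≰⇒> ¬p)

    bounded : ∀ n vs → Unique vs → length vs ≤ n → Bounded vs
    bounded zero    [] un le = z≤n
    bounded (suc n) vs un le with length vs ≤? K
    ... | yes small = small-bounded vs small
    ... | no large with E vs vs ^ e ≤? C * length vs ^ (e + g)
    ...   | yes ok = ok
    ...   | no ¬ok = ⊥-elim (Step.impossible vs un (λ ys un′ lt → bounded n ys un′ (≤-pred (≤-trans lt le))) (≰⇒> ¬ok) (≰⇒> large))

-- Choice of the constants

large-number : ∀ x → ∃ λ K → 5 ≤ K × x ≤ K
large-number x = 5 + x , m≤m+n 5 x , m≤n+m x 5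

common-bound : ∀ x y z → ∃ λ C → x ≤ C × y ≤ C × z ≤ C
common-bound x y z = x + y + z , ≤-trans (m≤m+n x y) (m≤m+n (x + y) z) , ≤-trans (m≤n+m y x) (m≤m+n (x + y) z) , m≤n+m z (x + y)

-- K depends only on e and g and is fixed first; the threshold and the final constant depend on κ =
-- 4·K, so C comes after it.
edge-bound : ∀ s₀ t₀ s' p₀ g → s' ≤ suc (suc s₀) → suc (suc s₀) ≤ s' + suc t₀ → suc s₀ * suc t₀ + s' ≡ suc g → 1 ≤ g →
  let e = suc s₀ * suc t₀ + (s' + suc t₀) in
  ∃ λ C → ∀ {A : Set} (_≟_ : DecidableEquality A) (adj : A → A → Bool) → (∀ x y → adj x y ≡ adj y x) → (∀ x → adj x x ≡ false) →
    ¬ Config adj (suc s₀) (suc t₀) s' (suc p₀) → ∀ vs → Unique vs →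
    ∑ vs (λ x → count vs (adj x)) ^ e ≤ C * length vs ^ (e + g)
edge-bound s₀ t₀ s' p₀ g s'≤a a≤N g≡ 1≤g
  with large-number (4 ^ (suc s₀ * suc t₀ + (s' + suc t₀) + (suc s₀ * suc t₀ + (s' + suc t₀) + g)))
... | K , 5≤K , 4^≤K
  with common-bound (K ^ suc (suc t₀)) (suc (Parameters.threshold s₀ t₀ s' (lightness s₀ t₀ s' p₀) (4 * K)) ^ (suc s₀ * suc t₀ + (s' + suc t₀)))
         (Parameters.finalConst s₀ t₀ s' (lightness s₀ t₀ s' p₀) p₀ (starConst (suc s₀) (suc t₀) (suc p₀)) (4 * K))
... | C , C₁ , C₂ , C₃ = C , λ _≟_ adj adj-sym adj-irrefl NC vs un →
  Regularise.bounded (suc s₀) (suc t₀) s' (suc p₀) _ g K C _ _ e≡ 1≤g 5≤K 4^≤K C₁ C₂ C₃ _≟_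
    (regular-bound s₀ t₀ s' p₀ s'≤a a≤N g≡ (4 * K) _≟_) adj adj-sym adj-irrefl NC (length vs) vs un ≤-refl
  where
  e≡ : suc s₀ * suc t₀ + (s' + suc t₀) ≡ suc (suc t₀) + g
  e≡ = trans (sym (+-assoc (suc s₀ * suc t₀) s' (suc t₀))) (trans (cong (_+ suc t₀) g≡) (trans (+-comm (suc g) (suc t₀)) (+-suc (suc t₀) g)))

-- For t = 1 the two non-roots v₀ and q₁ play symmetric roles.
swap-config : ∀ {A : Set} {adj : A → A → Bool} → (∀ x y → adj x y ≡ adj y x) → (∀ x → adj x x ≡ false) →
              ∀ {s s' p} → Config adj s' 1 s p → Config adj s 1 s' p
swap-config {adj = adj} adj-sym adj-irrefl F = record
  { v = λ c → q c zero ; w = u zero ; u = λ _ → w ; q = λ c _ → v c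
  ; v~w = λ c i → q~u c zero i
  ; v~q = λ c _ → trans (adj-sym _ _) (v~q c zero)
  ; q~u = λ c _ i → v~w c i
  ; v-inj = λ e → proj₁ (q-inj e)
  ; w-inj = λ e → proj₂ (u-inj e)
  ; u-inj = λ { {zero} {_} {zero} e → refl , w-inj e }
  ; q-inj = λ { {_} {zero} {_} {zero} e → v-inj e , refl }
  ; v≢u = λ e → w≢q (sym e)
  ; v≢q = λ e → v≢q (sym e)
  ; w≢u = λ e → w≢u (sym e)
  ; w≢q = λ e → v≢u (sym e)
  ; u≢q = λ e → v≢w (sym e) }
  where
  open Config F
  v≢w : ∀ {c i} → v c ≢ w i
  v≢w {c} {i} e = absurdᵇ (subst (λ z → adj (v c) z ≡ true) (sym e) (v~w c i)) (adj-irrefl (v c))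

-- The trees T_{s,t,s'}

⌊≟⌋-true : ∀ {n} (x y : Fin n) → ⌊ x Fin.≟ y ⌋ ≡ true → x ≡ y
⌊≟⌋-true x y e with x Fin.≟ y
... | yes q = q

config⇒contains : ∀ {n} (G : SimpleGraph n) s t s' p → Config (SimpleGraph.adj G) s t s' p →
                  Contains G (PowV (T s t s') p) (powAdj (T s t s') p)
config⇒contains {n} G s t s' p F = f , f-inj , f-adj
  where
  open Config F
  open SimpleGraph G renaming (sym to adj-sym)
  adj≢ : ∀ {x y} → adj x y ≡ true → x ≢ y
  adj≢ {x} e refl = absurdᵇ e (irrefl x)
  root : Fin (t * s) ⊎ Fin s' → Fin n
  root (inj₁ b) = u (proj₁ (remQuot {t} s b)) (proj₂ (remQuot {t} s b))
  root (inj₂ i) = w i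
  f : PowV (T s t s') p → Fin n
  f (inj₁ i)           = root (splitAt (t * s) i)
  f (inj₂ (c , zero))  = v c
  f (inj₂ (c , suc j)) = q c j
  root-inj : ∀ x y → root x ≡ root y → x ≡ y
  root-inj (inj₁ b) (inj₁ b′) e with u-inj e
  ... | e₁ , e₂ = cong inj₁ (trans (sym (combine-remQuot {t} s b)) (trans (cong₂ combine e₁ e₂) (combine-remQuot {t} s b′)))
  root-inj (inj₁ b) (inj₂ i)  e = ⊥-elim (w≢u (sym e))
  root-inj (inj₂ i) (inj₁ b)  e = ⊥-elim (w≢u e)
  root-inj (inj₂ i) (inj₂ i′) e = cong inj₂ (w-inj e)
  v≢root : ∀ c x → v c ≢ root x
  v≢root c (inj₁ b) = v≢u
  v≢root c (inj₂ i) = adj≢ (v~w c i)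
  q≢root : ∀ c j x → q c j ≢ root x
  q≢root c j (inj₁ b) e = u≢q (sym e)
  q≢root c j (inj₂ i) e = w≢q (sym e)
  f-inj : Injective _≡_ _≡_ f
  f-inj {inj₁ i} {inj₁ i′} e = cong inj₁ (trans (sym (join-splitAt (t * s) s' i)) (trans (cong (Fin.join (t * s) s') (root-inj (splitAt (t * s) i) (splitAt (t * s) i′) e)) (join-splitAt (t * s) s' i′)))
  f-inj {inj₁ i} {inj₂ (c , zero)}   e = ⊥-elim (v≢root c (splitAt (t * s) i) (sym e))
  f-inj {inj₁ i} {inj₂ (c , suc j)}  e = ⊥-elim (q≢root c j (splitAt (t * s) i) (sym e))
  f-inj {inj₂ (c , zero)}  {inj₁ i}  e = ⊥-elim (v≢root c (splitAt (t * s) i) e)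
  f-inj {inj₂ (c , suc j)} {inj₁ i}  e = ⊥-elim (q≢root c j (splitAt (t * s) i) e)
  f-inj {inj₂ (c , zero)}  {inj₂ (d , zero)}  e = cong (λ z → inj₂ (z , zero)) (v-inj e)
  f-inj {inj₂ (c , zero)}  {inj₂ (d , suc j)} e = ⊥-elim (v≢q e)
  f-inj {inj₂ (c , suc j)} {inj₂ (d , zero)}  e = ⊥-elim (v≢q (sym e))
  f-inj {inj₂ (c , suc j)} {inj₂ (d , suc k)} e with q-inj e
  ... | refl , refl = refl
  to-root : ∀ i c x → ⌊ parentT s t s' i Fin.≟ x ⌋ ≡ true → adj (f (inj₂ (c , x))) (f (inj₁ i)) ≡ true
  to-root i c x e with splitAt (t * s) i
  to-root i c zero    e | inj₁ b = ⊥-elim (absurdᵇ e refl)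
  to-root i c (suc j) e | inj₁ b with ⌊≟⌋-true (suc (proj₁ (remQuot {t} s b))) (suc j) e
  ... | refl = q~u c (proj₁ (remQuot {t} s b)) (proj₂ (remQuot {t} s b))
  to-root i c zero    e | inj₂ k = v~w c k
  to-root i c (suc j) e | inj₂ k = ⊥-elim (absurdᵇ e refl)
  f-adj : ∀ x y → powAdj (T s t s') p x y ≡ true → adj (f x) (f y) ≡ true
  f-adj (inj₁ i) (inj₁ i′) ()
  f-adj (inj₁ i) (inj₂ (c , x)) e = trans (adj-sym _ _) (to-root i c x e)
  f-adj (inj₂ (c , x)) (inj₁ i) e = to-root i c x e
  f-adj (inj₂ (c , x)) (inj₂ (d , y)) e with ⌊≟⌋-true c d (proj₁ (∧-elim e))
  f-adj (inj₂ (c , zero))  (inj₂ (c , zero))  e | refl = ⊥-elim (absurdᵇ (proj₂ (∧-elim {⌊ c Fin.≟ c ⌋} e)) refl)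
  f-adj (inj₂ (c , zero))  (inj₂ (c , suc j)) e | refl = v~q c j
  f-adj (inj₂ (c , suc j)) (inj₂ (c , zero))  e | refl = trans (adj-sym _ _) (v~q c j)
  f-adj (inj₂ (c , suc j)) (inj₂ (c , suc k)) e | refl = ⊥-elim (absurdᵇ (proj₂ (∧-elim {⌊ c Fin.≟ c ⌋} e)) refl)

sumF-cong : ∀ n {f g : Fin n → ℕ} → (∀ i → f i ≡ g i) → sumF n f ≡ sumF n g
sumF-cong zero    e = refl
sumF-cong (suc n) e = cong₂ _+_ (e zero) (sumF-cong n (λ i → e (suc i)))

sumF-const : ∀ n c → sumF n (λ _ → c) ≡ n * c
sumF-const zero    c = refl
sumF-const (suc n) c = cong (c +_) (sumF-const n c)

sumF-zero : ∀ n {f : Fin n → ℕ} → (∀ i → f i ≡ 0) → sumF n f ≡ 0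
sumF-zero n e = trans (sumF-cong n e) (trans (sumF-const n 0) (*-zeroʳ n))

sumF-mono : ∀ n {f g : Fin n → ℕ} → (∀ i → f i ≤ g i) → sumF n f ≤ sumF n g
sumF-mono zero    e = z≤n
sumF-mono (suc n) e = +-mono-≤ (e zero) (sumF-mono n (λ i → e (suc i)))

sumF-++ : ∀ m n (f : Fin (m + n) → ℕ) → sumF (m + n) f ≡ sumF m (λ i → f (i Fin.↑ˡ n)) + sumF n (λ i → f (m Fin.↑ʳ i))
sumF-++ zero    n f = refl
sumF-++ (suc m) n f = trans (cong (f zero +_) (sumF-++ m n (λ i → f (suc i)))) (sym (+-assoc (f zero) _ _))

sumF-pick : ∀ n (S : Fin n → Bool) x → sumF n (λ y → ind (S y ∧ ⌊ x Fin.≟ y ⌋)) ≡ ind (S x)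
sumF-pick (suc n) S zero    = trans (cong₂ _+_ (cong ind (∧-identityʳ (S zero))) (sumF-zero n (λ i → cong ind (∧-zeroʳ (S (suc i)))))) (+-identityʳ _)
sumF-pick (suc n) S (suc x) = trans (cong₂ _+_ (cong ind (∧-zeroʳ (S zero))) (sumF-cong n (λ y → cong (λ z → ind (S (suc y) ∧ z)) (peel x y)))) (sumF-pick n (λ y → S (suc y)) x)
  where peel : ∀ {n} (x y : Fin n) → ⌊ suc x Fin.≟ suc y ⌋ ≡ ⌊ x Fin.≟ y ⌋
        peel x y with x Fin.≟ y
        ... | yes _ = refl
        ... | no _  = refl

∑-tabulate : ∀ {X : Set} n (h : Fin n → X) (f : X → ℕ) → ∑ (tabulate h) f ≡ sumF n (λ i → f (h i))
∑-tabulate zero    h f = refl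
∑-tabulate (suc n) h f = cong (f (h zero) +_) (∑-tabulate n (λ i → h (suc i)) f)

edges≤ : ∀ {n} (G : SimpleGraph n) → edges G ≤ ∑ (allFin n) (λ x → count (allFin n) (SimpleGraph.adj G x))
edges≤ {n} G = ≤-trans (sumF-mono n (λ i → sumF-mono n (λ j → ind-mono (λ e → proj₂ (∧-elim {i <F j} e)))))
  (≤-reflexive (sym (trans (∑-tabulate n _ _) (sumF-cong n (λ i → ∑-tabulate n _ _)))))

-- Consequences of balancedness

module Tree (s t s' : ℕ) where

  -- Balancedness is tested on {v₀} and on {q₁, ..., q_t}; the set with both flags true supplies the
  -- inner edges in e(F).
  level : Bool → Bool → Fin (suc t) → Bool
  level α β zero    = α
  level α β (suc _) = β

  inner-edges : ∀ α β → sumF (suc t) (λ x → sumF (suc t) (λ y → ind ((x <F y) ∧ (level α β x ∨ level α β y) ∧ innerT s t s' x y))) ≡ t * ind (α ∨ β)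
  inner-edges α β = trans (cong₂ _+_ (trans (sumF-cong t (λ j → cong ind (∧-identityʳ (α ∨ β)))) (sumF-const t _))
      (sumF-zero t (λ i → sumF-zero t (λ j → cong ind (trans (cong ((suc i <F suc j) ∧_) (∧-zeroʳ (β ∨ β))) (∧-zeroʳ (suc i <F suc j)))))))
    (+-identityʳ _)

  parent-level : ∀ α β → sumF (t * s + s') (λ i → ind (level α β (parentT s t s' i))) ≡ t * s * ind β + s' * ind α
  parent-level α β = trans (sumF-++ (t * s) s' _) (cong₂ _+_ (trans (sumF-cong (t * s) left) (sumF-const (t * s) _)) (trans (sumF-cong s' right) (sumF-const s' _)))
    where
    left : ∀ i → ind (level α β (parentT s t s' (i Fin.↑ˡ s'))) ≡ ind β
    left i rewrite splitAt-↑ˡ (t * s) i s' = refl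
    right : ∀ i → ind (level α β (parentT s t s' (t * s Fin.↑ʳ i))) ≡ ind α
    right i rewrite splitAt-↑ʳ (t * s) s' i = refl

  eAt-level : ∀ α β → eAt (T s t s') (level α β) ≡ t * s * ind β + s' * ind α + t * ind (α ∨ β)
  eAt-level α β = cong₂ _+_ (trans (sumF-cong (t * s + s') (λ i → sumF-pick (suc t) (level α β) (parentT s t s' i))) (parent-level α β)) (inner-edges α β)

  card-level : ∀ α β → card (T s t s') (level α β) ≡ ind α + t * ind β
  card-level α β = cong (ind α +_) (sumF-const t _)

  eR-T : eR (T s t s') ≡ t * s + s' + t
  eR-T = cong₂ _+_
    (cong₂ _+_ (sumF-zero (t * s + s') (λ i → sumF-zero (t * s + s') (λ j → cong ind (∧-zeroʳ (i <F j)))))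
      (trans (sumF-cong (t * s + s') (λ i → sumF-pick (suc t) (λ _ → true) (parentT s t s' i))) (trans (sumF-const (t * s + s') 1) (*-identityʳ _))))
    (trans (sumF-cong (suc t) (λ x → sumF-cong (suc t) (λ y → cong (λ z → ind ((x <F y) ∧ z)) (sym (all-levels x y))))) (trans (inner-edges true true) (*-identityʳ t)))
    where
    all-levels : ∀ x y → (level true true x ∨ level true true y) ∧ innerT s t s' x y ≡ innerT s t s' x y
    all-levels zero    y = refl
    all-levels (suc x) y = refl

  module _ (1≤t : 1 ≤ t) (bal : Balanced (T s t s')) where

    open ≤-Reasoning

    private instance
      t≢0 : NonZero t
      t≢0 = >-nonZero 1≤t

    balanced-level : ∀ α β → (t * s + s' + t) * (ind α + t * ind β) ≤ (t * s * ind β + s' * ind α + t * ind (α ∨ β)) * suc t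
    balanced-level α β = begin
      (t * s + s' + t) * (ind α + t * ind β)   ≡⟨ sym (cong₂ _*_ eR-T (card-level α β)) ⟩
      eR (T s t s') * card (T s t s') (level α β)    ≤⟨ proj₂ bal (level α β) ⟩
      eAt (T s t s') (level α β) * suc t             ≡⟨ cong (_* suc t) (eAt-level α β) ⟩
      (t * s * ind β + s' * ind α + t * ind (α ∨ β)) * suc t ∎

    -- Balancedness at S = {v₀}, where s' + t edges meet S: e(F) ≤ (s' + t)·(t + 1).
    s≤s'+t : s ≤ s' + t
    s≤s'+t = *-cancelʳ-≤ s (s' + t) t (+-cancelʳ-≤ (s' + t) _ _ (begin
      s * t + (s' + t)                                ≡⟨ lem₁ s t s' ⟩
      (t * s + s' + t) * (1 + t * 0)                  ≤⟨ balanced-level true false ⟩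
      (t * s * 0 + s' * 1 + t * 1) * suc t            ≡⟨ lem₂ s t s' ⟩
      (s' + t) * t + (s' + t)                         ∎))
      where lem₁ : ∀ s t s' → s * t + (s' + t) ≡ (t * s + s' + t) * (1 + t * 0)
            lem₁ = solve-∀
            lem₂ : ∀ s t s' → (t * s * 0 + s' * 1 + t * 1) * suc t ≡ (s' + t) * t + (s' + t)
            lem₂ = solve-∀

    -- Balancedness at S = {q₁, ..., q_t}. The inequality guarantees that the a common roots of
    -- `grid⇒config` suffice for the s' leaves of v₀.
    s'≤1+s : s' ≤ suc s
    s'≤1+s = *-cancelʳ-≤ s' (suc s) t (+-cancelʳ-≤ ((t * s + t) * t) _ _ (begin
      s' * t + (t * s + t) * t                        ≡⟨ lem₁ s t s' ⟩
      (t * s + s' + t) * (0 + t * 1)                  ≤⟨ balanced-level false true ⟩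
      (t * s * 1 + s' * 0 + t * 1) * suc t            ≡⟨ lem₂ s t s' ⟩
      suc s * t + (t * s + t) * t                     ∎))
      where lem₁ : ∀ s t s' → s' * t + (t * s + t) * t ≡ (t * s + s' + t) * (0 + t * 1)
            lem₁ = solve-∀
            lem₂ : ∀ s t s' → (t * s * 1 + s' * 0 + t * 1) * suc t ≡ suc s * t + (t * s + t) * t
            lem₂ = solve-∀

    -- This is ρ_F > 1, as e(F) is the number of roots plus t and m is 1 + t. It makes g = e(F) - m
    -- positive, which `Regularise` uses as K ≤ K^g.
    many-roots : 1 < t * s + s'
    many-roots = +-cancelʳ-< t 1 (t * s + s') (<-≤-trans (proj₁ bal) (≤-reflexive eR-T))

-- From pair counts on lists to the exponent on graphs

ExponentBound : (s t s' p : ℕ) → Set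
ExponentBound s t s' p =
  ∃ λ (C : ℕ) → ∃ λ (N : ℕ) → ∀ (n : ℕ) → N ≤ n →
  (G : SimpleGraph n) →
  ¬ Contains G (PowV (T s t s') p) (powAdj (T s t s') p) →
  edges G ^ eR (T s t s') ≤ C * n ^ (2 * eR (T s t s') ∸ RootedGraph.m (T s t s'))

GraphBound : (s t s' p e g : ℕ) → Set
GraphBound s t s' p e g =
  ∃ λ C → ∀ n (G : SimpleGraph n) → ¬ Config (SimpleGraph.adj G) s t s' p →
  ∑ (allFin n) (λ x → count (allFin n) (SimpleGraph.adj G x)) ^ e ≤ C * n ^ (e + g)

exponent-bound : ∀ s t s' p e g → eR (T s t s') ≡ e → e ≡ suc t + g →
  GraphBound s t s' p e g → ExponentBound s t s' p
exponent-bound s t s' p e g eR≡ e≡ (C , bound) rewrite eR≡ = C , 0 , λ n _ G NC → begin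
  edges G ^ e                                             ≤⟨ ^-monoˡ-≤ e (edges≤ G) ⟩
  ∑ (allFin n) (λ x → count (allFin n) (SimpleGraph.adj G x)) ^ e  ≤⟨ bound n G (λ F → NC (config⇒contains G s t s' p F)) ⟩
  C * n ^ (e + g)                                         ≡⟨ cong (λ z → C * n ^ z) (sym exponent) ⟩
  C * n ^ (2 * e ∸ suc t)                                 ∎
  where
  open ≤-Reasoning
  exponent : 2 * e ∸ suc t ≡ e + g
  exponent = trans (cong (_∸ suc t) (trans (cong (e +_) (trans (+-identityʳ e) e≡)) (lem e t g))) (m+n∸m≡n (suc t) (e + g))
    where lem : ∀ e t g → e + (suc t + g) ≡ suc t + (e + g)
          lem = solve-∀

on-graphs : ∀ {s t s' p} e g →
  (∃ λ C → ∀ {A : Set} (_≟_ : DecidableEquality A) (adj : A → A → Bool) → (∀ x y → adj x y ≡ adj y x) → (∀ x → adj x x ≡ false) →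
    ¬ Config adj s t s' p → ∀ vs → Unique vs → ∑ vs (λ x → count vs (adj x)) ^ e ≤ C * length vs ^ (e + g)) →
  GraphBound s t s' p e g
on-graphs e g (C , bound) = C , λ n G NC → ≤-trans (bound Fin._≟_ (SimpleGraph.adj G) (SimpleGraph.sym G) (SimpleGraph.irrefl G) NC (allFin n) (Unique.allFin⁺ n))
  (≤-reflexive (cong (λ k → C * k ^ (e + g)) (length-tabulate {n = n} (λ i → i))))

cube-large : ∀ s t → 2 ≤ t → t ≤ s → ¬ (s ^ 3 ∸ 1 ≤ t)
cube-large s t 2≤t t≤s le = <⇒≱ s+1<s³ (≤-trans (m∸n≤o⇒m≤n+o 1 (≤-trans le t≤s)) (≤-refl))
  where
  open ≤-Reasoning
  2≤s : 2 ≤ s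
  2≤s = ≤-trans 2≤t t≤s
  m∸n≤o⇒m≤n+o : ∀ {m o} n → m ∸ n ≤ o → m ≤ n + o
  m∸n≤o⇒m≤n+o {m} n h = ≤-trans (m≤n+m∸n m n) (+-monoʳ-≤ n h)
  s+1<s³ : 1 + s < s ^ 3
  s+1<s³ = begin-strict
    1 + s          <⟨ +-monoˡ-< s 2≤s ⟩
    s + s          ≤⟨ +-monoʳ-≤ s (m≤m+n s (s + (s + 0))) ⟩
    4 * s          ≡⟨ *-comm 4 s ⟩
    s * 4          ≤⟨ *-monoʳ-≤ s (^-monoˡ-≤ 2 2≤s) ⟩
    s ^ 3          ∎

theorem8 : (s t s' : ℕ) → 1 ≤ s → 1 ≤ t → (2 ≤ s ∸ s' → s ^ 3 ∸ 1 ≤ t) →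
    Balanced (T s t s') →
    (p : ℕ) → 1 ≤ p →
    ∃ λ (C : ℕ) → ∃ λ (N : ℕ) → ∀ (n : ℕ) → N ≤ n →
    (G : SimpleGraph n) →
    ¬ Contains G (PowV (T s t s') p) (powAdj (T s t s') p) →
    edges G ^ eR (T s t s') ≤ C * n ^ (2 * eR (T s t s') ∸ RootedGraph.m (T s t s'))
theorem8 s@(suc s₀) t@(suc t₀) s' _ 1≤t cond bal p@(suc p₀) _
  with m≤n⇒∃[o]m+o≡n (Tree.many-roots s t s' 1≤t bal) | suc s ≤? s' + t
-- `suc g₀` is one less than the number of roots, that is e(F) - m.
... | g₀ , g≡ | yes a≤N = exponent-bound s t s' p (s * t + (s' + t)) (suc g₀) (trans (Tree.eR-T s t s') (lem s t s'))
    (trans (sym (trans (lem s t s') refl)) (trans (cong (_+ t) (sym g≡)) (lem′ g₀ t)))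
    (on-graphs (s * t + (s' + t)) (suc g₀) (edge-bound s₀ t₀ s' p₀ (suc g₀) (Tree.s'≤1+s s t s' 1≤t bal) a≤N (trans (cong (_+ s') (*-comm s t)) (sym g≡)) (s≤s z≤n)))
  where
  lem : ∀ s t s' → t * s + s' + t ≡ s * t + (s' + t)
  lem = solve-∀
  lem′ : ∀ g t → 2 + g + t ≡ suc t + suc g
  lem′ = solve-∀
... | g₀ , g≡ | no ¬a≤N = extremal s' t₀ s≡ cond g≡
  where
  s≡ : s ≡ s' + t
  s≡ = ≤-antisym (Tree.s≤s'+t s t s' 1≤t bal) (≤-pred (≰⇒> ¬a≤N))
  -- Here s = s' + t. If t ≥ 2, then s ∸ s' = t activates the cubic hypothesis, and s³ - 1 ≤ t ≤ s
  -- is impossible. If t = 1 and s' = 0, then s = 1 and F has a single root, against `many-roots`.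
  -- If t = 1 and s' ≥ 1, the exchanged tree T_{s',1,s} satisfies both s ≤ s' + 1 and s' + 1 ≤ s +
  -- 1, as `edge-bound` requires.
  extremal : ∀ s' t₀ → s ≡ s' + suc t₀ → (2 ≤ s ∸ s' → s ^ 3 ∸ 1 ≤ suc t₀) → 2 + g₀ ≡ suc t₀ * s + s' → ExponentBound s (suc t₀) s' p
  extremal s' (suc t₁) eq cond g≡ = ⊥-elim (cube-large s (2+ t₁) (s≤s (s≤s z≤n)) (≤-trans (m≤n+m _ s') (≤-reflexive (sym eq)))
    (cond (≤-trans (s≤s (s≤s z≤n)) (≤-reflexive (sym (trans (cong (_∸ s') eq) (m+n∸m≡n s' (2+ t₁))))))))
  extremal zero     zero eq cond g≡ = ⊥-elim (1+n≢0 (suc-injective (trans g≡ (trans (+-identityʳ (1 * s)) (trans (+-identityʳ s) eq)))))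
  extremal (suc s₁) zero eq cond g≡ = exponent-bound s 1 (suc s₁) p (suc s₁ * 1 + (s + 1)) (suc g₀) (trans (Tree.eR-T s 1 (suc s₁)) (lem s (suc s₁)))
    (trans (sym (lem s (suc s₁))) (trans (cong (_+ 1) (sym g≡)) (lem′ g₀)))
    (swapped (suc s₁ * 1 + (s + 1)) (suc g₀) (on-graphs (suc s₁ * 1 + (s + 1)) (suc g₀) (edge-bound s₁ 0 s p₀ (suc g₀) (≤-reflexive (trans eq (+-comm (suc s₁) 1))) (≤-trans (≤-reflexive (trans (+-comm 1 (suc s₁)) (sym eq))) (m≤m+n s 1)) (trans (lem″ s (suc s₁)) (sym g≡)) (s≤s z≤n))))
    where
    lem : ∀ s s' → 1 * s + s' + 1 ≡ s' * 1 + (s + 1)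
    lem = solve-∀
    lem′ : ∀ g → 2 + g + 1 ≡ 2 + suc g
    lem′ = solve-∀
    lem″ : ∀ s s' → s' * 1 + s ≡ 1 * s + s'
    lem″ = solve-∀
    swapped : ∀ e g → GraphBound (suc s₁) 1 s p e g → GraphBound s 1 (suc s₁) p e g
    swapped e g (C , bound) = C , λ n G NC → bound n G (λ F → NC (swap-config (SimpleGraph.sym G) (SimpleGraph.irrefl G) F))
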